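{- Let $n$ be an even integer and $m \ge 5$ an integer such that $n \ne 4m$ whenever $m$ is odd. Let $I$ be a 1-factor (perfect matching) of the complete graph $K_n$, and let $K_n+I$ denote the multigraph obtained from $K_n$ by duplicating every edge of $I$. Then $K_n+I$ admits a decomposition into 2-factors each of which is a vertex-disjoint union of cycles of length $m$ (a $C_m$-factorization) if and only if $m$ divides $n$.
   Context: A decomposition of a (multi)graph $G$ is a set of subgraphs whose edge sets partition the edge multiset of $G$. A 2-factor is a spanning 2-regular subgraph; a $C_m$-factor is a 2-factor all of whose components are cycles of length $m$, and a $C_m$-factorization is a decomposition into $C_m$-factors. -}

module Defs where

open import Data.Nat using (ℕ; zero; suc; _+_)
open import Data.Nat.DivMod using (_mod_)
open import Data.Fin using (Fin; toℕ; _≟_)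
open import Data.Fin.Base using (zero; suc)
open import Data.List using (List; map; filter; length; allFin)
open import Data.Nat.ListAction using (sum)
open import Data.Product using (Σ; _×_; proj₁; _,_)
open import Data.Bool using (if_then_else_)
open import Function.Definitions using (Injective)
open import Relation.Binary.PropositionalEquality using (_≡_; _≢_)
open import Relation.Nullary using (¬_)
open import Relation.Nullary.Decidable using (⌊_⌋; _×-dec_; _⊎-dec_)
open import Data.Sum using (_⊎_)

cnext : ∀ {m} → Fin m → Fin m
cnext {suc k} i = suc (toℕ i) mod suc k

record PerfectMatching (n : ℕ) : Set where
  field
    mate      : Fin n → Fin n
    mate-invol : ∀ v → mate (mate v) ≡ v
    mate-nofix : ∀ v → mate v ≢ v
open PerfectMatching public

-- Multiplicity of the edge {u,v} (u ≠ v) in K_n + I.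
multKI : ∀ {n} → PerfectMatching n → Fin n → Fin n → ℕ
multKI I u v = if ⌊ mate I u ≟ v ⌋ then 2 else 1

-- A cycle of length m in a graph on Fin n: an injective cyclic sequence
-- c 0, c 1, ..., c (m-1); its edges are {c i , c (i+1 mod m)}.
Cycle : ℕ → ℕ → Set
Cycle n m = Σ (Fin m → Fin n) Injective'
  where
  Injective' : (Fin m → Fin n) → Set
  Injective' f = Injective _≡_ _≡_ f

vertexOcc : ∀ {n m} → Cycle n m → Fin n → ℕ
vertexOcc {m = m} c v = length (filter (λ i → proj₁ c i ≟ v) (allFin m))

edgeOcc : ∀ {n m} → Cycle n m → Fin n → Fin n → ℕ
edgeOcc {m = m} c u v =
  length (filter (λ i → ((proj₁ c i ≟ u) ×-dec (proj₁ c (cnext i) ≟ v))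
                        ⊎-dec ((proj₁ c i ≟ v) ×-dec (proj₁ c (cnext i) ≟ u)))
                 (allFin m))

record CmFactor (n m : ℕ) : Set where
  field
    cycles   : List (Cycle n m)
    spanning : ∀ v → sum (map (λ c → vertexOcc c v) cycles) ≡ 1
open CmFactor public

factorEdgeMult : ∀ {n m} → CmFactor n m → Fin n → Fin n → ℕ
factorEdgeMult F u v = sum (map (λ c → edgeOcc c u v) (cycles F))

IsCmFactorization : ∀ {n m} → PerfectMatching n → List (CmFactor n m) → Set
IsCmFactorization I D =
  ∀ u v → u ≢ v → sum (map (λ F → factorEdgeMult F u v) D) ≡ multKI I u v

HasCmFactorization : (n m : ℕ) → PerfectMatching n → Set
HasCmFactorization n m I = Σ (List (CmFactor n m)) (IsCmFactorization I)

module Submission where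

-- Counting vertices shows that m divides n.  Conversely, it suffices to find n/2 C_m-factors which cover
-- every pair of vertices: every vertex then has degree n, so exactly one pair at it is covered twice, the
-- pairs covered twice form a perfect matching, and any two perfect matchings are conjugate.
--
-- The factors are translates of a few patterns.  The vertices are Z_N × X, and every cycle follows the
-- zigzag path 0, 1, -1, 2, -2, ... of Z_N on two strands, reflecting X or translating it from level to
-- level.  For even m both ends of the strands are joined within the end levels; for odd m the middle level
-- carries one apex of the cycle, which occupies only the levels on one side of it.  If N is odd, then the
-- path has two edges of each difference, and the patterns are chosen such that the pairs in X which one of
-- them misses are covered by the other one.

open import Defs
open import Data.Bool as Bool using (Bool; true; false; not; if_then_else_; _xor_; _∧_)
open import Data.Bool.Properties using (¬-not; not-involutive; xor-assoc; xor-identityʳ; ∧-identityʳ)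
open import Data.Fin as Fin using (Fin; toℕ; fromℕ; fromℕ<; inject₁; combine; remQuot; splitAt; join)
open import Data.Fin.Properties using (toℕ<n; toℕ-injective; toℕ-fromℕ; toℕ-fromℕ<; toℕ-inject₁; remQuot-combine; combine-remQuot; combine-injective; splitAt-join; all?; any?)
open import Data.List using (List; []; _∷_; map; filter; length; tabulate)
open import Data.Nat as ℕ using (ℕ; zero; suc; pred; NonZero; _≤_; _<_; _∸_; z≤n; s≤s; _≤?_; _<?_; >-nonZero; ≢-nonZero; >-nonZero⁻¹)
open import Data.Nat.Properties hiding (_≟_)
open import Data.Product using (∃; _×_; _,_; proj₁; proj₂)
open import Data.Sum using (_⊎_; inj₁; inj₂; swap)
open import Data.Unit using (tt)
open import Function using (_∘_)
open import Function.Bundles using (_⇔_; mk⇔)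
open import Relation.Binary.Definitions using (Tri; tri<; tri≈; tri>)
open import Relation.Binary.PropositionalEquality
open import Relation.Nullary using (¬_; Dec; yes; no; does; contradiction)
open import Relation.Nullary.Decidable using (map′; toWitness; does-⇔; dec-true; dec-false; _×-dec_; _⊎-dec_; _→-dec_)

-- The n/2 factors have only n/2 edges more than there are pairs, so a pattern has almost no room,
-- and parity decides which patterns exist. For odd N the two edges of equal difference must share
-- the pairs of X between them. Telling the halves apart by sums in a cyclic X works if 4 divides
-- |X|: reflections have to lead the sum of a block from one half to the other, or, for odd m, a
-- Latin square has to be cut into two equal halves. If |X| would be 2 modulo 4, bits take over. For
-- even m, X shrinks to one bit over a longer zigzag, which is cut into segments. For odd m, X
-- consists of Z_s with s odd and a bit; distances in Z_s replace sums, and the pairs which agree in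
-- Z_s form copies of the case of two cycles per factor, supplied by a starter. The remaining
-- difficulty there is that steps by a fixed distance run around cycles of odd length in Z_s, where
-- no alternating choice of bits exists; one special element in each cycle repairs this.

module Counting where

  open import Algebra.Properties.CommutativeMonoid.Sum +-0-commutativeMonoid
    using (sum; ∑-comm; ∑-distrib-+; sum-init-last) renaming (sum-cong-≗ to sum-cong)
  open import Data.Fin using (zero; suc; _≟_)
  import Data.Fin.Properties as Fin
  open import Data.Nat using (_+_; _*_)
  open import Data.Nat.Divisibility using (_∣_; divides)
  open import Data.Nat.DivMod using (_%_; _mod_; m<n⇒m%n≡m; n%n≡0; m%n<n)
  open import Data.Nat.ListAction using () renaming (sum to sumₗ)
  open import Function.Definitions using (Injective)

  -- Indicator sums over finite index sets

  ind : ∀ {p} {P : Set p} → Dec P → ℕ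
  ind d = if does d then 1 else 0

  ind-yes : ∀ {p} {P : Set p} (d : Dec P) → P → ind d ≡ 1
  ind-yes d p rewrite dec-true d p = refl

  ind-no : ∀ {p} {P : Set p} (d : Dec P) → ¬ P → ind d ≡ 0
  ind-no d p rewrite dec-false d p = refl

  ind-cong : ∀ {p q} {P : Set p} {Q : Set q} (d : Dec P) (e : Dec Q) → (P → Q) → (Q → P) → ind d ≡ ind e
  ind-cong (yes p) e f g = sym (ind-yes e (f p))
  ind-cong (no ¬p) e f g = sym (ind-no e (¬p ∘ g))

  sum-const : ∀ n k → sum {n} (λ _ → k) ≡ n * k
  sum-const zero    k = refl
  sum-const (suc n) k = cong (k +_) (sum-const n k)

  sum-zero : ∀ {n} (f : Fin n → ℕ) → (∀ i → f i ≡ 0) → sum f ≡ 0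
  sum-zero {n} f f≡0 = trans (sum-cong f≡0) (trans (sum-const n 0) (*-zeroʳ n))

  term≤sum : ∀ {n} (f : Fin n → ℕ) i → f i ≤ sum f
  term≤sum f zero    = m≤m+n _ _
  term≤sum f (suc i) = ≤-trans (term≤sum (f ∘ suc) i) (m≤n+m _ _)

  two-terms≤sum : ∀ {n} (f : Fin n → ℕ) i j → i ≢ j → f i + f j ≤ sum f
  two-terms≤sum f zero    zero    i≢j = contradiction refl i≢j
  two-terms≤sum f zero    (suc j) i≢j = +-monoʳ-≤ (f zero) (term≤sum (f ∘ suc) j)
  two-terms≤sum f (suc i) zero    i≢j =
    subst (_≤ sum f) (+-comm (f zero) _) (+-monoʳ-≤ (f zero) (term≤sum (f ∘ suc) i))
  two-terms≤sum f (suc i) (suc j) i≢j =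
    ≤-trans (two-terms≤sum (f ∘ suc) i j (i≢j ∘ cong suc)) (m≤n+m _ _)

  sum≡0⇒term≡0 : ∀ {n} (f : Fin n → ℕ) → sum f ≡ 0 → ∀ i → f i ≡ 0
  sum≡0⇒term≡0 f eq i = n≤0⇒n≡0 (subst (f i ≤_) eq (term≤sum f i))

  sum≡1⇒unique-term : ∀ {n} (f : Fin n → ℕ) → sum f ≡ 1 → ∃ λ w → f w ≡ 1 × (∀ v → v ≢ w → f v ≡ 0)
  sum≡1⇒unique-term {suc n} f eq with f zero in eq₀
  ... | suc zero    = zero , eq₀ , λ where
    zero    v≢w → contradiction refl v≢w
    (suc v) _   → sum≡0⇒term≡0 (f ∘ suc) (cong pred eq) v
  ... | suc (suc k) = contradiction (cong pred eq) λ ()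
  ... | zero        = let w , fw , rest = sum≡1⇒unique-term (f ∘ suc) eq in
    suc w , fw , λ where
      zero    _   → eq₀
      (suc v) v≢w → rest v (v≢w ∘ cong suc)

  -- Taking one away from every positive term turns "at least one everywhere, with the least
  -- possible total" into "sum zero", and a surplus of one into a single exceptional term.
  sum-pred : ∀ {n} (f : Fin n → ℕ) → (∀ i → 1 ≤ f i) → sum f ≡ n + sum (pred ∘ f)
  sum-pred {zero}  f f≥1 = refl
  sum-pred {suc n} f f≥1 with f zero | f≥1 zero | sum-pred (f ∘ suc) (f≥1 ∘ suc)
  ... | suc a | _ | eq = cong suc (begin
    a + sum (f ∘ suc)                ≡⟨ cong (a +_) eq ⟩
    a + (n + sum (pred ∘ f ∘ suc))   ≡⟨ +-assoc a n _ ⟨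
    a + n + sum (pred ∘ f ∘ suc)     ≡⟨ cong (_+ sum (pred ∘ f ∘ suc)) (+-comm a n) ⟩
    n + a + sum (pred ∘ f ∘ suc)     ≡⟨ +-assoc n a _ ⟩
    n + (a + sum (pred ∘ f ∘ suc))   ∎)
    where open ≡-Reasoning

  pred≡0 : ∀ {k} → 1 ≤ k → pred k ≡ 0 → k ≡ 1
  pred≡0 (s≤s z≤n) refl = refl

  pred≡1 : ∀ {k} → pred k ≡ 1 → k ≡ 2
  pred≡1 {suc zero} ()
  pred≡1 {suc (suc k)} eq = cong suc eq

  sum-≟ : ∀ {n} (a : Fin n) → sum (λ v → ind (a ≟ v)) ≡ 1
  sum-≟ {suc n} zero    = cong suc (sum-zero (λ v → ind (zero ≟ suc {n} v)) λ _ → refl)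
  sum-≟ (suc a) = trans (sum-cong λ v → ind-cong (suc a ≟ suc v) (a ≟ v) Fin.suc-injective (cong suc)) (sum-≟ a)

  length-filter-tabulate : ∀ {n a p} {A : Set a} {P : A → Set p} (P? : ∀ x → Dec (P x)) (f : Fin n → A) →
    length (filter P? (tabulate f)) ≡ sum (λ i → ind (P? (f i)))
  length-filter-tabulate {zero}  P? f = refl
  length-filter-tabulate {suc n} P? f with does (P? (f zero))
  ... | true  = cong suc (length-filter-tabulate P? (f ∘ suc))
  ... | false = length-filter-tabulate P? (f ∘ suc)

  sum-map-tabulate : ∀ {n a} {A : Set a} (f : A → ℕ) (g : Fin n → A) → sumₗ (map f (tabulate g)) ≡ sum (f ∘ g)
  sum-map-tabulate {zero}  f g = refl
  sum-map-tabulate {suc n} f g = cong (f (g zero) +_) (sum-map-tabulate f (g ∘ suc))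

  cnext-inject₁ : ∀ {k} (i : Fin k) → cnext (inject₁ i) ≡ suc i
  cnext-inject₁ {k} i = toℕ-injective (begin
    toℕ (suc (toℕ (inject₁ i)) mod suc k) ≡⟨ toℕ-fromℕ< (m%n<n (suc (toℕ (inject₁ i))) (suc k)) ⟩
    suc (toℕ (inject₁ i)) % suc k         ≡⟨ cong (λ x → suc x % suc k) (toℕ-inject₁ i) ⟩
    suc (toℕ i) % suc k                   ≡⟨ m<n⇒m%n≡m (s≤s (toℕ<n i)) ⟩
    suc (toℕ i)                           ∎)
    where open ≡-Reasoning

  cnext-fromℕ : ∀ k → cnext (fromℕ k) ≡ zero
  cnext-fromℕ k = toℕ-injective (begin
    toℕ (suc (toℕ (fromℕ k)) mod suc k) ≡⟨ toℕ-fromℕ< (m%n<n (suc (toℕ (fromℕ k))) (suc k)) ⟩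
    suc (toℕ (fromℕ k)) % suc k         ≡⟨ cong (λ x → suc x % suc k) (toℕ-fromℕ k) ⟩
    suc k % suc k                       ≡⟨ n%n≡0 (suc k) ⟩
    0                                   ∎)
    where open ≡-Reasoning

  -- A rotation only moves the first term to the end. It makes the two ends of the edges of a cycle
  -- contribute equally to degrees.
  sum-cnext : ∀ {m} (f : Fin m → ℕ) → sum (f ∘ cnext) ≡ sum f
  sum-cnext {zero}  f = refl
  sum-cnext {suc k} f = begin
    sum (f ∘ cnext)                                          ≡⟨ sum-init-last (f ∘ cnext) ⟩
    sum (f ∘ cnext ∘ inject₁) + f (cnext (fromℕ k))          ≡⟨ cong₂ _+_ (sum-cong λ i → cong f (cnext-inject₁ i))
      (cong f (cnext-fromℕ k)) ⟩
    sum (f ∘ suc) + f zero                                   ≡⟨ +-comm (sum (f ∘ suc)) _ ⟩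
    sum f                                                    ∎
    where open ≡-Reasoning

  cnext≢ : ∀ {m} → 2 ≤ m → (i : Fin m) → cnext i ≢ i
  cnext≢ {suc zero} (s≤s ())
  cnext≢ {suc (suc k)} _ i eq with toℕ i ℕ.≟ suc k
  ... | yes p = contradiction (begin
        0                            ≡⟨ n%n≡0 (suc (suc k)) ⟨
        suc (suc k) % suc (suc k)    ≡⟨ cong (λ x → suc x % suc (suc k)) p ⟨
        suc (toℕ i) % suc (suc k)    ≡⟨ toℕ-fromℕ< (m%n<n (suc (toℕ i)) (suc (suc k))) ⟨
        toℕ (cnext i)                ≡⟨ cong toℕ eq ⟩
        toℕ i                        ≡⟨ p ⟩
        suc k                        ∎) λ ()
    where open ≡-Reasoning
  ... | no ¬p = contradiction (begin
        suc (toℕ i)                  ≡⟨ m<n⇒m%n≡m (s≤s (≤∧≢⇒< (≤-pred (toℕ<n i)) ¬p)) ⟨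
        suc (toℕ i) % suc (suc k)    ≡⟨ toℕ-fromℕ< (m%n<n (suc (toℕ i)) (suc (suc k))) ⟨
        toℕ (cnext i)                ≡⟨ cong toℕ eq ⟩
        toℕ i                        ∎) 1+n≢n
    where open ≡-Reasoning

  Edge? : ∀ {n} (a b u v : Fin n) → Dec ((a ≡ u × b ≡ v) ⊎ (a ≡ v × b ≡ u))
  Edge? a b u v = ((a ≟ u) ×-dec (b ≟ v)) ⊎-dec ((a ≟ v) ×-dec (b ≟ u))

  edge-degree : ∀ {n} (a b u : Fin n) → a ≢ b → sum (λ v → ind (Edge? a b u v)) ≡ ind (a ≟ u) + ind (b ≟ u)
  edge-degree a b u a≢b with a ≟ u | b ≟ u
  ... | yes refl | yes refl = contradiction refl a≢b
  ... | yes refl | no  b≢u  = trans (sum-cong λ v → ind-cong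
    ((yes (refl {x = a}) ×-dec (b ≟ v)) ⊎-dec ((a ≟ v) ×-dec no b≢u)) (b ≟ v)
                                (λ { (inj₁ (_ , e)) → e ; (inj₂ (_ , e)) → contradiction e b≢u }) (λ e → inj₁ (refl , e)))
                                  (sum-≟ b)
  ... | no  a≢u  | yes refl = trans (sum-cong λ v → ind-cong
    ((no a≢u ×-dec (b ≟ v)) ⊎-dec ((a ≟ v) ×-dec yes (refl {x = b}))) (a ≟ v)
                                (λ { (inj₁ (e , _)) → contradiction e a≢u ; (inj₂ (e , _)) → e }) (λ e → inj₂ (e , refl)))
                                  (sum-≟ a)
  ... | no  a≢u  | no  b≢u  = sum-zero _ λ v → ind-no ((no a≢u ×-dec (b ≟ v)) ⊎-dec ((a ≟ v) ×-dec no b≢u))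
                                λ { (inj₁ (e , _)) → a≢u e ; (inj₂ (_ , e)) → b≢u e }

  -- An n-regular multigraph on n vertices which covers every pair has, at each vertex, exactly one doubled edge.
  module DoubledEdges {n : ℕ} (M : Fin n → Fin n → ℕ) (M-sym : ∀ u v → M u v ≡ M v u) (M-diag : ∀ u → M u u ≡ 0)
                      (cover : ∀ u v → u ≢ v → 1 ≤ M u v) (regular : ∀ u → sum (M u) ≡ n) where

    -- Raising the diagonal to one makes all entries of a row positive, and the row sum n + 1 then
    -- leaves an excess of exactly one.
    padded : Fin n → Fin n → ℕ
    padded u v = M u v + ind (u ≟ v)

    padded≥1 : ∀ u v → 1 ≤ padded u v
    padded≥1 u v with u ≟ v
    ... | yes _   = m≤n+m 1 _
    ... | no  u≢v = ≤-trans (cover u v u≢v) (m≤m+n _ 0)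

    excess : ∀ u → sum (pred ∘ padded u) ≡ 1
    excess u = +-cancelˡ-≡ n _ _ (begin
      n + sum (pred ∘ padded u)               ≡⟨ sum-pred (padded u) (padded≥1 u) ⟨
      sum (padded u)                          ≡⟨ ∑-distrib-+ (M u) (λ v → ind (u ≟ v)) ⟩
      sum (M u) + sum (λ v → ind (u ≟ v))     ≡⟨ cong₂ _+_ (regular u) (sum-≟ u) ⟩
      n + 1                                   ∎)
      where open ≡-Reasoning

    partner : ∀ u → ∃ λ w → pred (padded u w) ≡ 1 × (∀ v → v ≢ w → pred (padded u v) ≡ 0)
    partner u = sum≡1⇒unique-term (pred ∘ padded u) (excess u)

    other : Fin n → Fin n
    other u = proj₁ (partner u)

    padded-off : ∀ u v → u ≢ v → padded u v ≡ M u v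
    padded-off u v u≢v = trans (cong (M u v +_) (ind-no (u ≟ v) u≢v)) (+-identityʳ _)

    padded-diag : ∀ u → pred (padded u u) ≡ 0
    padded-diag u = cong pred (cong₂ _+_ (M-diag u) (ind-yes (u ≟ u) refl))

    other≢ : ∀ u → other u ≢ u
    other≢ u eq = contradiction (trans (sym (proj₁ (proj₂ (partner u))))
      (trans (cong (pred ∘ padded u) eq) (padded-diag u))) λ ()

    twice : ∀ u → M u (other u) ≡ 2
    twice u = trans (sym (padded-off u (other u) (other≢ u ∘ sym))) (pred≡1 (proj₁ (proj₂ (partner u))))

    once : ∀ u v → u ≢ v → other u ≢ v → M u v ≡ 1
    once u v u≢v ≢v = trans (sym (padded-off u v u≢v)) (pred≡0 (padded≥1 u v) (proj₂ (proj₂ (partner u)) v (≢v ∘ sym)))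

    other-invol : ∀ u → other (other u) ≡ u
    other-invol u with other (other u) ≟ u
    ... | yes p = p
    -- By symmetry the pair is doubled seen from its other end too; a different partner there would
    -- make it single.
    ... | no ¬p = contradiction (trans (sym (twice u)) (trans (M-sym u (other u)) (once (other u) u (other≢ u) ¬p))) λ ()

    doubled : PerfectMatching n
    doubled = record { mate = other ; mate-invol = other-invol ; mate-nofix = other≢ }

    doubled-spec : ∀ u v → u ≢ v → M u v ≡ multKI doubled u v
    doubled-spec u v u≢v with other u ≟ v
    ... | yes p   = trans (cong (M u) (sym p)) (twice u)
    ... | no  ≢v  = once u v u≢v ≢v

  -- Families of closed sequences and their degrees

  module Sequences {n m t h : ℕ} where

    Vertices : Set
    Vertices = Fin h → Fin t → Fin m → Fin n

    occurrences : Vertices → Fin h → Fin n → ℕ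
    occurrences s F v = sum λ c → sum λ i → ind (s F c i ≟ v)

    multiplicity : Vertices → Fin n → Fin n → ℕ
    multiplicity s u v = sum λ F → sum λ c → sum λ i → ind (Edge? (s F c i) (s F c (cnext i)) u v)

    Spanning : Vertices → Set
    Spanning s = ∀ F v → occurrences s F v ≡ 1

    multiplicity-sym : ∀ s u v → multiplicity s u v ≡ multiplicity s v u
    multiplicity-sym s u v = sum-cong λ F → sum-cong λ c → sum-cong λ i →
      ind-cong (Edge? (s F c i) (s F c (cnext i)) u v) (Edge? (s F c i) (s F c (cnext i)) v u) swap swap

    -- Pigeonhole: the t cycles of a factor have t * m = n places altogether, so once every vertex
    -- is hit, none can be hit twice.
    surjective⇒spanning : n ≡ t * m → (s : Vertices) → (∀ F v → ∃ λ c → ∃ λ i → s F c i ≡ v) → Spanning s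
    surjective⇒spanning n≡tm s surj F v = pred≡0 (occ≥1 v) (sum≡0⇒term≡0 (pred ∘ occurrences s F) preds≡0 v)
      where
      open ≡-Reasoning
      occ≥1 : ∀ v → 1 ≤ occurrences s F v
      occ≥1 v = let c , i , eq = surj F v in
        (≤-trans (≤-reflexive (sym (ind-yes (s F c i ≟ v) eq)))
        (≤-trans (term≤sum (λ i → ind (s F c i ≟ v)) i)
                 (term≤sum (λ c → sum λ i → ind (s F c i ≟ v)) c)))
      total : sum (occurrences s F) ≡ n
      total = begin
        sum (λ v → sum λ c → sum λ i → ind (s F c i ≟ v))  ≡⟨ ∑-comm (λ v c → sum λ i → ind (s F c i ≟ v)) ⟩
        sum (λ c → sum λ v → sum λ i → ind (s F c i ≟ v))  ≡⟨ sum-cong (λ c → ∑-comm λ v i → ind (s F c i ≟ v)) ⟩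
        sum (λ c → sum λ i → sum λ v → ind (s F c i ≟ v))  ≡⟨ sum-cong (λ c → sum-cong λ i → sum-≟ (s F c i)) ⟩
        sum {t} (λ c → sum {m} λ i → 1)                    ≡⟨ sum-cong {t} (λ c → trans (sum-const m 1) (*-identityʳ m)) ⟩
        sum {t} (λ c → m)                                  ≡⟨ sum-const t m ⟩
        t * m                                              ≡⟨ n≡tm ⟨
        n                                                  ∎
      preds≡0 : sum (pred ∘ occurrences s F) ≡ 0
      preds≡0 = +-cancelˡ-≡ n _ _ (trans (sym (sum-pred _ occ≥1)) (trans total (sym (+-identityʳ n))))

    spanning⇒injective : ∀ s → Spanning s → ∀ F c → Injective _≡_ _≡_ (s F c)
    spanning⇒injective s span F c {i} {j} eq with i ≟ j
    ... | yes i≡j = i≡j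
    ... | no  i≢j = contradiction (≤-trans twice (≤-reflexive (span F (s F c j)))) λ { (s≤s ()) }
      where
      f = λ k → ind (s F c k ≟ s F c j)
      twice : 2 ≤ occurrences s F (s F c j)
      twice = ≤-trans (≤-reflexive (sym (cong₂ _+_ (ind-yes (s F c i ≟ s F c j) eq) (ind-yes (s F c j ≟ s F c j) refl))))
             (≤-trans (two-terms≤sum f i j i≢j) (term≤sum (λ c → sum λ k → ind (s F c k ≟ _)) c))

    module _ (2≤m : 2 ≤ m) (s : Vertices) (span : Spanning s) where

      distinct-ends : ∀ F c i → s F c i ≢ s F c (cnext i)
      distinct-ends F c i eq = cnext≢ 2≤m i (sym (spanning⇒injective s span F c eq))

      no-loops : ∀ u → multiplicity s u u ≡ 0
      no-loops u = sum-zero _ λ F → sum-zero _ λ c → sum-zero _ λ i → ind-no (Edge? (s F c i) (s F c (cnext i)) u u)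
        λ { (inj₁ (p , q)) → distinct-ends F c i (trans p (sym q)) ; (inj₂ (p , q)) → distinct-ends F c i (trans p (sym q))
          }

      -- Each factor visits u once, and the visit contributes the edge leaving u and the edge
      -- entering it.
      total-degree : ∀ u → sum (multiplicity s u) ≡ h * 2
      total-degree u = begin
        sum (multiplicity s u)
          ≡⟨ ∑-comm (λ v F → sum λ c → sum λ i → E F c i v) ⟩
        sum (λ F → sum λ v → sum λ c → sum λ i → E F c i v)
          ≡⟨ sum-cong (λ F → trans (∑-comm λ v c → sum λ i → E F c i v) (sum-cong λ c → ∑-comm λ v i → E F c i v)) ⟩
        sum (λ F → sum λ c → sum λ i → sum λ v → E F c i v)
          ≡⟨ sum-cong (λ F → sum-cong λ c → sum-cong λ i → edge-degree (s F c i) (s F c (cnext i)) u (distinct-ends F c i))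
            ⟩
        sum (λ F → sum λ c → sum λ i → O F c i + O F c (cnext i))
          ≡⟨ sum-cong (λ F → sum-cong λ c → ∑-distrib-+ (O F c) (O F c ∘ cnext)) ⟩
        sum (λ F → sum λ c → sum (O F c) + sum (O F c ∘ cnext))
          ≡⟨ sum-cong (λ F → sum-cong λ c → cong (sum (O F c) +_) (sum-cnext (O F c))) ⟩
        sum (λ F → sum λ c → sum (O F c) + sum (O F c))
          ≡⟨ sum-cong (λ F → ∑-distrib-+ (λ c → sum (O F c)) (λ c → sum (O F c))) ⟩
        sum (λ F → occurrences s F u + occurrences s F u)
          ≡⟨ sum-cong (λ F → cong₂ _+_ (span F u) (span F u)) ⟩
        sum {h} (λ F → 2)
          ≡⟨ sum-const h 2 ⟩
        h * 2 ∎
        where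
        open ≡-Reasoning
        E = λ F c i v → ind (Edge? (s F c i) (s F c (cnext i)) u v)
        O = λ F c i → ind (s F c i ≟ u)

      Covering : Set
      Covering = ∀ u v → u ≢ v → 1 ≤ multiplicity s u v

      module _ (n≡2h : n ≡ h * 2) (cover : Covering) where

        doubled-edges : ∃ λ I → ∀ u v → u ≢ v → multiplicity s u v ≡ multKI I u v
        doubled-edges = DoubledEdges.doubled (multiplicity s) (multiplicity-sym s) no-loops cover
          (λ u → trans (total-degree u) (sym n≡2h)) ,
                        DoubledEdges.doubled-spec (multiplicity s) (multiplicity-sym s) no-loops cover
                          (λ u → trans (total-degree u) (sym n≡2h))

  -- Conjugating perfect matchings

  multKI≡ : ∀ {n} (I : PerfectMatching n) u v → multKI I u v ≡ suc (ind (mate I u ≟ v))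
  multKI≡ I u v with mate I u ≟ v
  ... | yes _ = refl
  ... | no  _ = refl

  conjugate : ∀ {n} (τ : Fin n → Fin n) → (∀ v → τ (τ v) ≡ v) → PerfectMatching n → PerfectMatching n
  conjugate τ ττ I = record
    { mate       = λ v → τ (mate I (τ v))
    ; mate-invol = λ v → trans (cong (τ ∘ mate I) (ττ _)) (trans (cong τ (mate-invol I _)) (ττ v))
    ; mate-nofix = λ v eq → mate-nofix I (τ v) (trans (sym (ττ _)) (cong τ eq))
    }

  module _ {n : ℕ} (a b : Fin n) where

    exchange : Fin n → Fin n
    exchange v with v ≟ a | v ≟ b
    ... | yes _ | _     = b
    ... | no  _ | yes _ = a
    ... | no  _ | no  _ = v

    exchange-left : exchange a ≡ b
    exchange-left with a ≟ a
    ... | yes _   = refl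
    ... | no  a≢a = contradiction refl a≢a

    exchange-right : exchange b ≡ a
    exchange-right with b ≟ a | b ≟ b
    ... | yes b≡a | _       = b≡a
    ... | no  _   | yes _   = refl
    ... | no  _   | no  b≢b = contradiction refl b≢b

    exchange-other : ∀ {v} → v ≢ a → v ≢ b → exchange v ≡ v
    exchange-other {v} v≢a v≢b with v ≟ a | v ≟ b
    ... | yes p | _     = contradiction p v≢a
    ... | no  _ | yes p = contradiction p v≢b
    ... | no  _ | no  _ = refl

    exchange-invol : ∀ v → exchange (exchange v) ≡ v
    exchange-invol v = case (v ≟ a) (v ≟ b)
      where
      case : Dec (v ≡ a) → Dec (v ≡ b) → exchange (exchange v) ≡ v
      case (yes refl) _          = trans (cong exchange exchange-left) exchange-right
      case (no _)     (yes refl) = trans (cong exchange exchange-right) exchange-left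
      case (no v≢a)   (no v≢b)   = trans (cong exchange (exchange-other v≢a v≢b)) (exchange-other v≢a v≢b)

  module Relabelling {n m t h : ℕ} where
    open Sequences {n} {m} {t} {h}

    Realises : Vertices → PerfectMatching n → Set
    Realises s I = Spanning s × (∀ u v → u ≢ v → multiplicity s u v ≡ multKI I u v)

    Realisable : PerfectMatching n → Set
    Realisable I = ∃ λ s → Realises s I

    relabel : ∀ τ (ττ : ∀ v → τ (τ v) ≡ v) I → Realisable I → Realisable (conjugate τ ττ I)
    relabel τ ττ I (s , span , mult) = (λ F c i → τ (s F c i)) , span′ , mult′
      where
      open ≡-Reasoning
      move : ∀ {x v} → τ x ≡ v → x ≡ τ v
      move eq = trans (sym (ττ _)) (cong τ eq)
      move⁻¹ : ∀ {x v} → x ≡ τ v → τ x ≡ v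
      move⁻¹ eq = trans (cong τ eq) (ττ _)
      span′ : ∀ F v → _
      span′ F v = trans (sum-cong λ c → sum-cong λ i → ind-cong (τ (s F c i) ≟ v) (s F c i ≟ τ v) move move⁻¹)
        (span F (τ v))
      mult′ : ∀ u v → u ≢ v → _
      mult′ u v u≢v = begin
        sum (λ F → sum λ c → sum λ i → ind (Edge? (τ (s F c i)) (τ (s F c (cnext i))) u v))
          ≡⟨ (sum-cong λ F → sum-cong λ c → sum-cong λ i →
               ind-cong (Edge? (τ (s F c i)) (τ (s F c (cnext i))) u v) (Edge? (s F c i) (s F c (cnext i)) (τ u) (τ v))
                 (λ { (inj₁ (p , q)) → inj₁ (move p , move q) ; (inj₂ (p , q)) → inj₂ (move p , move q) })
                 (λ { (inj₁ (p , q)) → inj₁ (move⁻¹ p , move⁻¹ q) ; (inj₂ (p , q)) → inj₂ (move⁻¹ p , move⁻¹ q) })) ⟩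
        multiplicity s (τ u) (τ v)                   ≡⟨ mult (τ u) (τ v)
          (λ eq → u≢v (trans (sym (ττ u)) (trans (cong τ eq) (ττ v)))) ⟩
        multKI I (τ u) (τ v)                         ≡⟨ multKI≡ I (τ u) (τ v) ⟩
        suc (ind (mate I (τ u) ≟ τ v))               ≡⟨ cong suc
          (ind-cong (mate I (τ u) ≟ τ v) (τ (mate I (τ u)) ≟ v) move⁻¹ move) ⟩
        suc (ind (τ (mate I (τ u)) ≟ v))             ≡⟨ multKI≡ (conjugate τ ττ I) u v ⟨
        multKI (conjugate τ ττ I) u v                ∎

    -- Conjugating by the exchange of the two partners of v makes the matchings agree at v and
    -- keeps every agreement made before.
    realise-prefix : ∀ J I → Realisable J → ∀ k → k ≤ n → ∃ λ K → Realisable K × (∀ u → toℕ u < k → mate K u ≡ mate I u)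
    realise-prefix J I R zero    _   = J , R , λ _ ()
    realise-prefix J I R (suc k) k<n with realise-prefix J I R k (<⇒≤ k<n)
    ... | K , R′ , agree = conjugate τ ττ K , relabel τ ττ K R′ , agree′
      where
      v = fromℕ< k<n

      a = mate K v
      b = mate I v
      τ = exchange a b
      ττ = exchange-invol a b
      at-v : ∀ {u} → u ≡ v → τ (mate K (τ u)) ≡ mate I u
      at-v refl = trans (cong (τ ∘ mate K) (exchange-other a b (mate-nofix K v ∘ sym) (mate-nofix I v ∘ sym)))
        (exchange-left a b)
      agree′ : ∀ u → toℕ u < suc k → τ (mate K (τ u)) ≡ mate I u
      agree′ u u<1+k with u ≟ v
      ... | yes u≡v = at-v u≡v
      ... | no  u≢v = old (agree u (≤∧≢⇒< (≤-pred u<1+k) λ eq → u≢v (toℕ-injective (trans eq (sym (toℕ-fromℕ< k<n))))))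
        (u ≟ a) (u ≟ b)
        where
        v≢a = mate-nofix K v ∘ sym
        v≢b = mate-nofix I v ∘ sym
        old : mate K u ≡ mate I u → Dec (u ≡ a) → Dec (u ≡ b) → τ (mate K (τ u)) ≡ mate I u
        -- If u is one of the two partners of v, then the earlier agreement at u makes it the other
        -- one as well; so `a` equals `b` and the exchange moves nothing.
        old eq (yes p) _ = trans (cong (τ ∘ mate K) (trans (cong τ p) (trans (exchange-left a b) (sym u≡b))))
                           (trans (cong τ Ku≡v) (trans (exchange-other a b v≢a v≢b) (trans (sym Ku≡v) eq)))
          where
          Ku≡v = trans (cong (mate K) p) (mate-invol K v)
          u≡b : u ≡ b
          u≡b = trans (sym (mate-invol I u)) (cong (mate I) (trans (sym eq) Ku≡v))
        old eq _ (yes p) = trans (cong (τ ∘ mate K) (trans (cong τ p) (trans (exchange-right a b) (sym u≡a))))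
                           (trans (cong τ (trans eq Iu≡v)) (trans (exchange-other a b v≢a v≢b) (sym Iu≡v)))
          where
          Iu≡v = trans (cong (mate I) p) (mate-invol I v)
          u≡a : u ≡ a
          u≡a = trans (sym (mate-invol K u)) (cong (mate K) (trans eq Iu≡v))
        -- Otherwise the partner of u is not moved either, since only v is matched to `a` in `K` and
        -- only v to `b` in `I`.
        old eq (no u≢a) (no u≢b) = trans (cong (τ ∘ mate K) (exchange-other a b u≢a u≢b))
          (trans (exchange-other a b
              (λ r → u≢v (trans (sym (mate-invol K u)) (trans (cong (mate K) r) (mate-invol K v))))
              (λ r → u≢v (trans (sym (mate-invol I u)) (trans (cong (mate I) (trans (sym eq) r)) (mate-invol I v)))))
            eq)

    realise-any : ∀ J I → Realisable J → Realisable I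
    realise-any J I R with realise-prefix J I R n ≤-refl
    ... | K , (s , span , mult) , agree = s , span , λ u v u≢v → trans (mult u v u≢v)
      (trans (multKI≡ K u v) (trans (cong (λ w → suc (ind (w ≟ v))) (agree u (toℕ<n u))) (sym (multKI≡ I u v))))

    realisable⇒factorization : ∀ I → Realisable I → HasCmFactorization n m I
    realisable⇒factorization I (s , span , mult) = tabulate factor , λ u v u≢v → trans (edges u v) (mult u v u≢v)
      where
      cycle : Fin h → Fin t → Cycle n m
      cycle F c = s F c , spanning⇒injective s span F c
      factor : Fin h → CmFactor n m
      factor F = record
        { cycles   = tabulate (cycle F)
        ; spanning = λ v → trans (sum-map-tabulate (λ c → vertexOcc c v) (cycle F))
            (trans (sum-cong λ c → length-filter-tabulate (λ i → s F c i ≟ v) (λ i → i)) (span F v))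
        }
      edges : ∀ u v → sumₗ (map (λ F → factorEdgeMult F u v) (tabulate factor)) ≡ multiplicity s u v
      edges u v = trans (sum-map-tabulate (λ F → factorEdgeMult F u v) factor)
        (sum-cong λ F → trans (sum-map-tabulate (λ c → edgeOcc c u v) (cycle F))
          (sum-cong λ c → length-filter-tabulate (λ i → Edge? (s F c i) (s F c (cnext i)) u v) (λ i → i)))

  -- Divisibility: counting the vertices of one factor

  vertices-of-cycle : ∀ {n m} (c : Cycle n m) → sum (vertexOcc c) ≡ m
  vertices-of-cycle {n} {m} c = begin
    sum (λ v → vertexOcc c v)                                  ≡⟨
      (sum-cong λ v → length-filter-tabulate (λ i → proj₁ c i ≟ v) (λ i → i)) ⟩
    sum (λ v → sum λ i → ind (proj₁ c i ≟ v))                  ≡⟨ ∑-comm (λ v i → ind (proj₁ c i ≟ v)) ⟩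
    sum (λ i → sum λ v → ind (proj₁ c i ≟ v))                  ≡⟨ (sum-cong λ i → sum-≟ (proj₁ c i)) ⟩
    sum {m} (λ i → 1)                                          ≡⟨ sum-const m 1 ⟩
    m * 1                                                      ≡⟨ *-identityʳ m ⟩
    m                                                          ∎
    where open ≡-Reasoning

  vertices-of-cycles : ∀ {n m} (cs : List (Cycle n m)) → sum (λ v → sumₗ (map (λ c → vertexOcc c v) cs)) ≡ length cs * m
  vertices-of-cycles {n} [] = trans (sum-const n 0) (*-zeroʳ n)
  vertices-of-cycles {n} (c ∷ cs) = trans (∑-distrib-+ (vertexOcc c) (λ v → sumₗ (map (λ c → vertexOcc c v) cs)))
    (cong₂ _+_ (vertices-of-cycle c) (vertices-of-cycles cs))

  factor⇒divides : ∀ {n m} → CmFactor n m → m ∣ n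
  factor⇒divides {n} F = divides (length (cycles F)) (begin
    n                                                          ≡⟨ *-identityʳ n ⟨
    n * 1                                                      ≡⟨ sum-const n 1 ⟨
    sum {n} (λ _ → 1)                                          ≡⟨ (sum-cong λ v → sym (spanning F v)) ⟩
    sum (λ v → sumₗ (map (λ c → vertexOcc c v) (cycles F)))    ≡⟨ vertices-of-cycles (cycles F) ⟩
    length (cycles F) * _                                      ∎)
    where open ≡-Reasoning

  factorization⇒divides : ∀ {n m} (I : PerfectMatching n) → HasCmFactorization n m I → m ∣ n
  factorization⇒divides {zero}  I _             = divides 0 refl
  -- There is a factor to count in, because an empty decomposition would miss the edge of `I` at
  -- vertex zero.
  factorization⇒divides {suc n} I ([] , eq)     = contradiction
    (trans (eq zero (mate I zero) (mate-nofix I zero ∘ sym)) (multKI≡ I zero (mate I zero))) λ ()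
  factorization⇒divides {suc n} I (F ∷ _ , _)   = factor⇒divides F

  -- Covers, and the factorizations they yield

  record Enumeration (A : Set) (k : ℕ) : Set where
    field
      at   : Fin k → A
      onto : ∀ a → ∃ λ i → at i ≡ a
  open Enumeration

  enum-Fin : ∀ {k} → Enumeration (Fin k) k
  enum-Fin = record { at = λ i → i ; onto = λ i → i , refl }

  enum-Bool : Enumeration Bool 2
  enum-Bool = record { at = λ { zero → false ; (suc _) → true } ; onto = λ { false → zero , refl ; true → suc zero , refl }
    }

  enum-× : ∀ {A B k l} → Enumeration A k → Enumeration B l → Enumeration (A × B) (k * l)
  enum-× {A} {B} {k} {l} EA EB = record
    { at   = λ i → pair (remQuot {k} l i)
    ; onto = λ { (a , b) → let i , p = onto EA a ; j , q = onto EB b in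
        combine i j , trans (cong pair (remQuot-combine i j)) (cong₂ _,_ p q) }
    }
    where
    pair : Fin k × Fin l → A × B
    pair (i , j) = at EA i , at EB j

  enum-⊎ : ∀ {A B k l} → Enumeration A k → Enumeration B l → Enumeration (A ⊎ B) (k + l)
  enum-⊎ {A} {B} {k} {l} EA EB = record { at = λ i → f (splitAt k i) ; onto = g }
    where
    f : Fin k ⊎ Fin l → A ⊎ B
    f (inj₁ i) = inj₁ (at EA i)
    f (inj₂ j) = inj₂ (at EB j)
    g : ∀ a → ∃ λ i → f (splitAt k i) ≡ a
    g (inj₁ a) = let i , p = onto EA a in join k l (inj₁ i) , trans (cong f (splitAt-join k l (inj₁ i))) (cong inj₁ p)
    g (inj₂ b) = let j , q = onto EB b in join k l (inj₂ j) , trans (cong f (splitAt-join k l (inj₂ j))) (cong inj₂ q)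

  module _ {V A : Set} (enc : V → A) where

    infix 4 _~_
    _~_ : V → V → Set
    u ~ v = enc u ≡ enc v

    -- Vertices are compared only through `enc`, so that integer coordinates can stand for residues
    -- without being normalised.
    data Consecutive (m : ℕ) (s : ℕ → V) (u v : V) : Set where
      next : ∀ i → suc i < m → s i ~ u → s (suc i) ~ v → Consecutive m s u v
      wrap : ∀ i → suc i ≡ m → s i ~ u → s 0 ~ v → Consecutive m s u v

    Adjacent : (m : ℕ) (s : ℕ → V) (u v : V) → Set
    Adjacent m s u v = Consecutive m s u v ⊎ Consecutive m s v u

  -- Neither the coordinates of a vertex nor the names of factors and cycles need to be unique, and
  -- pairs may be covered repeatedly: counting shows afterwards how often everything occurs.
  record Cover (n m t h : ℕ) : Set₁ where
    field
      Vertex Factor Part : Set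
      enc      : Vertex → Fin n
      enc-onto : ∀ w → ∃ λ v → enc v ≡ w
      factors  : Enumeration Factor h
      parts    : Enumeration Part t
      path     : Factor → Part → ℕ → Vertex
      spans    : ∀ F v → ∃ λ c → ∃ λ i → i < m × enc (path F c i) ≡ enc v
      covers   : ∀ u v → enc u ≢ enc v → ∃ λ F → ∃ λ c → Adjacent enc m (path F c) u v

  cnext-suc : ∀ {m i} (p : i < m) (q : suc i < m) → cnext (fromℕ< p) ≡ fromℕ< q
  cnext-suc {suc k} {i} p (s≤s q) = trans (cong cnext (toℕ-injective
    (trans (toℕ-fromℕ< p) (trans (sym (toℕ-fromℕ< q)) (sym (toℕ-inject₁ (fromℕ< q)))))))
    (cnext-inject₁ (fromℕ< q))

  cnext-wrap : ∀ {m i} (p : i < m) → suc i ≡ m → (q : 0 < m) → cnext (fromℕ< p) ≡ fromℕ< q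
  cnext-wrap {suc k} p refl (s≤s q) = trans (cong cnext (toℕ-injective (trans (toℕ-fromℕ< p) (sym (toℕ-fromℕ k)))))
    (cnext-fromℕ k)

  cover⇒factorization : ∀ {n m t h} → Cover n m t h → n ≡ t * m → n ≡ h * 2 → 2 ≤ m → ∀ I → HasCmFactorization n m I
  cover⇒factorization {n} {m} {t} {h} C n≡tm n≡2h 2≤m I = realisable⇒factorization I
    (realise-any (proj₁ doubled) I (s , span , proj₂ doubled))
    where
    open Cover C
    open Sequences {n} {m} {t} {h}
    open Relabelling {n} {m} {t} {h}

    s : Vertices
    s F c i = enc (path (at factors F) (at parts c) (toℕ i))

    0<m : 0 < m
    0<m = ≤-trans (s≤s z≤n) 2≤m

    span : Spanning s
    span = surjective⇒spanning n≡tm s λ F w →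
      let v , v≡w = enc-onto w
          c , i , i<m , eq = spans (at factors F) v
          c′ , c≡ = onto parts c
      in c′ , fromℕ< i<m , trans (cong₂ (λ c i → enc (path (at factors F) c i)) c≡ (toℕ-fromℕ< i<m)) (trans eq v≡w)

    consecutive : ∀ {F c u v} → Consecutive enc m (path F c) u v →
      ∃ λ F → ∃ λ c → ∃ λ i → s F c i ≡ enc u × s F c (cnext i) ≡ enc v
    consecutive {F} {c} (next i 1+i<m p q) =
      let F′ , F≡ = onto factors F
          c′ , c≡ = onto parts c
          i<m = ≤-trans (n≤1+n _) 1+i<m
          to = λ {j k} (p : j ≡ k) → cong (λ (F , c , j) → enc (path F c j)) (cong₂ _,_ F≡ (cong₂ _,_ c≡ p))
      in F′ , c′ , fromℕ< i<m , trans (to (toℕ-fromℕ< i<m)) p ,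
         trans (cong (s F′ c′) (cnext-suc i<m 1+i<m)) (trans (to (toℕ-fromℕ< 1+i<m)) q)
    consecutive {F} {c} (wrap i 1+i≡m p q) =
      let F′ , F≡ = onto factors F
          c′ , c≡ = onto parts c
          i<m = ≤-reflexive 1+i≡m
          to = λ {j k} (p : j ≡ k) → cong (λ (F , c , j) → enc (path F c j)) (cong₂ _,_ F≡ (cong₂ _,_ c≡ p))
      in F′ , c′ , fromℕ< i<m , trans (to (toℕ-fromℕ< i<m)) p ,
         trans (cong (s F′ c′) (cnext-wrap i<m 1+i≡m 0<m)) (trans (to (toℕ-fromℕ< 0<m)) q)

    edge⇒positive : ∀ u v F c i → (s F c i ≡ u × s F c (cnext i) ≡ v) ⊎ (s F c i ≡ v × s F c (cnext i) ≡ u) →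
      1 ≤ multiplicity s u v
    edge⇒positive u v F c i e = ≤-trans (≤-reflexive (sym (ind-yes (Edge? (s F c i) (s F c (cnext i)) u v) e)))
      (≤-trans (term≤sum (λ i → ind (Edge? (s F c i) (s F c (cnext i)) u v)) i)
      (≤-trans (term≤sum (λ c → sum λ i → ind (Edge? (s F c i) (s F c (cnext i)) u v)) c)
               (term≤sum (λ F → sum λ c → sum λ i → ind (Edge? (s F c i) (s F c (cnext i)) u v)) F)))

    covering : ∀ u v → u ≢ v → 1 ≤ multiplicity s u v
    covering u v u≢v with enc-onto u | enc-onto v
    ... | a , refl | b , refl with covers a b u≢v
    ...   | F , c , inj₁ e = let F , c , i , p , q = consecutive e in edge⇒positive (enc a) (enc b) F c i (inj₁ (p , q))
    ...   | F , c , inj₂ e = let F , c , i , p , q = consecutive e in edge⇒positive (enc a) (enc b) F c i (inj₂ (p , q))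

    doubled = doubled-edges 2≤m s span n≡2h covering

-- Closed walks assembled from strands

module Walks where

  open Counting
  open import Data.Nat using (_+_)

  module _ {V A : Set} {enc : V → A} where

    Consecutive-resp : ∀ {m s a b u v} → Consecutive enc m s a b → enc a ≡ enc u → enc b ≡ enc v → Consecutive enc m s u v
    Consecutive-resp (next i l p q) e f = next i l (trans p e) (trans q f)
    Consecutive-resp (wrap i l p q) e f = wrap i l (trans p e) (trans q f)

    Adjacent-resp : ∀ {m s a b u v} → Adjacent enc m s a b → enc a ≡ enc u → enc b ≡ enc v → Adjacent enc m s u v
    Adjacent-resp (inj₁ c) e f = inj₁ (Consecutive-resp c e f)
    Adjacent-resp (inj₂ c) e f = inj₂ (Consecutive-resp c f e)

  -- The cycle which runs through a 0, ..., a (p - 1) and returns through b (q - 1), ..., b 0.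
  module TwoStrands {V A : Set} (enc : V → A) (p q : ℕ) (a b : ℕ → V) where

    walk : ℕ → V
    walk i with i <? p
    ... | yes _ = a i
    ... | no  _ = b (q ∸ suc (i ∸ p))

    walk-a : ∀ {i} → i < p → walk i ≡ a i
    walk-a {i} i<p with i <? p
    ... | yes _   = refl
    ... | no  i≮p = contradiction i<p i≮p

    walk-b : ∀ j r → suc j + r ≡ q → walk (p + r) ≡ b j
    walk-b j r eq with p + r <? p
    ... | yes lt = contradiction (m≤m+n p r) (<⇒≱ lt)
    ... | no  _  = cong b (trans (cong₂ (λ q r → q ∸ suc r) (sym eq) (m+n∸m≡n p r))
                          (m+n∸n≡m j r))

    p+r<m : ∀ j r → suc j + r ≡ q → p + r < p + q
    p+r<m j r eq = +-monoʳ-< p (≤-trans (s≤s (m≤n+m r j)) (≤-reflexive eq))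

    on-a : ∀ {i} → i < p → ∃ λ k → k < p + q × enc (walk k) ≡ enc (a i)
    on-a {i} i<p = i , ≤-trans i<p (m≤m+n p q) , cong enc (walk-a i<p)

    on-b : ∀ {j} → j < q → ∃ λ k → k < p + q × enc (walk k) ≡ enc (b j)
    on-b {j} j<q = p + (q ∸ suc j) , p+r<m j _ (m+[n∸m]≡n j<q) , cong enc (walk-b j _ (m+[n∸m]≡n j<q))

    along-a : ∀ {i} → suc i < p → Adjacent enc (p + q) walk (a i) (a (suc i))
    along-a {i} lt = inj₁ (next i (≤-trans lt (m≤m+n p q)) (cong enc (walk-a (≤-trans (n≤1+n _) lt)))
      (cong enc (walk-a lt)))

    along-b : ∀ {j} → suc j < q → Adjacent enc (p + q) walk (b j) (b (suc j))
    along-b {j} lt = inj₂ (next (p + r) (subst (_< p + q) (+-suc p r) (p+r<m j (suc r) eq′))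
      (cong enc (walk-b (suc j) r eq))
      (cong enc (trans (cong walk (sym (+-suc p r))) (walk-b j (suc r) eq′))))
      where
      r = q ∸ suc (suc j)
      eq : suc (suc j) + r ≡ q
      eq = m+[n∸m]≡n lt
      eq′ : suc j + suc r ≡ q
      eq′ = trans (+-suc (suc j) r) eq

    ends : ∀ {i j} → suc i ≡ p → suc j ≡ q → Adjacent enc (p + q) walk (a i) (b j)
    ends {i} {j} refl refl = inj₁ (next i (s≤s (≤-trans (≤-reflexive (sym (+-identityʳ _))) (+-monoʳ-< i (s≤s z≤n))))
      (cong enc (walk-a ≤-refl))
      (cong enc (trans (cong walk (sym (+-identityʳ (suc i)))) (walk-b j 0 (+-identityʳ _)))))

    starts : 0 < p → 0 < q → Adjacent enc (p + q) walk (a 0) (b 0)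
    starts 0<p 0<q = inj₂ (wrap (p + (q ∸ 1)) (trans (sym (+-suc p _)) (cong (p +_) (m+[n∸m]≡n 0<q)))
      (cong enc (walk-b 0 _ (m+[n∸m]≡n 0<q))) (cong enc (walk-a 0<p)))

  -- With equally many levels on both strands the closed walk is symmetric under exchanging them;
  -- `bottom` and `top` are its two closing edges.
  module DoubleStrand {V A : Set} (enc : V → A) (μ : ℕ) (level : Bool → ℕ → V) where

    open TwoStrands enc μ μ (level false) (level true) public

    on : ∀ s {i} → i < μ → ∃ λ k → k < μ + μ × enc (walk k) ≡ enc (level s i)
    on false = on-a
    on true  = on-b

    along : ∀ s {i} → suc i < μ → Adjacent enc (μ + μ) walk (level s i) (level s (suc i))
    along false = along-a
    along true  = along-b

    bottom : ∀ s → 0 < μ → Adjacent enc (μ + μ) walk (level s 0) (level (not s) 0)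
    bottom false 0<μ = starts 0<μ 0<μ
    bottom true  0<μ = swap (starts 0<μ 0<μ)

    top : ∀ s {i} → suc i ≡ μ → Adjacent enc (μ + μ) walk (level s i) (level (not s) i)
    top false eq = ends eq eq
    top true  eq = swap (ends eq eq)

  -- The cycle which starts at an apex, follows level false outwards and returns along level true.
  module ApexWalk {V A : Set} (enc : V → A) (f : ℕ) (apex : V) (level : Bool → ℕ → V) where

    outward : ℕ → V
    outward zero    = apex
    outward (suc o) = level false o

    open TwoStrands enc (suc (suc f)) (suc f) outward (level true) public using (walk)
    private open module S = TwoStrands enc (suc (suc f)) (suc f) outward (level true) using
              (on-a; on-b; along-a; along-b; ends; starts)

    m = suc (suc f) + suc f

    on-apex : ∃ λ k → k < m × enc (walk k) ≡ enc apex
    on-apex = on-a (s≤s z≤n)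

    on : ∀ s {o} → o < suc f → ∃ λ k → k < m × enc (walk k) ≡ enc (level s o)
    on false lt = on-a (s≤s lt)
    on true  lt = on-b lt

    spoke : ∀ s → Adjacent enc m walk apex (level s 0)
    spoke false = along-a (s≤s (s≤s z≤n))
    spoke true  = starts (s≤s z≤n) (s≤s z≤n)

    along : ∀ s {o} → o < f → Adjacent enc m walk (level s o) (level s (suc o))
    along false lt = along-a (s≤s (s≤s lt))
    along true  lt = along-b (s≤s lt)

    rim : ∀ s → Adjacent enc m walk (level s f) (level (not s) f)
    rim false = ends refl refl
    rim true  = swap (ends refl refl)

  -- Unlike in `TwoStrands`, both runs are traversed forwards. The length `m` is kept apart from
  -- `p + q` because the two cycles of a starter split the same `m` differently.
  module Concatenated {V A : Set} (enc : V → A) (p q m : ℕ) (p+q≡m : p + q ≡ m) (a b : ℕ → V) where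

    walk : ℕ → V
    walk i with i <? p
    ... | yes _ = a i
    ... | no  _ = b (i ∸ p)

    walk-a : ∀ {i} → i < p → walk i ≡ a i
    walk-a {i} i<p with i <? p
    ... | yes _   = refl
    ... | no  i≮p = contradiction i<p i≮p

    walk-b : ∀ r → walk (p + r) ≡ b r
    walk-b r with p + r <? p
    ... | yes lt = contradiction (m≤m+n p r) (<⇒≱ lt)
    ... | no  _  = cong b (m+n∸m≡n p r)

    p+r<m : ∀ {r} → r < q → p + r < m
    p+r<m lt = <-≤-trans (+-monoʳ-< p lt) (≤-reflexive p+q≡m)

    p≤m : p ≤ m
    p≤m = ≤-trans (m≤m+n p q) (≤-reflexive p+q≡m)

    on-a : ∀ {i} → i < p → ∃ λ k → k < m × enc (walk k) ≡ enc (a i)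
    on-a {i} lt = i , <-≤-trans lt p≤m , cong enc (walk-a lt)

    on-b : ∀ {r} → r < q → ∃ λ k → k < m × enc (walk k) ≡ enc (b r)
    on-b {r} lt = p + r , p+r<m lt , cong enc (walk-b r)

    along-a : ∀ {i} → suc i < p → Adjacent enc m walk (a i) (a (suc i))
    along-a {i} lt = inj₁ (next i (<-≤-trans lt p≤m) (cong enc (walk-a (<-trans (n<1+n i) lt))) (cong enc (walk-a lt)))

    along-b : ∀ {r} → suc r < q → Adjacent enc m walk (b r) (b (suc r))
    along-b {r} lt = inj₁ (next (p + r) (subst (_< m) (+-suc p r) (p+r<m lt)) (cong enc (walk-b r))
      (cong enc (trans (cong walk (sym (+-suc p r))) (walk-b (suc r)))))

    joint : ∀ {i} → suc i ≡ p → 0 < q → Adjacent enc m walk (a i) (b 0)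
    joint {i} eq 0<q = inj₁ (next i (subst (_< m) (trans (+-identityʳ p) (sym eq)) (p+r<m 0<q))
      (cong enc (walk-a (≤-reflexive eq)))
      (cong enc (trans (cong walk (trans eq (sym (+-identityʳ p)))) (walk-b 0))))

    close : ∀ {r} → suc r ≡ q → 0 < p → Adjacent enc m walk (b r) (a 0)
    close {r} eq 0<p = inj₁ (wrap (p + r) (trans (sym (+-suc p r)) (trans (cong (p +_) eq) p+q≡m)) (cong enc (walk-b r))
      (cong enc (walk-a 0<p)))

-- Covers from zigzags over cyclic groups

module Constructions where

  open Counting
  open Walks
  open import Data.Integer using (ℤ; +_; 0ℤ; 1ℤ; _+_; _*_; -_; _-_)
  import Data.Integer.Properties as ℤ
  open import Data.Integer.Properties using (pos-+; pos-*)
  open import Data.Integer.DivMod using (_%ℕ_; _/ℕ_; n%ℕd<d; a≡a%ℕn+[a/ℕn]*n)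
  open import Data.Integer.Divisibility.Signed using (_∣_; divides; ∣⇒∣ᵤ)
  open import Data.Integer.Tactic.RingSolver using (solve-∀)
  import Data.Nat.Divisibility as ℕ
  open import Data.Nat.DivMod using (_/_; _%_; m≡m%n+[m/n]*n; m%n<n; n/n≡1; m<n⇒m/n≡0; +-distrib-/-∣ˡ; m<n*o⇒m/o<n; /-monoˡ-≤; m*n/n≡m)
  open import Data.Nat.GCD using (module GCD; module Bézout)
  open import Data.Nat.Tactic.RingSolver using () renaming (solve-∀ to solveℕ-∀)

  -- Congruences

  infix 4 _≈_[_]

  record _≈_[_] (x y : ℤ) (N : ℕ) : Set where
    constructor _,_
    field
      quotient : ℤ
      equation : x - y ≡ quotient * + N

  module _ {N : ℕ} where

    ≈-refl : ∀ {x} → x ≈ x [ N ]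
    ≈-refl {x} = 0ℤ , l x (+ N)
      where l : ∀ x n → x - x ≡ 0ℤ * n
            l = solve-∀

    ≈-reflexive : ∀ {x y} → x ≡ y → x ≈ y [ N ]
    ≈-reflexive refl = ≈-refl

    -- This and its two variants reduce a congruence to an identity between differences, which the
    -- ring solver settles.
    ≈-by : ∀ {x y a b} → x ≈ y [ N ] → a - b ≡ x - y → a ≈ b [ N ]
    ≈-by (q , eq) e = q , trans e eq

    ≈-by⁻ : ∀ {x y a b} → x ≈ y [ N ] → a - b ≡ y - x → a ≈ b [ N ]
    ≈-by⁻ {x} {y} (q , eq) e = - q , trans e (trans (l₁ x y) (trans (cong -_ eq) (l₂ q (+ N))))
      where l₁ : ∀ x y → y - x ≡ - (x - y)
            l₁ = solve-∀
            l₂ : ∀ q n → - (q * n) ≡ - q * n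
            l₂ = solve-∀

    ≈-by₂ : ∀ {x y z w a b} → x ≈ y [ N ] → z ≈ w [ N ] → a - b ≡ (x - y) + (z - w) → a ≈ b [ N ]
    ≈-by₂ (q , eq) (r , eq′) e = q + r , trans e (trans (cong₂ _+_ eq eq′) (l q r (+ N)))
      where l : ∀ q r n → q * n + r * n ≡ (q + r) * n
            l = solve-∀

    ≈-sym : ∀ {x y} → x ≈ y [ N ] → y ≈ x [ N ]
    ≈-sym {x} {y} p = ≈-by⁻ p refl

    ≈-trans : ∀ {x y z} → x ≈ y [ N ] → y ≈ z [ N ] → x ≈ z [ N ]
    ≈-trans {x} {y} {z} p q = ≈-by₂ p q (l x y z)
      where l : ∀ x y z → x - z ≡ (x - y) + (y - z)
            l = solve-∀

    ≈-shift : ∀ {a b} q → a - b ≡ q * + N → a ≈ b [ N ]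
    ≈-shift = _,_

  module _ (N : ℕ) .{{_ : NonZero N}} where

    residue : ℤ → Fin N
    residue x = fromℕ< (n%ℕd<d x N)

    residue-≈ : ∀ x → + toℕ (residue x) ≈ x [ N ]
    residue-≈ x = - (x /ℕ N) , (begin
      + toℕ (residue x) - x                          ≡⟨ cong (λ r → + r - x) (toℕ-fromℕ< (n%ℕd<d x N)) ⟩
      + (x %ℕ N) - x                                 ≡⟨ cong (λ y → + (x %ℕ N) - y) (a≡a%ℕn+[a/ℕn]*n x N) ⟩
      + (x %ℕ N) - (+ (x %ℕ N) + (x /ℕ N) * + N)     ≡⟨ l (+ (x %ℕ N)) (x /ℕ N) (+ N) ⟩
      - (x /ℕ N) * + N                               ∎)
      where
      open ≡-Reasoning
      l : ∀ r q n → r - (r + q * n) ≡ - q * n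
      l = solve-∀

  ≈⇒∣ : ∀ {N x y} → x ≈ y [ N ] → + N ∣ x - y
  ≈⇒∣ (q , eq) = divides q eq

  small≈ : ∀ {N a b} → a < N → b ≤ a → + a ≈ + b [ N ] → a ≡ b
  small≈ {N} {a} {b} a<N b≤a p with a ∸ b in eq
  ... | zero  = ≤-antisym (m∸n≡0⇒m≤n eq) b≤a
  ... | suc c = contradiction (ℕ.∣⇒≤ N∣c) (<⇒≱ (s a<N))
    where
    a≡ : a ≡ suc c ℕ.+ b
    a≡ = trans (sym (m∸n+n≡m b≤a)) (cong (ℕ._+ b) eq)
    s : a < N → suc c < N
    s lt = ≤-<-trans (≤-trans (m≤m+n (suc c) b) (≤-reflexive (sym a≡))) lt
    l : ∀ c b → c + b - b ≡ c
    l = solve-∀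
    diff : + a - + b ≡ + suc c
    diff = trans (cong (λ a → + a - + b) a≡) (trans (cong (λ z → z - + b) (pos-+ (suc c) b)) (l (+ suc c) (+ b)))
    N∣c : N ℕ.∣ suc c
    N∣c = ∣⇒∣ᵤ (subst (+ N ∣_) diff (≈⇒∣ p))

  small≈′ : ∀ {N a b} → a < N → b < N → + a ≈ + b [ N ] → a ≡ b
  small≈′ {a = a} {b} a<N b<N p with ≤-total b a
  ... | inj₁ b≤a = small≈ a<N b≤a p
  ... | inj₂ a≤b = sym (small≈ b<N a≤b (≈-sym p))

  module _ {N : ℕ} .{{_ : NonZero N}} where

    residue-cong : ∀ {x y} → x ≈ y [ N ] → residue N x ≡ residue N y
    residue-cong {x} {y} p = toℕ-injective (small≈′ (toℕ<n (residue N x)) (toℕ<n (residue N y))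
      (≈-trans (residue-≈ N x) (≈-trans p (≈-sym (residue-≈ N y)))))

    residue-toℕ : ∀ i → residue N (+ toℕ i) ≡ i
    residue-toℕ i = toℕ-injective (small≈′ (toℕ<n (residue N (+ toℕ i))) (toℕ<n i) (residue-≈ N (+ toℕ i)))

    residue-injective : ∀ {x y} → residue N x ≡ residue N y → x ≈ y [ N ]
    residue-injective {x} {y} eq = ≈-trans (≈-sym (residue-≈ N x))
      (≈-trans (≈-reflexive (cong (λ i → + toℕ i) eq)) (residue-≈ N y))

    _≈?_ : ∀ x y → Dec (x ≈ y [ N ])
    x ≈? y with residue N x Fin.≟ residue N y
    ... | yes p = yes (residue-injective p)
    ... | no ¬p = no λ q → ¬p (residue-cong q)

  -- Zigzag paths

  ≈-double : ∀ {N x y} → x ≈ y [ N ] → x + x ≈ y + y [ N ]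
  ≈-double {x = x} {y} e = ≈-by₂ e e (l x y)
    where l : ∀ x y → (x + x) - (y + y) ≡ (x - y) + (x - y)
          l = solve-∀

  ≈-reflect : ∀ {N z p p′ r} → z ≈ p [ N ] → p + p′ ≈ r [ N ] → r - z ≈ p′ [ N ]
  ≈-reflect {z = z} {p} {p′} {r} e s = ≈-by₂ (≈-sym s) (≈-sym e) (l r p p′ z)
    where l : ∀ r p p′ z → (r - z) - p′ ≡ (r - (p + p′)) + (p - z)
          l = solve-∀

  dbl : ℕ → ℕ
  dbl zero    = zero
  dbl (suc a) = suc (suc (dbl a))

  instance
    dbl-nonZero : ∀ {T} .{{_ : NonZero T}} → NonZero (dbl T)
    dbl-nonZero {suc T} = _

  dbl≡+ : ∀ a → dbl a ≡ a ℕ.+ a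
  dbl≡+ zero    = refl
  dbl≡+ (suc a) = cong suc (trans (cong suc (dbl≡+ a)) (sym (+-suc a a)))

  +dbl : ∀ a → + dbl a ≡ + a + + a
  +dbl a = trans (cong +_ (dbl≡+ a)) (pos-+ a a)

  dbl-+ : ∀ a b → dbl (a ℕ.+ b) ≡ dbl a ℕ.+ dbl b
  dbl-+ zero    b = refl
  dbl-+ (suc a) b = cong (suc ∘ suc) (dbl-+ a b)

  dbl-mono-≤ : ∀ {a b} → a ≤ b → dbl a ≤ dbl b
  dbl-mono-≤ z≤n     = z≤n
  dbl-mono-≤ (s≤s p) = s≤s (s≤s (dbl-mono-≤ p))

  dbl-cancel-< : ∀ {a b} → dbl a < dbl b → a < b
  dbl-cancel-< {a} {b} p = ≰⇒> λ b≤a → <⇒≱ p (dbl-mono-≤ b≤a)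

  dbl-injective : ∀ {a b} → dbl a ≡ dbl b → a ≡ b
  dbl-injective {zero}  {zero}  _  = refl
  dbl-injective {suc a} {suc b} eq = cong suc (dbl-injective (suc-injective (suc-injective eq)))

  data Halved : ℕ → Set where
    even : ∀ a → Halved (dbl a)
    odd  : ∀ a → Halved (suc (dbl a))

  halve : ∀ n → Halved n
  halve zero = even 0
  halve (suc n) with halve n
  ... | even a = odd a
  ... | odd a  = even (suc a)

  -- The sums of consecutive terms of `zigzag`. They alternate between 1 and 0, so the translate by
  -- x has the edge sums 2x + 1 and 2x, and these determine it.
  δ : ℕ → ℤ
  δ zero          = 1ℤ
  δ (suc zero)    = 0ℤ
  δ (suc (suc i)) = δ i

  δ-even : ∀ a → δ (dbl a) ≡ 1ℤ
  δ-even zero    = refl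
  δ-even (suc a) = δ-even a

  δ-odd : ∀ a → δ (suc (dbl a)) ≡ 0ℤ
  δ-odd zero    = refl
  δ-odd (suc a) = δ-odd a

  -- The walk 0, 1, -1, 2, -2, ...
  zigzag : ℕ → ℤ
  zigzag zero    = 0ℤ
  zigzag (suc i) = δ i - zigzag i

  zigzag-even : ∀ a → zigzag (dbl a) ≡ - + a
  zigzag-odd  : ∀ a → zigzag (suc (dbl a)) ≡ 1ℤ + + a
  zigzag-even zero    = refl
  zigzag-even (suc a) = trans (cong₂ _-_ (δ-odd a) (zigzag-odd a)) (l (+ a))
    where l : ∀ a → 0ℤ - (1ℤ + a) ≡ - (1ℤ + a)
          l = solve-∀
  zigzag-odd a = trans (cong₂ _-_ (δ-even a) (zigzag-even a)) (l (+ a))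
    where l : ∀ a → 1ℤ - - a ≡ 1ℤ + a
          l = solve-∀

  pos-∸ : ∀ {a b} → b ≤ a → + (a ∸ b) ≡ + a - + b
  pos-∸ {a} {b} b≤a = trans (l (+ (a ∸ b)) (+ b)) (cong (λ z → z - + b)
    (trans (sym (pos-+ (a ∸ b) b)) (cong +_ (m∸n+n≡m b≤a))))
    where l : ∀ c b → c ≡ c + b - b
          l = solve-∀

  -- A residue r > 0 is reached as the positive term r if 2r ≤ N and as the negative term r - N
  -- otherwise; either way the index stays below N.
  zigzag-onto : ∀ N .{{_ : NonZero N}} y → ∃ λ i → i < N × zigzag i ≈ y [ N ]
  zigzag-onto N y with toℕ (residue N y) in eq | toℕ<n (residue N y) | residue-≈ N y
  ... | zero  | 0<N | p = 0 , 0<N , p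
  ... | suc r | r<N | p with dbl (suc r) ≤? N
  ...   | yes ok = suc (dbl r) , ok , ≈-trans (≈-reflexive (zigzag-odd r)) p
  ...   | no  ¬ok = dbl (N ∸ suc r) , lt , ≈-trans
    (≈-reflexive (trans (zigzag-even (N ∸ suc r)) (cong -_ (pos-∸ (<⇒≤ r<N)))))
                      (≈-trans (≈-shift (- 1ℤ) (l (+ N) (+ suc r))) p)
    where
    l : ∀ n r → - (n - r) - r ≡ - 1ℤ * n
    l = solve-∀
    lt : dbl (N ∸ suc r) < N
    lt = +-cancelʳ-< (dbl (suc r)) (dbl (N ∸ suc r)) N (≤-<-trans
      (≤-reflexive (trans (sym (dbl-+ (N ∸ suc r) (suc r))) (trans (cong dbl (m∸n+n≡m (<⇒≤ r<N))) (dbl≡+ N))))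
      (+-monoʳ-< N (≰⇒> ¬ok)))

  zigzag-rise-even : ∀ a → zigzag (suc (dbl a)) - zigzag (dbl a) ≡ + suc (dbl a)
  zigzag-rise-even a = trans (cong₂ _-_ (zigzag-odd a) (zigzag-even a))
    (trans (l (+ a)) (cong (λ z → 1ℤ + z) (sym (+dbl a))))
    where l : ∀ a → (1ℤ + a) - (- a) ≡ 1ℤ + (a + a)
          l = solve-∀

  -- Descending by 2b + 2 is ascending by 2a + 1, as the two add up to the modulus. Hence the steps
  -- from level 2a and from level 2b + 1 have equal difference.
  zigzag-rise-odd : ∀ a b → zigzag (dbl (suc b)) - zigzag (suc (dbl b)) ≈ + suc (dbl a) [ suc (dbl (a ℕ.+ suc b)) ]
  zigzag-rise-odd a b = ≈-shift (- 1ℤ) (begin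
    zigzag (dbl (suc b)) - zigzag (suc (dbl b)) - + suc (dbl a)
      ≡⟨ cong₂ _-_ (cong₂ _-_ (zigzag-even (suc b)) (zigzag-odd b)) (cong (λ z → 1ℤ + z) (+dbl a)) ⟩
    - (1ℤ + + b) - (1ℤ + + b) - (1ℤ + (+ a + + a))
      ≡⟨ l (+ a) (+ b) ⟩
    - 1ℤ * (1ℤ + ((+ a + (1ℤ + + b)) + (+ a + (1ℤ + + b))))
      ≡⟨ cong (λ z → - 1ℤ * (1ℤ + z)) (trans (sym (cong₂ _+_ (pos-+ a (suc b)) (pos-+ a (suc b))))
        (sym (+dbl (a ℕ.+ suc b)))) ⟩
    - 1ℤ * + suc (dbl (a ℕ.+ suc b)) ∎)
    where
    open ≡-Reasoning
    l : ∀ a b → - (1ℤ + b) - (1ℤ + b) - (1ℤ + (a + a)) ≡ - 1ℤ * (1ℤ + ((a + (1ℤ + b)) + (a + (1ℤ + b))))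
    l = solve-∀

  -- In a zigzag of odd length 2κ+1 the edges numbered d and 2κ+1-d have the same difference; d is
  -- the odd one of the two numbers.
  record Rise (κ : ℕ) (u v : ℤ) : Set where
    field
      lo hi  : ℕ
      total  : lo ℕ.+ suc hi ≡ κ
      differ : v - u ≈ + suc (dbl lo) [ suc (dbl κ) ]

  -- Negating a nonzero residue modulo an odd number changes the parity of its representative, so
  -- one of the two orientations has an odd difference.
  rises : ∀ κ u v → ¬ u ≈ v [ suc (dbl κ) ] → Rise κ u v ⊎ Rise κ v u
  rises κ u v u≉v with toℕ (residue (suc (dbl κ)) (v - u)) | toℕ<n (residue (suc (dbl κ)) (v - u)) | residue-≈
    (suc (dbl κ)) (v - u)
  ... | d | d<N | p with halve d
  ...   | odd a = inj₁ record { lo = a ; hi = κ ∸ suc a ; total = trans (+-suc a _) (m+[n∸m]≡n a<κ) ; differ = ≈-sym p }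
    where
    a<κ : a < κ
    a<κ = dbl-cancel-< (≤-pred d<N)
  ...   | even zero = contradiction (≈-by p (l u v)) u≉v
    where l : ∀ u v → u - v ≡ 0ℤ - (v - u)
          l = solve-∀
  ...   | even (suc a) = inj₂ record
    { lo = κ ∸ suc a ; hi = a ; total = m∸n+n≡m a<κ
    ; differ = ≈-trans {y = - + dbl (suc a)} (≈-by p (l u v (+ dbl (suc a)))) (≈-shift (- 1ℤ) (begin
        - + dbl (suc a) - + suc (dbl (κ ∸ suc a))
          ≡⟨ cong₂ (λ x y → - x - (1ℤ + y)) (+dbl (suc a)) (trans (+dbl _) (cong₂ _+_ (pos-∸ a<κ) (pos-∸ a<κ))) ⟩
        - (+ suc a + + suc a) - (1ℤ + ((+ κ - + suc a) + (+ κ - + suc a)))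
          ≡⟨ l′ (+ κ) (+ suc a) ⟩
        - 1ℤ * (1ℤ + (+ κ + + κ))
          ≡⟨ cong (λ z → - 1ℤ * (1ℤ + z)) (sym (+dbl κ)) ⟩
        - 1ℤ * + suc (dbl κ) ∎)) }
    where
    open ≡-Reasoning
    l : ∀ u v d → (u - v) - (- d) ≡ d - (v - u)
    l = solve-∀
    l′ : ∀ k a → - (a + a) - (1ℤ + ((k - a) + (k - a))) ≡ - 1ℤ * (1ℤ + (k + k))
    l′ = solve-∀
    a<κ : suc a ≤ κ
    a<κ = ≤-pred (dbl-cancel-< {suc a} {suc κ} (m≤n⇒m≤1+n d<N))

  pair : ℕ → ℤ → Bool → ℕ → Bool → ℤ
  pair T h par c       false = h - + c
  pair T h true  c     true  = h + (1ℤ + + c)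
  pair T h false zero    true = h + + T
  pair T h false (suc c) true = h + + suc c

  -- The blocks {pair h p c false , pair h p c true} with c < T partition the residues modulo 2T;
  -- their elements add up to 2h + p, except when p = c = 0, where the two fixed points of the
  -- reflection x ↦ 2h - x form a block.
  centre : ℤ → Bool → ℤ
  centre h par = h + h + (if par then 1ℤ else 0ℤ)

  module _ {T : ℕ} .{{_ : NonZero T}} where

    private
      M = dbl T

    pair-onto : ∀ h par q → ∃ λ c → ∃ λ b → c < T × pair T h par c b ≈ q [ M ]
    pair-onto h par q with toℕ (residue M (h - q)) | toℕ<n (residue M (h - q)) | residue-≈ M (h - q)
    ... | r | r<M | p with r <? T
    ...   | yes r<T = r , false , r<T , ≈-by⁻ p (l h q (+ r))
      where l : ∀ h q r → (h - r) - q ≡ (h - q) - r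
            l = solve-∀
    pair-onto h true q | r | r<M | p | no r≮T = M ∸ suc r , true , lt , ≈-trans
      (≈-reflexive (cong (λ z → h + (1ℤ + z)) (pos-∸ r<M)))
      (≈-trans (≈-shift 1ℤ (l′ h (+ M) (+ r))) (≈-by⁻ p (l h q (+ r))))
      where
      l : ∀ h q r → (h - r) - q ≡ (h - q) - r
      l = solve-∀
      l′ : ∀ h m r → (h + (1ℤ + (m - (1ℤ + r)))) - (h - r) ≡ 1ℤ * m
      l′ = solve-∀
      lt : M ∸ suc r < T
      lt = +-cancelʳ-< (suc r) (M ∸ suc r) T (≤-<-trans (≤-reflexive (trans (m∸n+n≡m r<M) (dbl≡+ T)))
        (+-monoʳ-< T (s≤s (≮⇒≥ r≮T))))
    pair-onto h false q | r | r<M | p | no r≮T with M ∸ r in eq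
    ... | zero  = contradiction (m∸n≡0⇒m≤n eq) (<⇒≱ r<M)
    ... | suc c with suc c <? T
    ...   | yes c<T = suc c , true , c<T , ≈-trans
      (≈-reflexive (cong (λ z → h + z) (trans (cong +_ (sym eq)) (pos-∸ (<⇒≤ r<M)))))
      (≈-trans (≈-shift 1ℤ (l′ h (+ M) (+ r))) (≈-by⁻ p (l h q (+ r))))
      where
      l : ∀ h q r → (h - r) - q ≡ (h - q) - r
      l = solve-∀
      l′ : ∀ h m r → (h + (m - r)) - (h - r) ≡ 1ℤ * m
      l′ = solve-∀
    ...   | no  c≮T = 0 , true , >-nonZero⁻¹ T , ≈-trans
      (≈-shift 1ℤ (trans (l′ h (+ T)) (cong (λ z → 1ℤ * z) (sym (+dbl T)))))
      (≈-by⁻ p (trans (l h q (+ T)) (cong (λ z → h - q - + z) (sym r≡T))))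
      where
      l : ∀ h q r → (h - r) - q ≡ (h - q) - r
      l = solve-∀
      l′ : ∀ h t → (h + t) - (h - t) ≡ 1ℤ * (t + t)
      l′ = solve-∀
      r≡T : r ≡ T
      r≡T = ≤-antisym (+-cancelʳ-≤ T r T (≤-trans (+-monoʳ-≤ r (≮⇒≥ c≮T))
        (≤-reflexive (trans (cong (r ℕ.+_) (sym eq)) (trans (m+[n∸m]≡n (<⇒≤ r<M)) (dbl≡+ T)))))) (≮⇒≥ r≮T)

    -- The reflection x ↦ 2h + par - x exchanges the two elements of every ordinary block, and it
    -- takes p to q.
    pair-meet : ∀ h par p q → p + q ≈ centre h par [ M ] → ¬ p ≈ q [ M ] →
                ∃ λ c → ∃ λ b → c < T × pair T h par c b ≈ p [ M ] × pair T h par c (not b) ≈ q [ M ]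
    pair-meet h par p q s p≉q with pair-onto h par p
    pair-meet h true p q s p≉q | c , false , c<T , e = c , false , c<T , e , ≈-by₂ (≈-sym s) (≈-sym e) (l h p q (+ c))
      where l : ∀ h p q c → (h + (1ℤ + c)) - q ≡ ((h + h + 1ℤ) - (p + q)) + (p - (h - c))
            l = solve-∀
    pair-meet h true p q s p≉q | c , true , c<T , e = c , true , c<T , e , ≈-by₂ (≈-sym s) (≈-sym e) (l h p q (+ c))
      where l : ∀ h p q c → (h - c) - q ≡ ((h + h + 1ℤ) - (p + q)) + (p - (h + (1ℤ + c)))
            l = solve-∀
    -- The exceptional block consists of the fixed points of the reflection, where q would be
    -- congruent to p.
    pair-meet h false p q s p≉q | zero , false , c<T , e = contradiction (≈-by₂ (≈-sym s) (≈-double (≈-sym e)) (l h p q))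
      p≉q
      where l : ∀ h p q → p - q ≡ ((h + h + 0ℤ) - (p + q)) + ((p + p) - ((h - 0ℤ) + (h - 0ℤ)))
            l = solve-∀
    pair-meet h false p q s p≉q | zero , true , c<T , e = contradiction
      (≈-by₂ (≈-sym s) (≈-trans (≈-double (≈-sym e))
        (≈-shift 1ℤ (trans (l′ h (+ T)) (cong (λ z → 1ℤ * z) (sym (+dbl T)))))) (l h p q)) p≉q
      where l : ∀ h p q → p - q ≡ ((h + h + 0ℤ) - (p + q)) + ((p + p) - (h + h))
            l = solve-∀
            l′ : ∀ h t → (h + t + (h + t)) - (h + h) ≡ 1ℤ * (t + t)
            l′ = solve-∀
    pair-meet h false p q s p≉q | suc c , false , c<T , e = suc c , false , c<T , e , ≈-by₂ (≈-sym s) (≈-sym e)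
      (l h p q (+ suc c))
      where l : ∀ h p q c → (h + c) - q ≡ ((h + h + 0ℤ) - (p + q)) + (p - (h - c))
            l = solve-∀
    pair-meet h false p q s p≉q | suc c , true , c<T , e = suc c , true , c<T , e , ≈-by₂ (≈-sym s) (≈-sym e)
      (l h p q (+ suc c))
      where l : ∀ h p q c → (h - c) - q ≡ ((h + h + 0ℤ) - (p + q)) + (p - (h + c))
            l = solve-∀

    block-onto : ∀ h par q → ∃ λ (c : Fin T) → ∃ λ b → pair T h par (toℕ c) b ≈ q [ M ]
    block-onto h par q =
      let c , b , c<T , e = pair-onto h par q
      in fromℕ< c<T , b , subst (λ c → pair T h par c b ≈ q [ M ]) (sym (toℕ-fromℕ< c<T)) e

    block-meet : ∀ h par p q → p + q ≈ centre h par [ M ] → ¬ p ≈ q [ M ] →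
                 ∃ λ (c : Fin T) → ∃ λ b → pair T h par (toℕ c) b ≈ p [ M ] × pair T h par (toℕ c) (not b) ≈ q [ M ]
    block-meet h par p q s p≉q =
      let c , b , c<T , e , f = pair-meet h par p q s p≉q
      in fromℕ< c<T , b , subst (λ c → pair T h par c b ≈ p [ M ]) (sym (toℕ-fromℕ< c<T)) e ,
         subst (λ c → pair T h par c (not b) ≈ q [ M ]) (sym (toℕ-fromℕ< c<T)) f

  -- If the two strands of a block have sum σ at level 0, then they have sum blockSum σ i at level i.
  module Strand (ρ : ℕ → ℤ) where

    strand : ℕ → ℤ → ℤ
    strand zero    p = p
    strand (suc i) p = ρ i - strand i p

    source : ℕ → ℤ → ℤ
    source zero    p = p
    source (suc i) p = source i (ρ i - p)

    blockSum : ℤ → ℕ → ℤ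
    blockSum σ zero    = σ
    blockSum σ (suc i) = ρ i + ρ i - blockSum σ i

    strand-source : ∀ i p → strand i (source i p) ≡ p
    strand-source zero    p = refl
    strand-source (suc i) p = trans (cong (λ z → ρ i - z) (strand-source i (ρ i - p))) (l (ρ i) p)
      where l : ∀ r p → r - (r - p) ≡ p
            l = solve-∀

    module _ {N : ℕ} where

      strand-cong : ∀ i {p q} → p ≈ q [ N ] → strand i p ≈ strand i q [ N ]
      strand-cong zero    e = e
      strand-cong (suc i) {p} {q} e = ≈-by⁻ (strand-cong i e) (l (ρ i) (strand i p) (strand i q))
        where l : ∀ r p q → (r - p) - (r - q) ≡ q - p
              l = solve-∀

      from-source : ∀ i {p q} → p ≈ source i q [ N ] → strand i p ≈ q [ N ]
      from-source i {p} {q} e = ≈-trans (strand-cong i e) (≈-reflexive (strand-source i q))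

      -- Undoing a reflection takes the sum of a pair back along `blockSum`, so a pair inside any
      -- level can be looked up among the blocks of level 0.
      source-sum : ∀ σ i {p q} → p + q ≈ blockSum σ i [ N ] → source i p + source i q ≈ σ [ N ]
      source-sum σ zero    e = e
      source-sum σ (suc i) {p} {q} e = source-sum σ i (≈-by⁻ e (l (ρ i) p q (blockSum σ i)))
        where l : ∀ r p q s → (r - p + (r - q)) - s ≡ (r + r - s) - (p + q)
              l = solve-∀

      source-injective : ∀ i {p q} → source i p ≈ source i q [ N ] → p ≈ q [ N ]
      source-injective i {p} {q} e = ≈-trans (≈-reflexive (sym (strand-source i p))) (from-source i e)

  module Grid (N M : ℕ) .{{_ : NonZero N}} .{{_ : NonZero M}} where

    point : ℤ × ℤ → Fin (N ℕ.* M)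
    point (y , p) = combine (residue N y) (residue M p)

    point-cong : ∀ {y y′ p p′} → y ≈ y′ [ N ] → p ≈ p′ [ M ] → point (y , p) ≡ point (y′ , p′)
    point-cong e f = cong₂ combine (residue-cong e) (residue-cong f)

    point-onto : ∀ w → ∃ λ v → point v ≡ w
    point-onto w = let i , j = remQuot {N} M w in
      (+ toℕ i , + toℕ j) , trans (cong₂ combine (residue-toℕ i) (residue-toℕ j)) (combine-remQuot {N} M w)

  represent : ∀ {N} .{{_ : NonZero N}} y → ∃ λ (x : Fin N) → + toℕ x ≈ y [ N ]
  represent {N} y = residue N y , residue-≈ N y

  represent-at : ∀ {N} .{{_ : NonZero N}} z y → ∃ λ (x : Fin N) → + toℕ x + z ≈ y [ N ]
  represent-at {N} z y = residue N (y - z) , ≈-by (residue-≈ N (y - z)) (l (+ toℕ (residue N (y - z))) z y)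
    where l : ∀ x z y → x + z - y ≡ x - (y - z)
          l = solve-∀

  -- The step from level i reflects in `ρ F i`. So a factor covers, between two consecutive columns,
  -- the pairs whose second coordinates have this sum, and inside its two end columns the pairs
  -- which have the block sum there.
  module Reflecting (N T μ : ℕ) .{{_ : NonZero N}} .{{_ : NonZero T}} (Factor : Set)
                    (base half : Factor → ℤ) (parity : Factor → Bool) (ρ : Factor → ℕ → ℤ) where

    open Grid N (dbl T)

    level : Factor → Fin T → Bool → ℕ → ℤ × ℤ
    level F c b i = base F + zigzag i , Strand.strand (ρ F) i (pair T (half F) (parity F) (toℕ c) b)

    path : Factor → Fin T → ℕ → ℤ × ℤ
    path F c = DoubleStrand.walk point μ (level F c)

    module _ (F : Factor) where
      open Strand (ρ F)

      reach : ∀ i y p → base F + zigzag i ≈ y [ N ] → ∃ λ c → ∃ λ b → point (level F c b i) ≡ point (y , p)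
      reach i y p e =
        let c , b , f = block-onto {T} (half F) (parity F) (source i p)
        in c , b , point-cong e (from-source i f)

      spans-at : ∀ i y p → i < μ → base F + zigzag i ≈ y [ N ] →
        ∃ λ c → ∃ λ k → k < μ ℕ.+ μ × point (path F c k) ≡ point (y , p)
      spans-at i y p i<μ e =
        let c , b , eq = reach i y p e
            k , k<m , eq′ = DoubleStrand.on point μ (level F c) b i<μ
        in c , k , k<m , trans eq′ eq

      edge : ∀ i y p y′ p′ → suc i < μ → base F + zigzag i ≈ y [ N ] → base F + zigzag (suc i) ≈ y′ [ N ] →
             p + p′ ≈ ρ F i [ dbl T ] → ∃ λ c → Adjacent point (μ ℕ.+ μ) (path F c) (y , p) (y′ , p′)
      edge i y p y′ p′ lt e e′ s =
        let c , b , f = block-onto {T} (half F) (parity F) (source i p)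
        in c , Adjacent-resp (DoubleStrand.along point μ (level F c) b lt)
          (point-cong e (from-source i f))
          (point-cong e′ (≈-reflect {z = strand i (pair T (half F) (parity F) (toℕ c) b)} (from-source i f) s))

      block : ∀ i p p′ → p + p′ ≈ blockSum (centre (half F) (parity F)) i [ dbl T ] → ¬ p ≈ p′ [ dbl T ] →
              ∃ λ (c : Fin T) → ∃ λ b → strand i (pair T (half F) (parity F) (toℕ c) b) ≈ p [ dbl T ] ×
                                strand i (pair T (half F) (parity F) (toℕ c) (not b)) ≈ p′ [ dbl T ]
      block i p p′ s p≉p′ =
        let c , b , f , f′ = block-meet {T} (half F) (parity F) (source i p) (source i p′)
                               (source-sum (centre (half F) (parity F)) i s) (λ e → p≉p′ (source-injective i e))
        in c , b , from-source i f , from-source i f′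

      flat-bottom : ∀ y p y′ p′ → 0 < μ → base F + 0ℤ ≈ y [ N ] → base F + 0ℤ ≈ y′ [ N ] →
                    p + p′ ≈ centre (half F) (parity F) [ dbl T ] → ¬ p ≈ p′ [ dbl T ] →
                    ∃ λ c → Adjacent point (μ ℕ.+ μ) (path F c) (y , p) (y′ , p′)
      flat-bottom y p y′ p′ 0<μ e e′ s p≉p′ =
        let c , b , f , f′ = block 0 p p′ s p≉p′
        in c , Adjacent-resp (DoubleStrand.bottom point μ (level F c) b 0<μ) (point-cong e f) (point-cong e′ f′)

      flat-top : ∀ i y p y′ p′ → suc i ≡ μ → base F + zigzag i ≈ y [ N ] → base F + zigzag i ≈ y′ [ N ] →
                 p + p′ ≈ blockSum (centre (half F) (parity F)) i [ dbl T ] → ¬ p ≈ p′ [ dbl T ] →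
                 ∃ λ c → Adjacent point (μ ℕ.+ μ) (path F c) (y , p) (y′ , p′)
      flat-top i y p y′ p′ eq e e′ s p≉p′ =
        let c , b , f , f′ = block i p p′ s p≉p′
        in c , Adjacent-resp (DoubleStrand.top point μ (level F c) b eq) (point-cong e f) (point-cong e′ f′)

  ≈-rebase : ∀ {N x y i} → zigzag i ≈ y - x [ N ] → x + zigzag i ≈ y [ N ]
  ≈-rebase {x = x} {y} {i} e = ≈-by e (l x y (zigzag i))
    where l : ∀ x y z → x + z - y ≡ z - (y - x)
          l = solve-∀

  as-centre : ∀ {T} .{{_ : NonZero T}} q → ∃ λ (h : Fin T) → ∃ λ par → q ≈ centre (+ toℕ h) par [ dbl T ]
  as-centre {T} q with toℕ (residue (dbl T) q) | toℕ<n (residue (dbl T) q) | residue-≈ (dbl T) q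
  ... | r | r<M | p with halve r
  ...   | even h = fromℕ< h<T , false , ≈-trans (≈-sym p)
    (≈-reflexive (trans (+dbl h) (trans (l (+ h)) (cong (λ h → centre (+ h) false) (sym (toℕ-fromℕ< h<T))))))
    where
    h<T = dbl-cancel-< {h} {T} r<M
    l : ∀ h → h + h ≡ h + h + 0ℤ
    l = solve-∀
  ...   | odd h = fromℕ< h<T , true , ≈-trans (≈-sym p)
    (≈-reflexive (trans (cong (λ z → 1ℤ + z) (+dbl h))
    (trans (l (+ h)) (cong (λ h → centre (+ h) true) (sym (toℕ-fromℕ< h<T))))))
    where
    h<T = dbl-cancel-< {h} {T} (<-trans (n<1+n _) r<M)
    l : ∀ h → 1ℤ + (h + h) ≡ h + h + 1ℤ
    l = solve-∀

  record RiseAt (N : ℕ) (u v : ℤ) (i : ℕ) : Set where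
    field
      inside : suc i < N
      rise   : zigzag (suc i) - zigzag i ≈ v - u [ N ]

  rise-lo : ∀ {κ u v} (r : Rise κ u v) → RiseAt (suc (dbl κ)) u v (dbl (Rise.lo r))
  rise-lo {κ} r = record
    { inside = s≤s (≤-trans (n≤1+n _) (dbl-mono-≤ {suc lo} {κ}
      (≤-trans (m≤m+n (suc lo) hi) (≤-reflexive (trans (sym (+-suc lo hi)) total)))))
    ; rise   = ≈-trans (≈-reflexive (zigzag-rise-even lo)) (≈-sym differ)
    }
    where open Rise r

  rise-hi : ∀ {κ u v} (r : Rise κ u v) → RiseAt (suc (dbl κ)) u v (suc (dbl (Rise.hi r)))
  rise-hi {κ} r = record
    { inside = s≤s (dbl-mono-≤ {suc hi} {κ} (≤-trans (m≤n+m (suc hi) lo) (≤-reflexive total)))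
    ; rise   = ≈-trans (subst (λ κ → _ ≈ _ [ suc (dbl κ) ]) total (zigzag-rise-odd lo hi)) (≈-sym differ)
    }
    where open Rise r

  -- The translate is chosen to fit level i; the difference of the levels then makes it fit level j.
  place-levels : ∀ {N} .{{_ : NonZero N}} i j u v → zigzag j - zigzag i ≈ v - u [ N ] →
                 ∃ λ (x : Fin N) → + toℕ x + zigzag i ≈ u [ N ] × + toℕ x + zigzag j ≈ v [ N ]
  place-levels {N} i j u v d =
    let x , e = represent-at {N} (zigzag i) u
    in x , e , ≈-by₂ e d (l (+ toℕ x) (zigzag i) (zigzag j) u v)
    where
    l : ∀ x z z′ u v → x + z′ - v ≡ (x + z - u) + ((z′ - z) - (v - u))
    l = solve-∀

  place : ∀ {N u v i} .{{_ : NonZero N}} → RiseAt N u v i →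
          ∃ λ (x : Fin N) → + toℕ x + zigzag i ≈ u [ N ] × + toℕ x + zigzag (suc i) ≈ v [ N ]
  place {N} {u} {v} {i} r = place-levels i (suc i) u v (RiseAt.rise r)

  -- The two edges of equal difference, seen from the middle level suc f of a zigzag with 2f + 3 levels.
  data Twin (f : ℕ) (N : ℕ) (u v : ℤ) : Set where
    middle : RiseAt N u v f → RiseAt N u v (suc f) → Twin f N u v
    outer  : ∀ o → o < f → RiseAt N u v (f ∸ suc o) → RiseAt N u v (suc (suc f) ℕ.+ o) → Twin f N u v

  module TwinLevels {f u v} (r : Rise (suc f) u v) where
    open Rise r
    N = suc (dbl (suc f))

    -- The numbers of the twin edges add up to the odd number 2f + 1, so one of them lies on each
    -- side of the middle level.
    levels : dbl lo ℕ.+ suc (dbl hi) ≡ suc (dbl f)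
    levels = trans (+-suc (dbl lo) (dbl hi)) (cong suc
      (trans (sym (dbl-+ lo hi)) (cong dbl (suc-injective (trans (sym (+-suc lo hi)) total)))))

    from : ∀ {i j} → i ≤ f → i ℕ.+ j ≡ suc (dbl f) → RiseAt N u v i → RiseAt N u v j → Twin f N u v
    from {i} {j} le eq p q with m≤n⇒m<n∨m≡n le
    ... | inj₂ refl = middle p (subst (RiseAt N u v)
      (+-cancelˡ-≡ i j (suc i) (trans eq (trans (cong suc (dbl≡+ i)) (sym (+-suc i i))))) q)
    ... | inj₁ lt = outer (f ∸ suc i) (≤-trans (≤-reflexive (sym (+-∸-assoc 1 lt))) (m∸n≤m f i))
        (subst (RiseAt N u v) (sym (trans (cong (f ∸_) (sym (+-∸-assoc 1 lt))) (m∸[m∸n]≡n le))) p)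
        (subst (RiseAt N u v) (+-cancelˡ-≡ i j _ (trans eq
          (trans (cong suc (dbl≡+ f)) (trans (cong (λ g → suc (f ℕ.+ g)) (sym (m+[n∸m]≡n lt))) (l i f (f ∸ suc i)))))) q)
      where
      l : ∀ i f o → suc (f ℕ.+ (suc i ℕ.+ o)) ≡ i ℕ.+ (suc (suc f) ℕ.+ o)
      l = solveℕ-∀

  twin : ∀ {f u v} → Rise (suc f) u v → Twin f (suc (dbl (suc f))) u v
  twin {f} {u} {v} r with dbl (Rise.lo r) ≤? f
  ... | yes le = from le levels (rise-lo r) (rise-hi r)
    where open TwinLevels r
  ... | no ¬le = from (+-cancelˡ-≤ f (suc (dbl hi)) f
    (≤-pred (≤-trans (+-monoˡ-≤ (suc (dbl hi)) (≰⇒> ¬le)) (≤-reflexive (trans levels (cong suc (dbl≡+ f)))))))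
      (trans (+-comm (suc (dbl hi)) (dbl lo)) levels) (rise-hi r) (rise-lo r)
    where
    open TwinLevels r
    open Rise r

  -- Cycles of even length

  -- Cycle lengths 4(l + 1): the zigzag path on Z_N and its first N/2 translates decompose K_N, and the
  -- reflection p ↦ 2h + par - p maps the block {p , p′} of a cycle onto itself.
  module FourDividesLength (l T : ℕ) .{{_ : NonZero T}} where

    N = dbl (suc l)

    Factor : Set
    Factor = Fin (suc l) × (Fin T × Bool)

    base half : Factor → ℤ
    base (x , _)     = + toℕ x
    half (_ , h , _) = + toℕ h

    parity : Factor → Bool
    parity (_ , _ , par) = par

    open Grid N (dbl T)
    open Reflecting N T N Factor base half parity (λ F _ → centre (half F) (parity F))

    constant-sum : ∀ F i → Strand.blockSum (λ _ → centre (half F) (parity F)) (centre (half F) (parity F)) i ≡ centre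
      (half F) (parity F)
    constant-sum F zero    = refl
    constant-sum F (suc i) = trans (cong (λ z → σ + σ - z) (constant-sum F i)) (e σ)
      where σ = centre (half F) (parity F)
            e : ∀ s → s + s - s ≡ s
            e = solve-∀

    Joined : ℤ × ℤ → ℤ × ℤ → Set
    Joined u v = ∃ λ F → ∃ λ c → Adjacent point (N ℕ.+ N) (path F c) u v

    Joined-sym : ∀ {u v} → Joined u v → Joined v u
    Joined-sym (F , c , a) = F , c , swap a

    -- The translates have the bottom columns 0, ..., l and the top columns l + 1, ..., 2l + 1, so
    -- every column is an end column.
    within : ∀ y p y′ p′ → y ≈ y′ [ N ] → ¬ p ≈ p′ [ dbl T ] → Joined (y , p) (y′ , p′)
    within y p y′ p′ y≈y′ p≉p′ = go (represent y) (as-centre {T} (p + p′))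
      where
      go : ∃ (λ (r : Fin N) → + toℕ r ≈ y [ N ]) → ∃ (λ (h : Fin T) → ∃ λ par → p + p′ ≈ centre (+ toℕ h) par [ dbl T ]) →
           Joined (y , p) (y′ , p′)
      go (r , e) (h , par , s) with toℕ r <? suc l
      ... | yes r<λ = F , flat-bottom F y p y′ p′ (s≤s z≤n) e₀ (≈-trans e₀ y≈y′) s p≉p′
        where
        F = fromℕ< r<λ , h , par
        e₀ : base F + 0ℤ ≈ y [ N ]
        e₀ = ≈-trans (≈-reflexive (trans (ℤ.+-identityʳ _) (cong +_ (toℕ-fromℕ< r<λ)))) e
      ... | no  r≮λ = F , flat-top F (suc (dbl l)) y p y′ p′ refl e₀ (≈-trans e₀ y≈y′)
                            (≈-trans s (≈-reflexive (sym (constant-sum F (suc (dbl l)))))) p≉p′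
        where
        x<λ : toℕ r ∸ suc l < suc l
        x<λ = +-cancelʳ-< (suc l) _ (suc l) (≤-<-trans (≤-reflexive (m∸n+n≡m (≮⇒≥ r≮λ)))
                (<-≤-trans (toℕ<n r) (≤-reflexive (dbl≡+ (suc l)))))
        F = fromℕ< x<λ , h , par
        e₀ : base F + zigzag (suc (dbl l)) ≈ y [ N ]
        e₀ = ≈-trans (≈-reflexive (trans (cong₂ _+_ (trans (cong +_ (toℕ-fromℕ< x<λ)) (pos-∸ (≮⇒≥ r≮λ))) (zigzag-odd l))
          (m (+ toℕ r) (+ l)))) e
          where m : ∀ r l → (r - (1ℤ + l)) + (1ℤ + l) ≡ r
                m = solve-∀

    opposite : ∀ {y y′} x z d → y + y′ ≈ x + x + d [ N ] → x + z ≈ y [ N ] → x + (d - z) ≈ y′ [ N ]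
    opposite {y} {y′} x z d s e = ≈-by₂ (≈-sym s) (≈-sym e) (m x y y′ z d)
      where m : ∀ x y y′ z d → x + (d - z) - y′ ≡ (x + x + d - (y + y′)) + (y - (x + z))
            m = solve-∀

    between : ∀ y p y′ p′ → ¬ y ≈ y′ [ N ] → Joined (y , p) (y′ , p′)
    between y p y′ p′ y≉y′ = go (as-centre {suc l} (y + y′)) (as-centre {T} (p + p′))
      where
      go : ∃ (λ (x : Fin (suc l)) → ∃ λ par → y + y′ ≈ centre (+ toℕ x) par [ dbl (suc l) ]) →
           ∃ (λ (h : Fin T) → ∃ λ par → p + p′ ≈ centre (+ toℕ h) par [ dbl T ]) → Joined (y , p) (y′ , p′)
      go (x , b , s) (h , par , s′) = let i , i<N , e = zigzag-onto N (y - + toℕ x) in find b s i i<N (halve i) (≈-rebase {i = i} e)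
        where
        F : Factor
        F = x , h , par
        s″ : p′ + p ≈ centre (+ toℕ h) par [ dbl T ]
        s″ = ≈-by s′ (m p p′ (centre (+ toℕ h) par))
          where m : ∀ p q c → (q + p) - c ≡ (p + q) - c
                m = solve-∀
        lower : ∀ j → suc j < N → + toℕ x + zigzag (suc j) ≈ y [ N ] → + toℕ x + zigzag j ≈ y′ [ N ] →
          Joined (y , p) (y′ , p′)
        lower j lt e e′ = Joined-sym (F , edge F j y′ p′ y p lt e′ e s″)
        upper : ∀ i → suc i < N → + toℕ x + zigzag i ≈ y [ N ] → + toℕ x + zigzag (suc i) ≈ y′ [ N ] →
          Joined (y , p) (y′ , p′)
        upper i lt e e′ = F , edge F i y p y′ p′ lt e e′ s′
        flip : ∀ d z → d - (d - z) ≡ z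
        flip = solve-∀
        -- Steps from even levels have sum 2x + 1, steps from odd levels 2x. The parities of the sum
        -- and of the level of y therefore decide whether y′ is the next or the previous level;
        -- where the zigzag ends and has no such neighbour, y and y′ would coincide.
        find : ∀ b → y + y′ ≈ centre (+ toℕ x) b [ N ] → ∀ i → i < N → Halved i → + toℕ x + zigzag i ≈ y [ N ] →
          Joined (y , p) (y′ , p′)
        find true  s _ lt (even a) e = upper (dbl a) (dbl-mono-≤ {suc a} {suc l} (dbl-cancel-< lt)) e
          (≈-trans (≈-reflexive (cong (λ d → + toℕ x + (d - zigzag (dbl a))) (δ-even a)))
            (opposite (+ toℕ x) (zigzag (dbl a)) 1ℤ s e))
        find true  s _ lt (odd a) e = lower (dbl a) lt e
          (≈-trans (≈-reflexive (cong (λ z → + toℕ x + z)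
            (trans (sym (flip 1ℤ (zigzag (dbl a)))) (cong (λ d → 1ℤ - (d - zigzag (dbl a))) (sym (δ-even a))))))
            (opposite (+ toℕ x) (zigzag (suc (dbl a))) 1ℤ s e))
        find false s _ lt (even zero) e = contradiction (≈-trans (≈-sym e) (opposite (+ toℕ x) 0ℤ 0ℤ s e)) y≉y′
        find false s _ lt (even (suc a)) e = lower (suc (dbl a)) lt e
          (≈-trans (≈-reflexive (cong (λ z → + toℕ x + z)
            (trans (sym (flip 0ℤ (zigzag (suc (dbl a))))) (cong (λ d → 0ℤ - (d - zigzag (suc (dbl a)))) (sym (δ-odd a))))))
            (opposite (+ toℕ x) (zigzag (dbl (suc a))) 0ℤ s e))
        find false s _ lt (odd a) e = last (suc (suc (dbl a)) <? N)
          where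
          last : Dec (suc (suc (dbl a)) < N) → Joined (y , p) (y′ , p′)
          last (yes ok) = upper (suc (dbl a)) ok e
            (≈-trans (≈-reflexive (cong (λ d → + toℕ x + (d - zigzag (suc (dbl a)))) (δ-odd a)))
              (opposite (+ toℕ x) (zigzag (suc (dbl a))) 0ℤ s e))
          last (no ¬ok) = contradiction (≈-trans (≈-sym e) (≈-trans (≈-shift 1ℤ
              (trans (m (+ toℕ x) (zigzag (suc (dbl a))))
                (trans (cong (λ z → 1ℤ * (z + z)) (trans (zigzag-odd a) (cong (λ a → 1ℤ + + a) a≡l)))
                (cong (λ z → 1ℤ * z) (sym (+dbl (suc l)))))))
              (opposite (+ toℕ x) (zigzag (suc (dbl a))) 0ℤ s e))) y≉y′
            where
            m : ∀ x z → (x + z) - (x + (0ℤ - z)) ≡ 1ℤ * (z + z)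
            m = solve-∀
            a≡l : a ≡ l
            a≡l = suc-injective (dbl-injective {suc a} {suc l} (≤-antisym lt (≮⇒≥ ¬ok)))

    cover : Cover (N ℕ.* dbl T) (N ℕ.+ N) T (suc l ℕ.* (T ℕ.* 2))
    cover = record
      { Vertex = ℤ × ℤ ; Factor = Factor ; Part = Fin T
      ; enc = point ; enc-onto = point-onto
      ; factors = enum-× enum-Fin (enum-× enum-Fin enum-Bool) ; parts = enum-Fin
      ; path = path
      ; spans = λ { F (y , p) → let i , i<N , e = zigzag-onto N (y - base F) in spans-at F i y p i<N (≈-rebase {i = i} e) }
      ; covers = λ { (y , p) (y′ , p′) u≢v → covers y p y′ p′ u≢v (y ≈? y′) }
      }
      where
      covers : ∀ y p y′ p′ → point (y , p) ≢ point (y′ , p′) → Dec (y ≈ y′ [ N ]) → Joined (y , p) (y′ , p′)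
      covers y p y′ p′ u≢v (yes e) = within y p y′ p′ e λ f → u≢v (point-cong e f)
      covers y p y′ p′ u≢v (no ¬e) = between y p y′ p′ ¬e

  -- Cycle lengths 2(2κ + 1) with an even number of cycles per factor.  The blocks of a factor have
  -- sum first at the bottom level and sum second at the top level; the four values taken for a given
  -- a are the four residues 4a, ..., 4a + 3.
  module EvenlyManyCycles (k τ : ℕ) .{{_ : NonZero τ}} where

    κ N T : ℕ
    κ = suc k
    N = suc (dbl κ)
    T = dbl τ

    Label : Set
    Label = Fin τ × Bool

    Factor : Set
    Factor = Fin N × Label

    base : Factor → ℤ
    base (x , _) = + toℕ x

    quad : Fin τ → ℤ
    quad a = + toℕ a + + toℕ a

    halfOf : Label → ℤ
    halfOf (a , false) = quad a
    halfOf (a , true)  = quad a + 1ℤ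

    parityOf : Label → Bool
    parityOf (_ , b) = not b

    -- A reflection in `turn` leads from block sum `first` to `second` only if twice `turn` is their
    -- sum. The values of `first` are 4a + 1 and 4a + 2, those of `second` 4a + 3 and 4a. Exchanging
    -- the two labels of a solves the equation, and the values of `turn` are those of `first` again.
    first second turn : Label → ℤ
    first L = centre (halfOf L) (parityOf L)
    second (a , false) = quad a + quad a + (1ℤ + (1ℤ + 1ℤ))
    second (a , true)  = quad a + quad a
    turn (a , b) = first (a , not b)

    turn-sum : ∀ L → turn L + turn L - first L ≡ second L
    turn-sum (a , false) = l (quad a)
      where l : ∀ q → (q + 1ℤ + (q + 1ℤ) + 0ℤ) + (q + 1ℤ + (q + 1ℤ) + 0ℤ) - (q + q + 1ℤ) ≡ q + q + (1ℤ + (1ℤ + 1ℤ))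
            l = solve-∀
    turn-sum (a , true) = l (quad a)
      where l : ∀ q → (q + q + 1ℤ) + (q + q + 1ℤ) - (q + 1ℤ + (q + 1ℤ) + 0ℤ) ≡ q + q
            l = solve-∀

    -- Reflecting in the block sum itself preserves it, so the sum changes at the edge k only, the
    -- last of the lower half of the 2k + 2 edges. Of two edges of equal difference one lies in each
    -- half, and together they meet all sums.
    ρ : Label → ℕ → ℤ
    ρ L i with <-cmp i k
    ... | tri< _ _ _ = first L
    ... | tri≈ _ _ _ = turn L
    ... | tri> _ _ _ = second L

    ρ-below : ∀ L {i} → i < k → ρ L i ≡ first L
    ρ-below L {i} lt with <-cmp i k
    ... | tri< _ _ _  = refl
    ... | tri≈ ¬a _ _ = contradiction lt ¬a
    ... | tri> ¬a _ _ = contradiction lt ¬a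

    ρ-at : ∀ L → ρ L k ≡ turn L
    ρ-at L with <-cmp k k
    ... | tri< _ ¬b _ = contradiction refl ¬b
    ... | tri≈ _ _ _  = refl
    ... | tri> _ ¬b _ = contradiction refl ¬b

    ρ-above : ∀ L {i} → k < i → ρ L i ≡ second L
    ρ-above L {i} gt with <-cmp i k
    ... | tri< _ _ ¬c = contradiction gt ¬c
    ... | tri≈ _ _ ¬c = contradiction gt ¬c
    ... | tri> _ _ _  = refl

    module Sums (L : Label) where
      open Strand (ρ L)

      stable : ∀ s → s + s - s ≡ s
      stable = solve-∀

      sum-below : ∀ i → i ≤ k → blockSum (first L) i ≡ first L
      sum-below zero    _  = refl
      sum-below (suc i) lt = trans (cong₂ (λ r s → r + r - s) (ρ-below L lt) (sum-below i (≤-trans (n≤1+n i) lt)))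
        (stable (first L))

      sum-above : ∀ j → blockSum (first L) (suc k ℕ.+ j) ≡ second L
      sum-above zero    = trans (cong (blockSum (first L) ∘ suc) (+-identityʳ k))
        (trans (cong₂ (λ r s → r + r - s) (ρ-at L) (sum-below k ≤-refl)) (turn-sum L))
      sum-above (suc j) = trans (cong (blockSum (first L) ∘ suc) (+-suc k j))
        (trans (cong₂ (λ r s → r + r - s) (ρ-above L (s≤s (m≤m+n k j))) (sum-above j)) (stable (second L)))

      sum-top : blockSum (first L) (dbl κ) ≡ second L
      sum-top = trans (cong (blockSum (first L)) (dbl≡+ κ)) (sum-above (suc k))

    label : ∀ q → ∃ λ L → q ≈ first L [ dbl T ] ⊎ q ≈ second L [ dbl T ]
    label q = go (as-centre {T} q)
      where
      go : ∃ (λ (h : Fin T) → ∃ λ par → q ≈ centre (+ toℕ h) par [ dbl T ]) →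
        ∃ λ L → q ≈ first L [ dbl T ] ⊎ q ≈ second L [ dbl T ]
      go (h , par , e) = split par (toℕ h) (toℕ<n h) (halve (toℕ h)) e
        where
        split : ∀ par h → h < T → Halved h → q ≈ centre (+ h) par [ dbl T ] →
          ∃ λ L → q ≈ first L [ dbl T ] ⊎ q ≈ second L [ dbl T ]
        split par _ lt (even a) e = go′ par e
          where
          a<τ = dbl-cancel-< {a} {τ} lt
          a′ = fromℕ< a<τ
          h≡ : + dbl a ≡ quad a′
          h≡ = trans (+dbl a) (cong (λ a → + a + + a) (sym (toℕ-fromℕ< a<τ)))
          go′ : ∀ par → q ≈ centre (+ dbl a) par [ dbl T ] → ∃ λ L → q ≈ first L [ dbl T ] ⊎ q ≈ second L [ dbl T ]
          go′ true  e = (a′ , false) , inj₁ (≈-trans e (≈-reflexive (cong (λ h → centre h true) h≡)))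
          go′ false e = (a′ , true)  , inj₂ (≈-trans e
            (≈-reflexive (trans (cong (λ h → centre h false) h≡) (ℤ.+-identityʳ (quad a′ + quad a′)))))
        split par _ lt (odd a) e = go′ par e
          where
          a<τ = dbl-cancel-< {a} {τ} (<-trans (n<1+n _) lt)
          a′ = fromℕ< a<τ
          h≡ : + suc (dbl a) ≡ quad a′ + 1ℤ
          h≡ = trans (cong (λ z → 1ℤ + z) (trans (+dbl a) (cong (λ a → + a + + a) (sym (toℕ-fromℕ< a<τ))))) (l (quad a′))
            where l : ∀ q → 1ℤ + q ≡ q + 1ℤ
                  l = solve-∀
          go′ : ∀ par → q ≈ centre (+ suc (dbl a)) par [ dbl T ] → ∃ λ L → q ≈ first L [ dbl T ] ⊎ q ≈ second L [ dbl T ]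
          go′ true  e = (a′ , false) , inj₂ (≈-trans e (≈-reflexive (trans (cong (λ h → centre h true) h≡) (l (quad a′)))))
            where l : ∀ q → q + 1ℤ + (q + 1ℤ) + 1ℤ ≡ q + q + (1ℤ + (1ℤ + 1ℤ))
                  l = solve-∀
          go′ false e = (a′ , true)  , inj₁ (≈-trans e (≈-reflexive (cong (λ h → centre h false) h≡)))

    open Grid N (dbl T)
    open Reflecting N T N Factor base (halfOf ∘ proj₂) (parityOf ∘ proj₂) (ρ ∘ proj₂)

    Joined : ℤ × ℤ → ℤ × ℤ → Set
    Joined u v = ∃ λ F → ∃ λ c → Adjacent point (N ℕ.+ N) (path F c) u v

    Joined-sym : ∀ {u v} → Joined u v → Joined v u
    Joined-sym (F , c , a) = F , c , swap a

    within : ∀ y p y′ p′ → y ≈ y′ [ N ] → ¬ p ≈ p′ [ dbl T ] → Joined (y , p) (y′ , p′)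
    within y p y′ p′ y≈y′ p≉p′ = go (label (p + p′))
      where
      go : ∃ (λ L → p + p′ ≈ first L [ dbl T ] ⊎ p + p′ ≈ second L [ dbl T ]) → Joined (y , p) (y′ , p′)
      go (L , inj₁ s) = let x , e₀ = represent-at {N} 0ℤ y
        in (x , L) , flat-bottom (x , L) y p y′ p′ (s≤s z≤n) e₀ (≈-trans e₀ y≈y′) s p≉p′
      go (L , inj₂ s) = let x , e₀ = represent-at {N} (zigzag (dbl κ)) y
        in (x , L) , flat-top (x , L) (dbl κ) y p y′ p′ refl e₀ (≈-trans e₀ y≈y′)
          (≈-trans s (≈-reflexive (sym (Sums.sum-top L)))) p≉p′

    rising : ∀ y p y′ p′ → Rise κ y y′ → Joined (y , p) (y′ , p′)
    rising y p y′ p′ r = go (label (p + p′))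
      where
      open Rise r
      at : ∀ i L → RiseAt N y y′ i → p + p′ ≈ ρ L i [ dbl T ] → Joined (y , p) (y′ , p′)
      at i L ri s = let x , e , e′ = place ri in (x , L) , edge (x , L) i y p y′ p′ (RiseAt.inside ri) e e′ s

      early : ∀ i L → i ≤ k → RiseAt N y y′ i → p + p′ ≈ first L [ dbl T ] → Joined (y , p) (y′ , p′)
      early i L le ri s with m≤n⇒m<n∨m≡n le
      ... | inj₁ lt = at i L ri (≈-trans s (≈-reflexive (sym (ρ-below L lt))))
      -- At the turning edge the sums `first` occur with the two labels exchanged.
      early i (a , false) le ri s | inj₂ refl = at i (a , true)  ri (≈-trans s (≈-reflexive (sym (ρ-at (a , true)))))
      early i (a , true)  le ri s | inj₂ refl = at i (a , false) ri (≈-trans s (≈-reflexive (sym (ρ-at (a , false)))))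

      late : ∀ i L → k < i → RiseAt N y y′ i → p + p′ ≈ second L [ dbl T ] → Joined (y , p) (y′ , p′)
      late i L gt ri s = at i L ri (≈-trans s (≈-reflexive (sym (ρ-above L gt))))

      levels : dbl lo ℕ.+ dbl hi ≡ dbl k
      levels = trans (sym (dbl-+ lo hi)) (cong dbl (suc-injective (trans (sym (+-suc lo hi)) total)))

      go : ∃ (λ L → p + p′ ≈ first L [ dbl T ] ⊎ p + p′ ≈ second L [ dbl T ]) → Joined (y , p) (y′ , p′)
      go (L , s) with dbl lo ≤? k
      go (L , inj₁ s) | yes le = early (dbl lo) L le (rise-lo r) s
      go (L , inj₂ s) | yes le = late (suc (dbl hi)) L (s≤s (+-cancelˡ-≤ (dbl lo) k (dbl hi)
        (≤-trans (+-monoˡ-≤ k le) (≤-reflexive (trans (sym (dbl≡+ k)) (sym levels)))))) (rise-hi r) s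
      go (L , inj₂ s) | no ¬le = late (dbl lo) L (≰⇒> ¬le) (rise-lo r) s
      go (L , inj₁ s) | no ¬le = early (suc (dbl hi)) L (+-cancelˡ-≤ k (suc (dbl hi)) k
        (≤-trans (≤-trans (≤-reflexive (+-suc k (dbl hi))) (+-monoˡ-≤ (dbl hi) (≰⇒> ¬le)))
          (≤-reflexive (trans levels (dbl≡+ k))))) (rise-hi r) s

    cover : Cover (N ℕ.* dbl T) (N ℕ.+ N) T (N ℕ.* (τ ℕ.* 2))
    cover = record
      { Vertex = ℤ × ℤ ; Factor = Factor ; Part = Fin T
      ; enc = point ; enc-onto = point-onto
      ; factors = enum-× enum-Fin (enum-× enum-Fin enum-Bool) ; parts = enum-Fin
      ; path = path
      ; spans = λ { F (y , p) → let i , i<N , e = zigzag-onto N (y - base F) in spans-at F i y p i<N (≈-rebase {i = i} e) }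
      ; covers = λ { (y , p) (y′ , p′) u≢v → covers y p y′ p′ u≢v (y ≈? y′) }
      }
      where
      covers : ∀ y p y′ p′ → point (y , p) ≢ point (y′ , p′) → Dec (y ≈ y′ [ N ]) → Joined (y , p) (y′ , p′)
      covers y p y′ p′ u≢v (yes e) = within y p y′ p′ e λ f → u≢v (point-cong e f)
      covers y p y′ p′ u≢v (no ¬e) with rises κ y y′ ¬e
      ... | inj₁ r = rising y p y′ p′ r
      ... | inj₂ r = Joined-sym (rising y′ p′ y p r)

  -- Bits and ladders

  bit : Bool → Fin 2
  bit false = Fin.zero
  bit true  = Fin.suc Fin.zero

  bit-onto : ∀ i → ∃ λ b → bit b ≡ i
  bit-onto Fin.zero           = false , refl
  bit-onto (Fin.suc Fin.zero) = true , refl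

  par : ℕ → Bool
  par zero    = false
  par (suc n) = not (par n)

  par-dbl : ∀ a → par (dbl a) ≡ false
  par-dbl zero    = refl
  par-dbl (suc a) = trans (not-involutive (par (dbl a))) (par-dbl a)

  par-+ : ∀ a b → par (a ℕ.+ b) ≡ par a xor par b
  par-+ zero    b = refl
  par-+ (suc a) b = trans (cong not (par-+ a b)) (l (par a) (par b))
    where l : ∀ x y → not (x xor y) ≡ not x xor y
          l false y = refl
          l true  y = not-involutive y

  xor-cancelˡ : ∀ x y → x xor (x xor y) ≡ y
  xor-cancelˡ false y = refl
  xor-cancelˡ true  y = not-involutive y

  xor-cancelʳ : ∀ x y → (x xor y) xor y ≡ x
  xor-cancelʳ false false = refl
  xor-cancelʳ false true  = refl
  xor-cancelʳ true  false = refl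
  xor-cancelʳ true  true  = refl

  xor≡false⇒≡ : ∀ x y → x xor y ≡ false → x ≡ y
  xor≡false⇒≡ false false _ = refl
  xor≡false⇒≡ true  true  _ = refl

  xor≡true⇒≡not : ∀ x y → x xor y ≡ true → x ≡ not y
  xor≡true⇒≡not false true  _ = refl
  xor≡true⇒≡not true  false _ = refl

  module Ladder (N : ℕ) .{{_ : NonZero N}} where

    point : ℤ × Bool → Fin (N ℕ.* 2)
    point (y , b) = combine (residue N y) (bit b)

    point-cong : ∀ {y y′ b b′} → y ≈ y′ [ N ] → b ≡ b′ → point (y , b) ≡ point (y′ , b′)
    point-cong e f = cong₂ combine (residue-cong e) (cong bit f)

    point-onto : ∀ w → ∃ λ v → point v ≡ w
    point-onto w = let i , j = remQuot {N} 2 w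
                       b , e = bit-onto j in
      (+ toℕ i , b) , trans (cong₂ combine (residue-toℕ i) e) (combine-remQuot {N} 2 w)

  -- Cycle lengths 2(2g + 1), g = suc f, with 2h + 1 cycles per factor.  The zigzag path on Z_N is cut into
  -- 2h + 1 segments of μ levels.  Segments 2q and 2q + 1 are joined to two cycles by the edge between
  -- them and by the edge between their outer ends, which has the same difference; the last segment
  -- gives one cycle.
  module OddlyManyCycles (f h : ℕ) where

    g μ κ N : ℕ
    g = suc f
    μ = suc (dbl g)
    κ = h ℕ.* μ ℕ.+ g
    N = suc (dbl κ)

    N≡ : N ≡ suc (dbl h) ℕ.* μ
    N≡ = cong suc (trans (dbl-+ (h ℕ.* μ) g) (trans
      (cong (ℕ._+ dbl g) (trans (dbl≡+ (h ℕ.* μ)) (trans (sym (*-distribʳ-+ μ h h)) (cong (ℕ._* μ) (sym (dbl≡+ h))))))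
      (+-comm _ (dbl g))))

    -- Marks every other segment, so that the segment h, which is its own mirror image, stays
    -- unmarked.
    flips : ℕ → Bool
    flips r = par (r ℕ.+ h)

    -- The step whose crossing is changed in a marked segment: the first step before the middle
    -- segment and the last step beyond it, so that mirrored segments change mirrored steps.
    extra : ℕ → ℕ → Bool
    extra r ρ with r <? h
    ... | yes _ = does (ρ ℕ.≟ 0)
    ... | no  _ = does (suc ρ ℕ.≟ dbl g)

    -- Alternation along the 2g steps of a segment already makes mirrored steps complementary. The
    -- exceptional steps keep this and reverse the total crossing of the marked segments.
    crossing : ℕ → ℕ → Bool
    crossing r ρ = not (par ρ) xor (flips r ∧ extra r ρ)

    β : ℕ → ℕ → Bool
    β r zero    = false
    β r (suc ρ) = β r ρ xor crossing r ρ

    mirror-extra : ∀ {r r′ ρ ρ′} → r < h → r ℕ.+ r′ ≡ dbl h → ρ ℕ.+ ρ′ ℕ.+ 2 ≡ μ → extra r ρ ≡ extra r′ ρ′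
    mirror-extra {r} {r′} {ρ} {ρ′} r<h er eρ with r <? h | r′ <? h
    ... | no r≮h | _ = contradiction r<h r≮h
    ... | yes _ | yes r′<h = contradiction (+-mono-< r<h r′<h) (<-irrefl (trans er (dbl≡+ h)))
    ... | yes _ | no _ = does-⇔ (mk⇔
      (λ ρ≡0 → suc-injective (trans (+-comm 2 ρ′) (trans (cong (λ ρ → ρ ℕ.+ ρ′ ℕ.+ 2) (sym ρ≡0)) eρ)))
      (λ e → +-cancelʳ-≡ (suc (suc ρ′)) ρ 0 (trans (l ρ ρ′) (trans eρ (cong suc (sym e))))))
      (ρ ℕ.≟ 0) (suc ρ′ ℕ.≟ dbl g)
      where l : ∀ a b → a ℕ.+ suc (suc b) ≡ a ℕ.+ b ℕ.+ 2
            l = solveℕ-∀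

    -- Mirrored steps are the two zigzag edges of equal difference: one of them covers the pairs
    -- with equal bits, the other the pairs with different bits. Only the position of `extra` needs
    -- care, and it was chosen symmetrically.
    mirror : ∀ {r r′ ρ ρ′} → r ℕ.+ r′ ≡ dbl h → ρ ℕ.+ ρ′ ℕ.+ 2 ≡ μ → crossing r ρ ≡ not (crossing r′ ρ′)
    mirror {r} {r′} {ρ} {ρ′} er eρ = trans (cong₂ (λ x y → not x xor y) parities flipped)
      (l (par ρ′) (flips r′ ∧ extra r′ ρ′))
      where
      l : ∀ x y → not (not x) xor y ≡ not (not x xor y)
      l false false = refl
      l false true  = refl
      l true  false = refl
      l true  true  = refl
      parities : par ρ ≡ not (par ρ′)
      parities = xor≡true⇒≡not (par ρ) (par ρ′) (trans (sym (par-+ ρ ρ′))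
        (trans (sym (not-involutive _)) (trans (cong par (trans (+-comm 2 (ρ ℕ.+ ρ′)) eρ)) (cong not (par-dbl g)))))
      same-flips : flips r ≡ flips r′
      same-flips = trans (par-+ r h) (trans (cong (_xor par h)
        (xor≡false⇒≡ (par r) (par r′) (trans (sym (par-+ r r′)) (trans (cong par er) (par-dbl h))))) (sym (par-+ r′ h)))
      flipped : flips r ∧ extra r ρ ≡ flips r′ ∧ extra r′ ρ′
      flipped with <-cmp r h
      ... | tri< r<h _ _ = cong₂ _∧_ same-flips (mirror-extra r<h er eρ)
      ... | tri≈ _ r≡h _ = trans (cong (_∧ extra r ρ) off) (sym (cong (_∧ extra r′ ρ′) (trans (sym same-flips) off)))
        where off : flips r ≡ false
              off = trans (cong (λ r → par (r ℕ.+ h)) r≡h) (trans (cong par (sym (dbl≡+ h))) (par-dbl h))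
      ... | tri> _ _ r>h = cong₂ _∧_ same-flips (sym
        (mirror-extra {r′} {r} {ρ′} {ρ} r′<h (trans (+-comm r′ r) er) (trans (cong (ℕ._+ 2) (+-comm ρ′ ρ)) eρ)))
        where r′<h : r′ < h
              r′<h = ≰⇒> λ h≤r′ → <-irrefl (trans (sym (dbl≡+ h)) (sym er)) (+-mono-<-≤ r>h h≤r′)

    -- Exactly one of the edges inside a segment r ≠ h has its crossing changed.
    plain : ℕ → Bool
    plain zero    = false
    plain (suc ρ) = plain ρ xor not (par ρ)

    tally : ℕ → ℕ → Bool
    tally r zero    = false
    tally r (suc ρ) = tally r ρ xor extra r ρ

    β-split : ∀ r ρ → β r ρ ≡ plain ρ xor (flips r ∧ tally r ρ)
    β-split r zero    = l (flips r)
      where l : ∀ x → false ≡ x ∧ false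
            l false = refl
            l true  = refl
    β-split r (suc ρ) = trans (cong (_xor crossing r ρ) (β-split r ρ))
      (l (plain ρ) (not (par ρ)) (flips r) (tally r ρ) (extra r ρ))
      where l : ∀ a b c d e → (a xor (c ∧ d)) xor (b xor (c ∧ e)) ≡ (a xor b) xor (c ∧ (d xor e))
            l false false false d e = refl
            l false false true  d e = refl
            l false true  false d e = refl
            l false true  true  false e = refl
            l false true  true  true  e = refl
            l true  false false d e = refl
            l true  false true  false false = refl
            l true  false true  false true = refl
            l true  false true  true  false = refl
            l true  false true  true  true = refl
            l true  true  false d e = refl
            l true  true  true  false false = refl
            l true  true  true  false true = refl
            l true  true  true  true  false = refl
            l true  true  true  true  true = refl

    tally-top : ∀ r → tally r (dbl g) ≡ true
    tally-top r = go (r <? h)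
     where
     go : Dec (r < h) → tally r (dbl g) ≡ true
     go (yes r<h) = first (suc (dbl f))
      where
      ex : ∀ ρ → extra r ρ ≡ does (ρ ℕ.≟ 0)
      ex ρ with r <? h
      ... | yes _ = refl
      ... | no ¬p = contradiction r<h ¬p
      first : ∀ ρ → tally r (suc ρ) ≡ true
      first zero    = ex 0
      first (suc ρ) = cong₂ _xor_ (first ρ) (ex (suc ρ))
     go (no r≮h) = cong₂ _xor_ (none (suc (dbl f)) ≤-refl) (trans (ex (suc (dbl f))) (dec-true (dbl g ℕ.≟ dbl g) refl))
      where
      ex : ∀ ρ → extra r ρ ≡ does (suc ρ ℕ.≟ dbl g)
      ex ρ with r <? h
      ... | no _  = refl
      ... | yes p = contradiction p r≮h
      none : ∀ ρ → ρ < dbl g → tally r ρ ≡ false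
      none zero    _  = refl
      none (suc ρ) lt = cong₂ _xor_ (none ρ (<-trans (n<1+n ρ) lt)) (trans (ex ρ) (dec-false (suc ρ ℕ.≟ dbl g) (<⇒≢ lt)))

    -- For even r, the link from segment r to segment r + 1 changes the bit by `β r (dbl g)`, and
    -- the edge between their outer ends by `β (suc r) (dbl g)`. Both have the same difference, so
    -- they must be complementary; marking every other segment achieves this.
    β-alternates : ∀ r → β (suc r) (dbl g) ≡ not (β r (dbl g))
    β-alternates r = trans (β-top (suc r)) (trans (l (plain (dbl g)) (flips r)) (cong not (sym (β-top r))))
      where
      l : ∀ x y → x xor not y ≡ not (x xor y)
      l false y = refl
      l true  y = refl
      β-top : ∀ r → β r (dbl g) ≡ plain (dbl g) xor flips r
      β-top r = trans (β-split r (dbl g)) (cong (plain (dbl g) xor_)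
        (trans (cong (flips r ∧_) (tally-top r)) (∧-identityʳ (flips r))))

    Part : Set
    Part = (Fin h × Bool) ⊎ Fin 1

    open Ladder N

    index : ℕ → ℕ → ℕ
    index r ρ = r ℕ.* μ ℕ.+ ρ

    spot : ℤ → ℕ → ℕ → Bool → ℤ × Bool
    spot x r ρ b = x + zigzag (index r ρ) , b xor β r ρ

    -- An odd-numbered segment is run through from its far end, so that the bottom closing edge
    -- joins the outer ends of the two segments and the top closing edge is the link.
    level : ℤ → Part → Bool → ℕ → ℤ × Bool
    level x (inj₁ (q , b)) false ρ = spot x (dbl (toℕ q)) ρ b
    level x (inj₁ (q , b)) true  ρ = spot x (suc (dbl (toℕ q))) (dbl g ∸ ρ) b
    level x (inj₂ _)       s     ρ = spot x (dbl h) ρ s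

    path : Fin N → Part → ℕ → ℤ × Bool
    path x c = DoubleStrand.walk point μ (level (+ toℕ x) c)

    index-< : ∀ {r} → index r 0 < N → r < suc (dbl h)
    index-< {r} lt = *-cancelʳ-< μ r (suc (dbl h)) (≤-<-trans (m≤m+n (r ℕ.* μ) 0) (<-≤-trans lt (≤-reflexive N≡)))

    locate : ∀ i → i < N → ∃ λ r → ∃ λ ρ → r < suc (dbl h) × ρ < μ × i ≡ index r ρ
    locate i i<N = i / μ , i % μ , index-< (≤-<-trans (≤-trans (+-monoʳ-≤ (i / μ ℕ.* μ) z≤n) (≤-reflexive (sym eq))) i<N) ,
      m%n<n i μ , eq
      where eq : i ≡ index (i / μ) (i % μ)
            eq = trans (m≡m%n+[m/n]*n i μ) (+-comm (i % μ) _)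

    data Segment : ℕ → Set where
      lower : (q : Fin h) → Segment (dbl (toℕ q))
      upper : (q : Fin h) → Segment (suc (dbl (toℕ q)))
      last  : Segment (dbl h)

    segment : ∀ r → r < suc (dbl h) → Segment r
    segment r lt = go (halve r) lt
      where
      go : ∀ {r} → Halved r → r < suc (dbl h) → Segment r
      go (odd q) lt = subst (Segment ∘ suc ∘ dbl) (toℕ-fromℕ< q<h) (upper (fromℕ< q<h))
        where q<h : q < h
              q<h = dbl-cancel-< (≤-pred lt)
      go (even q) lt with q <? h
      ... | yes q<h = subst (Segment ∘ dbl) (toℕ-fromℕ< q<h) (lower (fromℕ< q<h))
      ... | no  q≮h = subst (Segment ∘ dbl) (≤-antisym (≮⇒≥ q≮h) (≤-pred (dbl-cancel-< {q} {suc h} (m<n⇒m<1+n lt)))) last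

    on-spot : ∀ (x : Fin N) {r ρ} b → Segment r → ρ < μ →
              ∃ λ c → ∃ λ k → k < μ ℕ.+ μ × point (path x c k) ≡ point (spot (+ toℕ x) r ρ b)
    on-spot x b (lower q) lt = inj₁ (q , b) , DoubleStrand.on point μ (level (+ toℕ x) (inj₁ (q , b))) false lt
    on-spot x {ρ = ρ} b (upper q) lt =
      let k , k<m , e = DoubleStrand.on point μ (level (+ toℕ x) (inj₁ (q , b))) true {dbl g ∸ ρ} (s≤s (m∸n≤m (dbl g) ρ))
      in inj₁ (q , b) , k , k<m , trans e (cong (λ ρ → point (spot (+ toℕ x) (suc (dbl (toℕ q))) ρ b))
        (m∸[m∸n]≡n (≤-pred lt)))
    on-spot x b last lt = inj₂ Fin.zero , DoubleStrand.on point μ (level (+ toℕ x) (inj₂ Fin.zero)) b lt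

    along-spot : ∀ (x : Fin N) {r ρ} b → Segment r → suc ρ < μ →
                 ∃ λ c → Adjacent point (μ ℕ.+ μ) (path x c) (spot (+ toℕ x) r ρ b) (spot (+ toℕ x) r (suc ρ) b)
    along-spot x b (lower q) lt = inj₁ (q , b) , DoubleStrand.along point μ (level (+ toℕ x) (inj₁ (q , b))) false lt
    along-spot x {ρ = ρ} b (upper q) (s≤s lt) = inj₁ (q , b) , swap (Adjacent-resp
        (DoubleStrand.along point μ (level (+ toℕ x) (inj₁ (q , b))) true {dbl g ∸ suc ρ}
          (s≤s (≤-trans (≤-reflexive (sym down)) (m∸n≤m (dbl g) ρ))))
        (cong (λ ρ → point (spot (+ toℕ x) (suc (dbl (toℕ q))) ρ b)) (m∸[m∸n]≡n lt))
        (cong (λ ρ → point (spot (+ toℕ x) (suc (dbl (toℕ q))) ρ b))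
          (trans (cong (dbl g ∸_) (sym down)) (m∸[m∸n]≡n (<⇒≤ lt)))))
      where down : dbl g ∸ ρ ≡ suc (dbl g ∸ suc ρ)
            down = +-∸-assoc 1 lt
    along-spot x b last lt = inj₂ Fin.zero , DoubleStrand.along point μ (level (+ toℕ x) (inj₂ Fin.zero)) b lt

    Joined : ℤ × Bool → ℤ × Bool → Set
    Joined u v = ∃ λ x → ∃ λ c → Adjacent point (μ ℕ.+ μ) (path x c) u v

    Joined-sym : ∀ {u v} → Joined u v → Joined v u
    Joined-sym (F , c , a) = F , c , swap a

    within : ∀ y b y′ → y ≈ y′ [ N ] → Joined (y , b) (y′ , not b)
    within y b y′ y≈y′ =
      let x , e₀ = represent-at {N} z y
      in x , inj₂ Fin.zero , Adjacent-resp (DoubleStrand.bottom point μ (level (+ toℕ x) (inj₂ Fin.zero)) b (s≤s z≤n))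
           (point-cong e₀ (xor-identityʳ b)) (point-cong (≈-trans e₀ y≈y′) (xor-identityʳ (not b)))
      where
      z = zigzag (index (dbl h) 0)

    par-index : ∀ r → par (r ℕ.* μ) ≡ par r
    par-index zero    = refl
    par-index (suc r) = trans (par-+ μ (r ℕ.* μ)) (cong₂ _xor_ (cong not (par-dbl g)) (par-index r))

    -- The outer ends lie on opposite arms of the zigzag, at distances qμ + 2g + 1 and qμ from 0.
    -- These add up to the rise of the link, which starts at level 2qμ + 2g.
    far-ends : ∀ q lo → dbl lo ≡ index (dbl q) (dbl g) →
               zigzag (index (suc (dbl q)) (dbl g)) - zigzag (index (dbl q) 0) ≡ + suc (dbl lo)
    far-ends q lo eq = trans (cong₂ (λ i j → zigzag i - zigzag j) upper≡ lower≡)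
      (trans (cong₂ _-_ (zigzag-odd A) (zigzag-even B))
        (trans (l (+ A) (+ B)) (trans (cong (λ z → 1ℤ + z) (sym (pos-+ A B)))
        (cong (λ n → + suc n) (trans total (sym eq))))))
      where
      A = q ℕ.* μ ℕ.+ dbl g
      B = q ℕ.* μ
      dbl-* : ∀ q m → dbl q ℕ.* m ≡ dbl (q ℕ.* m)
      dbl-* q m = trans (cong (ℕ._* m) (dbl≡+ q)) (trans (*-distribʳ-+ m q q) (sym (dbl≡+ (q ℕ.* m))))
      lower≡ : index (dbl q) 0 ≡ dbl B
      lower≡ = trans (+-identityʳ _) (dbl-* q μ)
      upper≡ : index (suc (dbl q)) (dbl g) ≡ suc (dbl A)
      upper≡ = cong suc (trans (cong (λ z → dbl g ℕ.+ z ℕ.+ dbl g) (dbl-* q μ))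
        (trans (cong (λ z → dbl g ℕ.+ z ℕ.+ dbl g) (dbl≡+ B)) (trans (l′ B (dbl g)) (sym (dbl≡+ A)))))
        where l′ : ∀ b g → g ℕ.+ (b ℕ.+ b) ℕ.+ g ≡ (b ℕ.+ g) ℕ.+ (b ℕ.+ g)
              l′ = solveℕ-∀
      l : ∀ a b → (1ℤ + a) - (- b) ≡ 1ℤ + (a + b)
      l = solve-∀
      total : A ℕ.+ B ≡ index (dbl q) (dbl g)
      total = trans (l′ B (dbl g)) (cong (ℕ._+ dbl g) (trans (sym (dbl≡+ B)) (sym (dbl-* q μ))))
        where l′ : ∀ b g → b ℕ.+ g ℕ.+ b ≡ (b ℕ.+ b) ℕ.+ g
              l′ = solveℕ-∀

    bool-split : ∀ x y → x ≡ y ⊎ x ≡ not y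
    bool-split false false = inj₁ refl
    bool-split false true  = inj₂ refl
    bool-split true  false = inj₂ refl
    bool-split true  true  = inj₁ refl

    rising : ∀ y b y′ b′ → Rise κ y y′ → Joined (y , b) (y′ , b′)
    rising y b y′ b′ r = go (locate (dbl lo) (<-trans (n<1+n _) (RiseAt.inside (rise-lo r))))
      where
      open Rise r

      solve-bit : ∀ b b′ c → b xor b′ ≡ c → b xor c ≡ b′
      solve-bit b b′ _ refl = xor-cancelˡ b b′

      step-bit : ∀ b b′ c d → b xor b′ ≡ d → (b xor c) xor (c xor d) ≡ b′
      step-bit b b′ c _ refl = trans (xor-assoc b c (c xor (b xor b′)))
        (trans (cong (b xor_) (xor-cancelˡ c (b xor b′))) (xor-cancelˡ b b′))

      inner : ∀ i r ρ → RiseAt N y y′ i → i ≡ index r ρ → Segment r → suc ρ < μ → b xor b′ ≡ crossing r ρ →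
        Joined (y , b) (y′ , b′)
      inner i r ρ ri eq seg lt d =
        let x , e , e′ = place ri
            c , a = along-spot x {r} {ρ} (b xor β r ρ) seg lt
        in x , c , Adjacent-resp a
          (point-cong (≈-trans (≈-reflexive (cong (λ i → + toℕ x + zigzag i) (sym eq))) e) (xor-cancelʳ b (β r ρ)))
          (point-cong (≈-trans (≈-reflexive (cong (λ i → + toℕ x + zigzag i)
            (trans (+-suc (r ℕ.* μ) ρ) (cong suc (sym eq))))) e′) (step-bit b b′ (β r ρ) (crossing r ρ) d))

      mirrored : ∀ {r ρ} → r < suc (dbl h) → suc ρ < μ → dbl lo ≡ index r ρ → b xor b′ ≡ not (crossing r ρ) →
        Joined (y , b) (y′ , b′)
      mirrored {r₁} {ρ} r<t (s≤s lt) eq d = inner (suc (dbl hi)) r′ ρ′ (rise-hi r) hi≡ (segment r′ (s≤s (m∸n≤m (dbl h) r₁)))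
          (≤-trans (≤-reflexive (+-comm 2 ρ′)) (≤-trans (≤-trans (m≤n+m (ρ′ ℕ.+ 2) ρ) (≤-reflexive (sym (+-assoc ρ ρ′ 2))))
            (≤-reflexive eρ)))
          (trans d (sym (mirror {r′} {r₁} {ρ′} {ρ} (trans (+-comm r′ r₁) er) (trans (cong (ℕ._+ 2) (+-comm ρ′ ρ)) eρ))))
        where
        r′ = dbl h ∸ r₁
        ρ′ = dbl g ∸ suc ρ
        er : r₁ ℕ.+ r′ ≡ dbl h
        er = m+[n∸m]≡n (≤-pred r<t)
        eρ : ρ ℕ.+ ρ′ ℕ.+ 2 ≡ μ
        eρ = trans (l ρ ρ′) (cong suc (m+[n∸m]≡n lt))
          where l : ∀ a b → a ℕ.+ b ℕ.+ 2 ≡ suc (suc a ℕ.+ b)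
                l = solveℕ-∀
        N′ : dbl lo ℕ.+ suc (dbl hi) ℕ.+ 2 ≡ N
        N′ = trans (l (dbl lo) (dbl hi)) (cong suc (trans (sym (dbl-+ lo (suc hi))) (cong dbl total)))
          where l : ∀ a b → a ℕ.+ suc b ℕ.+ 2 ≡ suc (a ℕ.+ suc (suc b))
                l = solveℕ-∀
        hi≡ : suc (dbl hi) ≡ index r′ ρ′
        hi≡ = +-cancelˡ-≡ (index r₁ ρ) _ _ (+-cancelʳ-≡ 2 _ _
          (trans (cong (λ z → z ℕ.+ suc (dbl hi) ℕ.+ 2) (sym eq)) (trans N′ (trans N≡
          (trans (+-comm μ (dbl h ℕ.* μ)) (trans (cong₂ (λ a b → a ℕ.* μ ℕ.+ b) (sym er) (sym eρ)) (l r₁ r′ ρ ρ′ μ)))))))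
          where l : ∀ a b c d m → (a ℕ.+ b) ℕ.* m ℕ.+ (c ℕ.+ d ℕ.+ 2) ≡ (a ℕ.* m ℕ.+ c) ℕ.+ (b ℕ.* m ℕ.+ d) ℕ.+ 2
                l = solveℕ-∀

      link : ∀ {r} → Segment r → index r (suc (dbl g)) < N → dbl lo ≡ index r (dbl g) → Joined (y , b) (y′ , b′)
      link last lt _ = contradiction (<-≤-trans lt (≤-reflexive (trans N≡ (+-comm μ _)))) (<-irrefl refl)
      -- A step which rises by `dbl lo + 1` starts at an even level, but the last level of an
      -- odd-numbered segment is odd because μ is odd.
      link (upper q) lt eq = contradiction (trans (sym (par-dbl lo))
        (trans (cong par eq) (trans (par-+ (suc (dbl (toℕ q)) ℕ.* μ) (dbl g))
        (cong₂ _xor_ (trans (par-index (suc (dbl (toℕ q)))) (cong not (par-dbl (toℕ q)))) (par-dbl g))))) λ ()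
      link (lower q) lt eq = choose (bool-split (b xor b′) (β (dbl (toℕ q)) (dbl g)))
        where
        part : Bool → Part
        part b = inj₁ (q , b)
        choose : b xor b′ ≡ β (dbl (toℕ q)) (dbl g) ⊎ b xor b′ ≡ not (β (dbl (toℕ q)) (dbl g)) → Joined (y , b) (y′ , b′)
        choose (inj₁ d) =
          let x , e , e′ = place (rise-lo r)
              B = β (dbl (toℕ q)) (dbl g)
          in x , part (b xor B) , Adjacent-resp (DoubleStrand.top point μ (level (+ toℕ x) (part (b xor B))) false refl)
            (point-cong (≈-trans (≈-reflexive (cong (λ i → + toℕ x + zigzag i) (sym eq))) e) (xor-cancelʳ b B))
            (trans (cong (λ ρ → point (spot (+ toℕ x) (suc (dbl (toℕ q))) ρ (b xor B))) (n∸n≡0 (dbl g)))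
              (point-cong (≈-trans (≈-reflexive (cong (λ i → + toℕ x + zigzag i) next≡)) e′)
                (trans (xor-identityʳ (b xor B)) (solve-bit b b′ B d))))
          where
          next≡ : index (suc (dbl (toℕ q))) 0 ≡ suc (dbl lo)
          next≡ = trans (+-identityʳ _) (cong suc (trans (+-comm (dbl g) _) (sym eq)))
        choose (inj₂ d) =
          let x , e₀ = represent-at {N} z y
              e₁ : + toℕ x + z′ ≈ y′ [ N ]
              e₁ = ≈-by₂ e₀ (≈-sym differ) (trans (l (+ toℕ x) z z′ y y′)
                (cong (λ d → (+ toℕ x + z - y) + (d - (y′ - y))) (far-ends (toℕ q) lo eq)))
          in x , part b , Adjacent-resp (DoubleStrand.bottom point μ (level (+ toℕ x) (part b)) false (s≤s z≤n))
            (point-cong e₀ (xor-identityʳ b))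
            (point-cong e₁
              (solve-bit b b′ (β (suc (dbl (toℕ q))) (dbl g)) (trans d (sym (β-alternates (dbl (toℕ q)))))))
          where
          z = zigzag (index (dbl (toℕ q)) 0)
          z′ = zigzag (index (suc (dbl (toℕ q))) (dbl g))
          l : ∀ x z z′ y y′ → x + z′ - y′ ≡ (x + z - y) + ((z′ - z) - (y′ - y))
          l = solve-∀

      go : ∃ (λ r → ∃ λ ρ → r < suc (dbl h) × ρ < μ × dbl lo ≡ index r ρ) → Joined (y , b) (y′ , b′)
      go (r₁ , ρ , r<t , ρ<μ , eq) with suc ρ <? μ
      ... | no ¬lt = link (segment r₁ r<t) (≤-trans
        (≤-reflexive (cong suc (trans (+-suc (r₁ ℕ.* μ) (dbl g)) (cong suc (sym eq′))))) (RiseAt.inside (rise-lo r))) eq′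
        where
        eq′ : dbl lo ≡ index r₁ (dbl g)
        eq′ = trans eq (cong (index r₁) (≤-antisym (≤-pred ρ<μ) (≤-pred (≮⇒≥ ¬lt))))
      ... | yes lt with bool-split (b xor b′) (crossing r₁ ρ)
      ...   | inj₁ d = inner (dbl lo) r₁ ρ (rise-lo r) eq (segment r₁ r<t) lt d
      ...   | inj₂ d = mirrored r<t lt eq d

    cover : Cover (N ℕ.* 2) (μ ℕ.+ μ) (h ℕ.* 2 ℕ.+ 1) N
    cover = record
      { Vertex = ℤ × Bool ; Factor = Fin N ; Part = Part
      ; enc = point ; enc-onto = point-onto
      ; factors = enum-Fin ; parts = enum-⊎ (enum-× enum-Fin enum-Bool) enum-Fin
      ; path = path
      ; spans = λ { x (y , b) → spans x y b }
      ; covers = λ { (y , b) (y′ , b′) u≢v → covers y b y′ b′ u≢v (y ≈? y′) }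
      }
      where
      spans : ∀ (x : Fin N) y b → ∃ λ c → ∃ λ k → k < μ ℕ.+ μ × point (path x c k) ≡ point (y , b)
      spans x y b =
        let i , i<N , e = zigzag-onto N (y - + toℕ x)
            r , ρ , r<t , ρ<μ , eq = locate i i<N
            c , k , k<m , e′ = on-spot x {r} {ρ} (b xor β r ρ) (segment r r<t) ρ<μ
        in c , k , k<m , trans e′ (point-cong (≈-trans (≈-reflexive (cong (λ i → + toℕ x + zigzag i) (sym eq)))
          (≈-rebase {x = + toℕ x} {y = y} {i = i} e)) (xor-cancelʳ b (β r ρ)))
      covers : ∀ y b y′ b′ → point (y , b) ≢ point (y′ , b′) → Dec (y ≈ y′ [ N ]) → Joined (y , b) (y′ , b′)
      covers y b y′ b′ u≢v (yes e) = subst (λ b′ → Joined (y , b) (y′ , b′))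
        (sym (¬-not {b′} {b} λ f → u≢v (point-cong {b = b} {b′ = b′} e (sym f)))) (within y b y′ e)
      covers y b y′ b′ u≢v (no ¬e) with rises κ y y′ ¬e
      ... | inj₁ r = rising y b y′ b′ r
      ... | inj₂ r = Joined-sym (rising y′ b′ y b r)

  -- Cycles of odd length

  -- Odd cycle lengths 2f + 3 with 4L cycles per factor (L = suc L′, f = suc e).  Half of the vertices
  -- of the middle level are apexes of cycles through the levels before it (true), the other half of
  -- cycles through the levels after it.  The blocks next to the middle level have sum 1 resp. 0; the
  -- pair of their indices c, c′ determines which factor joins them, and from which side, via the
  -- Latin square c + c′ on Z_T.
  module FourDividesNumber (e L′ : ℕ) where

    f L T N m : ℕ
    f = suc e
    L = suc L′
    T = dbl L
    N = suc (dbl (suc f))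
    m = suc (suc f) ℕ.+ suc f

    Label : Set
    Label = Bool × Fin L

    value : Label → ℤ
    value (a , l) = + toℕ l + (if a then + L else 0ℤ)

    -- Over both sides and all labels these are the residues modulo 2T.
    turn : Bool → Label → ℤ
    turn true  j = value j
    turn false j = value j + + T

    -- After the first reflection the block sum stays the same. It is odd for `u = true` and even
    -- for `u = false`; doubling removes the summand T modulo 2T, so both sides together meet every
    -- residue again.
    ρ : Bool → Label → ℕ → ℤ
    ρ u j zero    = turn u j
    ρ u j (suc _) = turn u j + turn u j - centre 0ℤ u

    blockSum-const : ∀ u j o → Strand.blockSum (ρ u j) (centre 0ℤ u) (suc o) ≡ turn u j + turn u j - centre 0ℤ u
    blockSum-const u j zero    = refl
    blockSum-const u j (suc o) = trans (cong (λ s → w + w - s) (blockSum-const u j o)) (l w)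
      where w = turn u j + turn u j - centre 0ℤ u
            l : ∀ s → s + s - s ≡ s
            l = solve-∀

    position : Bool → ℕ → ℕ
    position true  o = f ∸ o
    position false o = suc (suc f) ℕ.+ o

    -- The indices of the apex and of the neighbouring block add up to l on the side `true` and to l
    -- + L on the side `false`, which are the two halves of Z_T. The bits a and `not a` select
    -- complementary transversals, so the apexes fill the middle level.
    tip : Bool → Label → Fin T → ℤ
    tip true  (a , l) c = pair T 0ℤ false (toℕ (residue T (+ toℕ l - + toℕ c))) a
    tip false (a , l) c = pair T 0ℤ true (toℕ (residue T (+ toℕ l + + L - + toℕ c))) (not a)

    Factor Part : Set
    Factor = Fin N × Label
    Part   = Bool × Fin T

    open Grid N (dbl T)

    apex : Factor → Part → ℤ × ℤ
    apex (x , j) (u , c) = + toℕ x + zigzag (suc f) , tip u j c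

    level : Factor → Part → Bool → ℕ → ℤ × ℤ
    level (x , j) (u , c) s o = + toℕ x + zigzag (position u o) , Strand.strand (ρ u j) o (pair T 0ℤ u (toℕ c) s)

    path : Factor → Part → ℕ → ℤ × ℤ
    path F c = ApexWalk.walk point f (apex F c) (level F c)

    Joined : ℤ × ℤ → ℤ × ℤ → Set
    Joined u v = ∃ λ F → ∃ λ c → Adjacent point m (path F c) u v

    Joined-sym : ∀ {u v} → Joined u v → Joined v u
    Joined-sym (F , c , a) = F , c , swap a

    value-onto : ∀ r → r < T → ∃ λ j → + r ≡ value j
    value-onto r r<T with r <? L
    ... | yes r<L = (false , fromℕ< r<L) , sym (trans (ℤ.+-identityʳ _) (cong +_ (toℕ-fromℕ< r<L)))
    ... | no  r≮L = (true , fromℕ< lt) , sym (trans (cong (λ z → + z + + L) (toℕ-fromℕ< lt))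
      (trans (sym (pos-+ (r ∸ L) L)) (cong +_ (m∸n+n≡m (≮⇒≥ r≮L)))))
      where lt : r ∸ L < L
            lt = +-cancelʳ-< L (r ∸ L) L (≤-<-trans (≤-reflexive (m∸n+n≡m (≮⇒≥ r≮L)))
              (<-≤-trans r<T (≤-reflexive (dbl≡+ L))))

    turn-onto : ∀ q → ∃ λ u → ∃ λ j → q ≈ turn u j [ dbl T ]
    turn-onto q = go (toℕ (residue (dbl T) q)) (toℕ<n (residue (dbl T) q)) (residue-≈ (dbl T) q)
      where
      go : ∀ r → r < dbl T → + r ≈ q [ dbl T ] → ∃ λ u → ∃ λ j → q ≈ turn u j [ dbl T ]
      go r r<M e with r <? T
      ... | yes r<T = let j , eq = value-onto r r<T in true , j , ≈-trans (≈-sym e) (≈-reflexive eq)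
      ... | no  r≮T = let j , eq = value-onto (r ∸ T) lt in false , j , ≈-trans (≈-sym e) (≈-reflexive
                        (trans (cong +_ (sym (m∸n+n≡m (≮⇒≥ r≮T)))) (trans (pos-+ (r ∸ T) T) (cong (λ z → z + + T) eq))))
        where lt : r ∸ T < T
              lt = +-cancelʳ-< T (r ∸ T) T (≤-<-trans (≤-reflexive (m∸n+n≡m (≮⇒≥ r≮T)))
                (<-≤-trans r<M (≤-reflexive (dbl≡+ T))))

    twice-turn : ∀ u u′ j → turn u j + turn u j ≈ turn u′ j + turn u′ j [ dbl T ]
    twice-turn true  true  j = ≈-refl
    twice-turn false false j = ≈-refl
    twice-turn true  false j = ≈-shift (- 1ℤ) (trans (l (value j) (+ T)) (cong (λ z → - 1ℤ * z) (sym (+dbl T))))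
      where l : ∀ v t → v + v - (v + t + (v + t)) ≡ - 1ℤ * (t + t)
            l = solve-∀
    twice-turn false true  j = ≈-shift 1ℤ (trans (l (value j) (+ T)) (cong (λ z → 1ℤ * z) (sym (+dbl T))))
      where l : ∀ v t → (v + t + (v + t)) - (v + v) ≡ 1ℤ * (t + t)
            l = solve-∀

    rim-sum : ∀ q → ∃ λ u → ∃ λ j → q ≈ turn u j + turn u j - centre 0ℤ u [ dbl T ]
    rim-sum q =
      let h , u , s = as-centre {T} q
          x = + toℕ h + (if u then 1ℤ else 0ℤ)
          u′ , j , e = turn-onto x
      in u , j , ≈-trans s (≈-trans (≈-reflexive (l (+ toℕ h) u)) (≈-minus (≈-trans (≈-double e) (twice-turn u′ u j))))
      where
      ≈-minus : ∀ {x y c} → x ≈ y [ dbl T ] → x - c ≈ y - c [ dbl T ]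
      ≈-minus {x} {y} {c} e = ≈-by e (l x y c)
        where l : ∀ x y c → (x - c) - (y - c) ≡ x - y
              l = solve-∀
      l : ∀ h u → centre h u ≡ (h + (if u then 1ℤ else 0ℤ)) + (h + (if u then 1ℤ else 0ℤ)) - centre 0ℤ u
      l h true  = l′ h
        where l′ : ∀ h → h + h + 1ℤ ≡ (h + 1ℤ) + (h + 1ℤ) - (0ℤ + 0ℤ + 1ℤ)
              l′ = solve-∀
      l h false = l′ h
        where l′ : ∀ h → h + h + 0ℤ ≡ (h + 0ℤ) + (h + 0ℤ) - (0ℤ + 0ℤ + 0ℤ)
              l′ = solve-∀

    module _ (u : Bool) (x : Fin N) (j : Label) where
      open Strand (ρ u j)

      reach : ∀ o {y p} → + toℕ x + zigzag (position u o) ≈ y [ N ] →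
        ∃ λ c → ∃ λ s → point (level (x , j) (u , c) s o) ≡ point (y , p)
      reach o {y} {p} e =
        let c , s , g = block-onto {T} 0ℤ u (source o p)
        in c , s , point-cong e (from-source o g)

      joined-along : ∀ o {y p y′ p′} → o < f → + toℕ x + zigzag (position u o) ≈ y [ N ] →
        + toℕ x + zigzag (position u (suc o)) ≈ y′ [ N ] →
                     p + p′ ≈ ρ u j o [ dbl T ] → Joined (y , p) (y′ , p′)
      joined-along o {y} {p} {y′} {p′} lt e e′ s =
        let c , b , g = block-onto {T} 0ℤ u (source o p)
            z = strand o (pair T 0ℤ u (toℕ c) b)
            z≈p : z ≈ p [ dbl T ]
            z≈p = from-source o g
            z′≈p′ : ρ u j o - z ≈ p′ [ dbl T ]
            z′≈p′ = ≈-reflect z≈p s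
        in (x , j) , (u , c) , Adjacent-resp (ApexWalk.along point f (apex (x , j) (u , c)) (level (x , j) (u , c)) b lt)
             (point-cong e z≈p) (point-cong e′ z′≈p′)

      joined-rim : ∀ {y p y′ p′} → + toℕ x + zigzag (position u f) ≈ y [ N ] → + toℕ x + zigzag (position u f) ≈ y′ [ N ] →
                   p + p′ ≈ turn u j + turn u j - centre 0ℤ u [ dbl T ] → ¬ p ≈ p′ [ dbl T ] → Joined (y , p) (y′ , p′)
      joined-rim {y} {p} {y′} {p′} e₀ e′ s p≉p′ =
        let c , b , g , g′ = block-meet {T} 0ℤ u (source f p) (source f p′)
                               (source-sum (centre 0ℤ u) f (≈-trans s (≈-reflexive (sym (blockSum-const u j e)))))
                                 (λ q → p≉p′ (source-injective f q))
        in (x , j) , (u , c) , Adjacent-resp (ApexWalk.rim point f (apex (x , j) (u , c)) (level (x , j) (u , c)) b)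
             (point-cong e₀ (from-source f g)) (point-cong e′ (from-source f g′))

    tip-up : ∀ a l (c c′ : Fin T) → + toℕ l ≈ + toℕ c + + toℕ c′ [ T ] → tip true (a , l) c ≡ pair T 0ℤ false (toℕ c′) a
    tip-up a l c c′ e = cong (λ c → pair T 0ℤ false (toℕ c) a) (trans (residue-cong remainder) (residue-toℕ c′))
      where
      i : ∀ l c c′ → (l - c) - c′ ≡ l - (c + c′)
      i = solve-∀
      remainder : + toℕ l - + toℕ c ≈ + toℕ c′ [ T ]
      remainder = ≈-by e (i (+ toℕ l) (+ toℕ c) (+ toℕ c′))

    tip-down : ∀ a l (c c′ : Fin T) → + toℕ l + + L ≈ + toℕ c + + toℕ c′ [ T ] →
      tip false (a , l) c ≡ pair T 0ℤ true (toℕ c′) (not a)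
    tip-down a l c c′ e = cong (λ c → pair T 0ℤ true (toℕ c) (not a)) (trans (residue-cong remainder) (residue-toℕ c′))
      where
      i : ∀ l c c′ → (l - c) - c′ ≡ l - (c + c′)
      i = solve-∀
      remainder : + toℕ l + + L - + toℕ c ≈ + toℕ c′ [ T ]
      remainder = ≈-by e (i (+ toℕ l + + L) (+ toℕ c) (+ toℕ c′))

    -- The blocks of sum 0 and those of sum 1 have the same transversals {-c} and {c + 1}.
    transversal : ∀ b (c′ : Fin T) → ∃ λ (c : Fin T) → pair T 0ℤ true (toℕ c) b ≡ pair T 0ℤ false (toℕ c′) b
    transversal false c′            = c′ , refl
    transversal true  Fin.zero      = fromℕ _ , cong (λ n → 0ℤ + (1ℤ + + n)) (toℕ-fromℕ _)
    transversal true  (Fin.suc c′)  = inject₁ c′ , cong (λ n → 0ℤ + (1ℤ + + n)) (toℕ-inject₁ c′)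

    on-apex : ∀ (x : Fin N) j {y} p → + toℕ x + zigzag (suc f) ≈ y [ N ] →
      ∃ λ c → ∃ λ k → k < m × point (path (x , j) c k) ≡ point (y , p)
    on-apex x (a , l) {y} p e = go (block-onto {T} 0ℤ false p)
      where
      F = x , a , l
      at : ∀ c → tip (proj₁ c) (a , l) (proj₂ c) ≈ p [ dbl T ] → ∃ λ c → ∃ λ k → k < m × point (path F c k) ≡ point (y , p)
      at c g = let k , k<m , eq = ApexWalk.on-apex point f (apex F c) (level F c) in c , k , k<m , trans eq (point-cong e g)
      cancel : ∀ q (c : Fin T) → q ≈ + toℕ (residue T (q - + toℕ c)) + + toℕ c [ T ]
      cancel q c = ≈-by⁻ (residue-≈ T (q - + toℕ c)) (i q (+ toℕ c) _)
        where i : ∀ q c r → q - (r + c) ≡ (q - c) - r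
              i = solve-∀
      go : ∃ (λ (c : Fin T) → ∃ λ b → pair T 0ℤ false (toℕ c) b ≈ p [ dbl T ]) →
        ∃ λ c → ∃ λ k → k < m × point (path F c k) ≡ point (y , p)
      go (c′ , b , g) with a Bool.≟ b
      ... | yes refl = at (true , residue T (+ toℕ l - + toℕ c′))
        (≈-trans (≈-reflexive (tip-up a l (residue T (+ toℕ l - + toℕ c′)) c′ (cancel (+ toℕ l) c′))) g)
      ... | no  a≢b  =
        let c , eq = transversal b c′
        in at (false , residue T (+ toℕ l + + L - + toℕ c)) (≈-trans (≈-reflexive (trans
             (tip-down a l (residue T (+ toℕ l + + L - + toℕ c)) c (cancel (+ toℕ l + + L) c))
             (trans (cong (pair T 0ℤ true (toℕ c)) (sym (¬-not (a≢b ∘ sym)))) eq))) g)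

    joined-middle : ∀ {y p y′ p′} → RiseAt N y y′ f → RiseAt N y y′ (suc f) → Joined (y , p) (y′ , p′)
    joined-middle {y} {p} {y′} {p′} r r′ = go (block-onto {T} 0ℤ true p) (block-onto {T} 0ℤ false p′)
      where
      go : ∃ (λ (c : Fin T) → ∃ λ b → pair T 0ℤ true (toℕ c) b ≈ p [ dbl T ]) →
        ∃ (λ (c : Fin T) → ∃ λ b → pair T 0ℤ false (toℕ c) b ≈ p′ [ dbl T ]) → Joined (y , p) (y′ , p′)
      go (c , b , g) (c′ , b′ , g′) = split (toℕ (residue T (+ toℕ c + + toℕ c′))) (toℕ<n (residue T (+ toℕ c + + toℕ c′)))
        (residue-≈ T (+ toℕ c + + toℕ c′))
        where
        split : ∀ n → n < T → + n ≈ + toℕ c + + toℕ c′ [ T ] → Joined (y , p) (y′ , p′)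
        split n n<T s with n <? L
        ... | yes n<L =
          let x , e , e′ = place r
              l = fromℕ< n<L
              F = x , b′ , l
              h : tip true (b′ , l) c ≈ p′ [ dbl T ]
              h = ≈-trans (≈-reflexive (tip-up b′ l c c′ (≈-trans (≈-reflexive (cong +_ (toℕ-fromℕ< n<L))) s))) g′
          in F , (true , c) , Adjacent-resp (swap (ApexWalk.spoke point f (apex F (true , c)) (level F (true , c)) b))
            (point-cong e g) (point-cong e′ h)
        ... | no  n≮L =
          let x , e , e′ = place r′
              l = fromℕ< lt
              F = x , not b , l
              h : tip false (not b , l) c′ ≈ p [ dbl T ]
              h = ≈-trans (≈-reflexive (trans (tip-down (not b) l c′ c
                (≈-trans (≈-reflexive (trans (cong (λ n → + n + + L) (toℕ-fromℕ< lt))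
                (trans (sym (pos-+ (n ∸ L) L)) (cong +_ (m∸n+n≡m (≮⇒≥ n≮L))))))
                    (≈-trans s (≈-reflexive (i (+ toℕ c) (+ toℕ c′))))))
                      (cong (pair T 0ℤ true (toℕ c)) (not-involutive b)))) g
              e₀ = ≈-trans (≈-reflexive (cong (λ i → + toℕ x + zigzag (suc (suc i))) (+-identityʳ f))) e′
          in F , (false , c′) , Adjacent-resp (ApexWalk.spoke point f (apex F (false , c′)) (level F (false , c′)) b′)
            (point-cong e h) (point-cong e₀ g′)
          where
          i : ∀ c c′ → c + c′ ≡ c′ + c
          i = solve-∀
          lt : n ∸ L < L
          lt = +-cancelʳ-< L (n ∸ L) L (≤-<-trans (≤-reflexive (m∸n+n≡m (≮⇒≥ n≮L))) (<-≤-trans n<T (≤-reflexive (dbl≡+ L))))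

    outer-sum : ∀ o q → ∃ λ u → ∃ λ j → q ≈ ρ u j o [ dbl T ]
    outer-sum zero    q = turn-onto q
    outer-sum (suc o) q = rim-sum q

    joined-outer : ∀ {y p y′ p′} o → o < f → RiseAt N y y′ (f ∸ suc o) → RiseAt N y y′ (suc (suc f) ℕ.+ o) →
      Joined (y , p) (y′ , p′)
    joined-outer {y} {p} {y′} {p′} o lt r r′ = go (outer-sum o (p + p′))
      where
      go : ∃ (λ u → ∃ λ j → p + p′ ≈ ρ u j o [ dbl T ]) → Joined (y , p) (y′ , p′)
      go (false , j , s) = let x , e , e′ = place r′ in
        joined-along false x j o lt e (≈-trans (≈-reflexive (cong (λ i → + toℕ x + zigzag i) (+-suc (suc (suc f)) o))) e′) s
      go (true , j , s) = let x , e , e′ = place r in Joined-sym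
        (joined-along true x j o lt (≈-trans (≈-reflexive (cong (λ i → + toℕ x + zigzag i) (+-∸-assoc 1 lt))) e′) e
          (≈-trans (≈-reflexive (i p p′)) s))
        where i : ∀ p q → q + p ≡ p + q
              i = solve-∀

    within : ∀ y p y′ p′ → y ≈ y′ [ N ] → ¬ p ≈ p′ [ dbl T ] → Joined (y , p) (y′ , p′)
    within y p y′ p′ y≈y′ p≉p′ =
      let u , j , s = rim-sum (p + p′)
          x , e₀ = represent-at {N} (zigzag (position u f)) y
      in joined-rim u x j e₀ (≈-trans e₀ y≈y′) s p≉p′

    spans : ∀ F y p → ∃ λ c → ∃ λ k → k < m × point (path F c k) ≡ point (y , p)
    spans (x , j) y p = go (zigzag-onto N (y - + toℕ x))
      where
      via : ∀ u o → o < suc f → + toℕ x + zigzag (position u o) ≈ y [ N ] →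
        ∃ λ c → ∃ λ k → k < m × point (path (x , j) c k) ≡ point (y , p)
      via u o lt e =
        let c , s , eq = reach u x j o {y} {p} e
            k , k<m , eq′ = ApexWalk.on point f (apex (x , j) (u , c)) (level (x , j) (u , c)) s lt
        in (u , c) , k , k<m , trans eq′ eq
      go : ∃ (λ i → i < N × zigzag i ≈ y - + toℕ x [ N ]) → ∃ λ c → ∃ λ k → k < m × point (path (x , j) c k) ≡ point (y , p)
      go (i , i<N , e) = at (≈-rebase {x = + toℕ x} {y = y} {i = i} e) (<-cmp i (suc f))
        where
        at : + toℕ x + zigzag i ≈ y [ N ] → Tri (i < suc f) (i ≡ suc f) (suc f < i) →
          ∃ λ c → ∃ λ k → k < m × point (path (x , j) c k) ≡ point (y , p)
        at e (tri< lt _ _) = via true (f ∸ i) (s≤s (m∸n≤m f i))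
          (≈-trans (≈-reflexive (cong (λ i → + toℕ x + zigzag i) (m∸[m∸n]≡n (≤-pred lt)))) e)
        at e (tri≈ _ eq _) = on-apex x j p (≈-trans (≈-reflexive (cong (λ i → + toℕ x + zigzag i) (sym eq))) e)
        at e (tri> _ _ gt) = via false (i ∸ suc (suc f))
          (+-cancelˡ-< (suc (suc f)) _ _ (≤-<-trans (≤-reflexive (m+[n∸m]≡n gt))
            (<-≤-trans i<N (≤-reflexive (cong suc (dbl≡+ (suc f)))))))
            (≈-trans (≈-reflexive (cong (λ i → + toℕ x + zigzag i) (m+[n∸m]≡n gt))) e)

    cover : Cover (N ℕ.* dbl T) m (2 ℕ.* T) (N ℕ.* (2 ℕ.* L))
    cover = record
      { Vertex = ℤ × ℤ ; Factor = Factor ; Part = Part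
      ; enc = point ; enc-onto = point-onto
      ; factors = enum-× enum-Fin (enum-× enum-Bool enum-Fin) ; parts = enum-× enum-Bool enum-Fin
      ; path = path
      ; spans = λ { F (y , p) → spans F y p }
      ; covers = λ { (y , p) (y′ , p′) u≢v → covers y p y′ p′ u≢v (y ≈? y′) }
      }
      where
      rising : ∀ {y p y′ p′} → Twin f N y y′ → Joined (y , p) (y′ , p′)
      rising {y} {p} {y′} {p′} (middle r r′) = joined-middle {y} {p} {y′} {p′} r r′
      rising {y} {p} {y′} {p′} (outer o lt r r′) = joined-outer {y} {p} {y′} {p′} o lt r r′
      covers : ∀ y p y′ p′ → point (y , p) ≢ point (y′ , p′) → Dec (y ≈ y′ [ N ]) → Joined (y , p) (y′ , p′)
      covers y p y′ p′ u≢v (yes e) = within y p y′ p′ e λ g → u≢v (point-cong e g)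
      covers y p y′ p′ u≢v (no ¬e) with rises (suc f) y y′ ¬e
      ... | inj₁ r = rising (twin r)
      ... | inj₂ r = Joined-sym (rising (twin r))

  -- Removing the special elements breaks every cycle z, z + 2d, z + 4d, ... of the residues modulo s
  -- into paths, on which κ alternates.
  record Colouring (s : ℕ) (d : ℤ) : Set where
    field
      special κ    : ℤ → Bool
      special-cong : ∀ {z w} → z ≈ w [ s ] → special z ≡ special w
      κ-cong       : ∀ {z w} → z ≈ w [ s ] → κ z ≡ κ w
      special-d    : ∀ z → special z ≡ true → special (z + d) ≡ false
      special-2d   : ∀ z → special z ≡ true → special (z + d + d) ≡ false
      κ-2d         : ∀ z → special z ≡ false → special (z + d + d) ≡ false → κ (z + d + d) ≡ not (κ z)

  dbl-odd : ∀ a b → dbl a ≢ suc (dbl b)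
  dbl-odd (suc a) (suc b) eq = dbl-odd a b (suc-injective (suc-injective eq))

  -- P z is the position of z on its cycle under z ↦ z + d; the length 2ℓ + 3 of the cycles is odd.
  module FromPosition (s ℓ : ℕ) (d : ℤ) (P : ℤ → ℕ) (P-cong : ∀ {z w} → z ≈ w [ s ] → P z ≡ P w)
    (P-step : ∀ z → P (z + d) ≡ suc (P z) × suc (P z) < suc (dbl (suc ℓ)) ⊎ P (z + d) ≡ 0 × suc (P z) ≡ suc
      (dbl (suc ℓ))) where

    -- In steps of two, the positions other than 0 form the single path 2, 4, ..., 2ℓ + 2, 1, 3,
    -- ..., 2ℓ + 1. The value `par ℓ` at position 1 continues the alternation past 2ℓ + 2.
    hue : ℕ → Bool
    hue zero          = false
    hue (suc zero)    = par ℓ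
    hue (suc (suc p)) = not (hue p)

    hue-dbl : ∀ a → hue (dbl a) ≡ par a
    hue-dbl zero    = refl
    hue-dbl (suc a) = cong not (hue-dbl a)

    is-zero : ℕ → Bool
    is-zero zero    = true
    is-zero (suc _) = false

    is-zero-suc : ∀ {p q} → p ≡ suc q → is-zero p ≡ false
    is-zero-suc refl = refl

    after-zero : ∀ z → P z ≡ 0 → P (z + d) ≡ 1
    after-zero z eq with P-step z
    ... | inj₁ (e , _) = trans e (cong suc eq)
    ... | inj₂ (_ , e) = contradiction (trans (cong suc (sym eq)) e) λ ()

    is-zero⇒≡ : ∀ p → is-zero p ≡ true → p ≡ 0
    is-zero⇒≡ zero _ = refl

    colouring : Colouring s d
    colouring = record
      { special = λ z → is-zero (P z) ; κ = λ z → hue (P z)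
      ; special-cong = λ e → cong is-zero (P-cong e) ; κ-cong = λ e → cong hue (P-cong e)
      ; special-d = λ z e → is-zero-suc (after-zero z (is-zero⇒≡ (P z) e))
      ; special-2d = λ z e → two z (after-zero z (is-zero⇒≡ (P z) e))
      ; κ-2d = alternate
      }
      where
      two : ∀ z → P (z + d) ≡ 1 → is-zero (P (z + d + d)) ≡ false
      two z eq with P-step (z + d)
      ... | inj₁ (e , _) = is-zero-suc e
      ... | inj₂ (_ , e) = contradiction (trans (cong suc (sym eq)) e) λ ()
      alternate : ∀ z → is-zero (P z) ≡ false → is-zero (P (z + d + d)) ≡ false → hue (P (z + d + d)) ≡ not (hue (P z))
      alternate z nz nz″ with P-step z | P-step (z + d)
      ... | _             | inj₂ (e , _)  = contradiction (trans (sym nz″) (cong is-zero e)) λ ()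
      ... | inj₁ (e , _)  | inj₁ (e′ , _) = cong hue (trans e′ (cong suc e))
      ... | inj₂ (e , e″) | inj₁ (e′ , _) = trans (cong hue (trans e′ (cong suc e))) (trans (sym (not-involutive (par ℓ)))
        (cong not (trans (sym (hue-dbl (suc ℓ))) (cong hue (sym (suc-injective e″))))))

  -- If c = gcd d s and x d ≡ c, then the position of z is the quotient of x z mod s by c.
  colour : ∀ g d → 1 ≤ d → d ≤ g → Colouring (suc (dbl g)) (+ d)
  colour g d 1≤d d≤g with Bézout.lemma d (suc (dbl g))
  ... | Bézout.result c isGCD identity = go (GCD.gcd∣m isGCD) (GCD.gcd∣n isGCD)
    where
    s = suc (dbl g)
    inverse : Bézout.Identity c d s → ∃ λ x → + d * x ≈ + c [ s ]
    inverse (Bézout.+- x y eq) = + x , ≈-shift (+ y)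
      (trans (cong (λ z → z - + c) (trans (l (+ d) (+ x))
      (trans (sym (pos-* x d)) (trans (cong +_ (sym eq)) (trans (pos-+ c (y ℕ.* s)) (cong (λ z → + c + z) (pos-* y s)))))))
      (l′ (+ c) (+ y * + s)))
      where l : ∀ d x → d * x ≡ x * d
            l = solve-∀
            l′ : ∀ c y → c + y - c ≡ y
            l′ = solve-∀
    inverse (Bézout.-+ x y eq) = - + x , ≈-shift (- + y)
      (trans (l (+ d) (+ x) (+ c)) (trans (cong -_
      (trans (cong (λ z → + c + z) (sym (pos-* x d))) (trans (sym (pos-+ c (x ℕ.* d))) (trans (cong +_ eq) (pos-* y s)))))
      (l′ (+ y) (+ s))))
      where l : ∀ d x c → d * - x - c ≡ - (c + x * d)
            l = solve-∀
            l′ : ∀ y s → - (y * s) ≡ - y * s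
            l′ = solve-∀
    go : c ℕ.∣ d → c ℕ.∣ s → Colouring s (+ d)
    go c∣d (ℕ.divides L s≡Lc) = odd-length (halve L) s≡Lc (inverse identity)
      where
      c≤d : c ≤ d
      c≤d = ℕ.∣⇒≤ {{>-nonZero 1≤d}} c∣d
      odd-length : ∀ {L} → Halved L → s ≡ L ℕ.* c → (∃ λ x → + d * x ≈ + c [ s ]) → Colouring s (+ d)
      odd-length (even a) eq _ = contradiction (trans
        (sym (trans (cong (ℕ._* c) (dbl≡+ a)) (trans (*-distribʳ-+ c a a) (sym (dbl≡+ (a ℕ.* c)))))) (sym eq))
        (dbl-odd (a ℕ.* c) g)
      -- Length one would mean c = s, against c ≤ d ≤ g.
      odd-length (odd zero) eq _ = contradiction (≤-trans (≤-reflexive (trans eq (+-identityʳ c)))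
        (≤-trans c≤d (≤-trans d≤g (≤-trans (m≤m+n g g) (≤-reflexive (sym (dbl≡+ g))))))) (<-irrefl refl)
      odd-length (odd (suc ℓ)) eq (x , xd) = FromPosition.colouring s ℓ (+ d) P
        (λ e → cong (λ i → toℕ i / c) (residue-cong (scale e))) step
        where
        instance
          c≢0 : NonZero c
          c≢0 = ≢-nonZero λ c≡0 → contradiction (trans eq
            (trans (cong (suc (dbl (suc ℓ)) ℕ.*_) c≡0) (*-zeroʳ (dbl (suc ℓ))))) λ ()
        len = suc (dbl (suc ℓ))
        r : ℤ → ℕ
        r z = toℕ (residue s (z * x))
        P : ℤ → ℕ
        P z = r z / c
        scale : ∀ {z w} → z ≈ w [ s ] → z * x ≈ w * x [ s ]
        scale {z} {w} (q , e) = q * x , trans (l z w x) (trans (cong (_* x) e) (l′ q (+ s) x))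
          where l : ∀ z w x → z * x - w * x ≡ (z - w) * x
                l = solve-∀
                l′ : ∀ q s x → q * s * x ≡ q * x * s
                l′ = solve-∀
        advance : ∀ z → + r (z + + d) ≈ + (c ℕ.+ r z) [ s ]
        advance z = ≈-trans (residue-≈ s ((z + + d) * x))
          (≈-trans (≈-by₂ xd (≈-sym (residue-≈ s (z * x))) (l z (+ d) x (+ c) (+ r z))) (≈-reflexive (sym (pos-+ c (r z)))))
          where l : ∀ z d x c r → (z + d) * x - (c + r) ≡ (d * x - c) + (z * x - r)
                l = solve-∀
        suc-P : ∀ z → (c ℕ.+ r z) / c ≡ suc (P z)
        suc-P z = trans (+-distrib-/-∣ˡ {c} (r z) {c} ℕ.∣-refl) (cong (ℕ._+ P z) (n/n≡1 c))
        step : ∀ z → P (z + + d) ≡ suc (P z) × suc (P z) < len ⊎ P (z + + d) ≡ 0 × suc (P z) ≡ len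
        step z with c ℕ.+ r z <? s
        ... | yes lt = inj₁ (trans (cong (_/ c) (small≈′ (toℕ<n (residue s ((z + + d) * x))) lt (advance z))) (suc-P z) ,
                             ≤-<-trans (≤-reflexive (sym (suc-P z))) (m<n*o⇒m/o<n {o = c} (<-≤-trans lt (≤-reflexive eq))))
        -- After the wrap the remainder is below c, so the position restarts at 0, and the position
        -- before was the last one.
        ... | no ¬lt = inj₂ (trans (cong (_/ c) (small≈′ (toℕ<n (residue s ((z + + d) * x)))
          (<-≤-trans rest<c (≤-trans c≤d (≤-trans d≤g
          (≤-trans (m≤m+n g g) (≤-trans (≤-reflexive (sym (dbl≡+ g))) (n≤1+n _)))))) (≈-trans (advance z) wrapped)))
          (m<n⇒m/n≡0 rest<c) ,
                             ≤-antisym (m<n*o⇒m/o<n {o = c} (<-≤-trans (toℕ<n (residue s (z * x))) (≤-reflexive eq)))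
                               (≤-trans (≤-reflexive (trans (sym (m*n/n≡m len c)) (cong (_/ c) (sym eq))))
                                 (≤-trans (/-monoˡ-≤ c (≮⇒≥ ¬lt)) (≤-reflexive (suc-P z)))))
          where
          rest = c ℕ.+ r z ∸ s
          rest<c : rest < c
          rest<c = +-cancelʳ-< s rest c (≤-<-trans (≤-reflexive (m∸n+n≡m (≮⇒≥ ¬lt)))
            (+-monoʳ-< c (toℕ<n (residue s (z * x)))))
          wrapped : + (c ℕ.+ r z) ≈ + rest [ s ]
          wrapped = ≈-shift 1ℤ (trans (cong (λ z′ → + (c ℕ.+ r z) - z′) (pos-∸ (≮⇒≥ ¬lt))) (l (+ (c ℕ.+ r z)) (+ s)))
            where l : ∀ a s → a - (a - s) ≡ 1ℤ * s
                  l = solve-∀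

  -- It is used with m = N: the translates of two cycles on Z_N × Z_2, which is the case of two
  -- cycles per factor.
  record Starter (N m : ℕ) .{{_ : NonZero N}} : Set where
    open Ladder N
    field
      cycle  : ℤ → Bool → ℕ → ℤ × Bool
      spans  : ∀ x y b → ∃ λ s → ∃ λ i → i < m × point (cycle x s i) ≡ point (y , b)
      covers : ∀ y b y′ b′ → point (y , b) ≢ point (y′ , b′) → ∃ λ (x : Fin N) →
        ∃ λ s → Adjacent point m (cycle (+ toℕ x) s) (y , b) (y′ , b′)

  -- The first cycle follows the zigzag, passing the middle level suc f twice and omitting the last level; the
  -- second one omits the middle level and passes the last level twice.
  module LongStarter (e : ℕ) where

    f N m : ℕ
    f = suc (suc e)
    N = suc (dbl (suc f))
    m = suc (suc f) ℕ.+ suc f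

    open Ladder N

    χ : Bool
    χ = par (suc f)

    -- Twin edges must be complementary, one keeping the bit and one changing it. `β₁` keeps it only
    -- from level 1 to level 2, `β₂` changes it only in its last step, and these two steps are
    -- twins. The constant `χ` is the bit which `β₁` has at level f, just before the middle.
    β₁ β₂ : ℕ → Bool
    β₁ zero          = false
    β₁ (suc zero)    = true
    β₁ (suc (suc i)) = not (par i)
    β₂ r = if does (r ℕ.≟ suc e) then not χ else χ

    β₁-f : β₁ f ≡ χ
    β₁-f = sym (not-involutive (not (par e)))

    β₂-last : β₂ (suc e) ≡ not χ
    β₂-last = cong (λ c → if c then not χ else χ) (dec-true (suc e ℕ.≟ suc e) refl)

    β₂-early : ∀ {r} → r ≢ suc e → β₂ r ≡ χ
    β₂-early {r} ne = cong (λ c → if c then not χ else χ) (dec-false (r ℕ.≟ suc e) ne)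

    bitA : ℕ → Bool
    bitA i = if does (i ℕ.≟ suc f) then not χ else β₁ i

    bitA-early : ∀ {i} → i ≤ f → bitA i ≡ β₁ i
    bitA-early {i} le = cong (λ c → if c then not χ else β₁ i) (dec-false (i ℕ.≟ suc f) λ { refl → <-irrefl refl le })

    bitA-middle : bitA (suc f) ≡ not χ
    bitA-middle = cong (λ c → if c then not χ else β₁ (suc f)) (dec-true (suc f ℕ.≟ suc f) refl)

    module _ (x : ℤ) where
      a₁ b₁ a₂ b₂ : ℕ → ℤ × Bool
      a₁ i       = x + zigzag i , bitA i
      b₁ zero    = x + zigzag (suc f) , χ
      b₁ (suc r) = x + zigzag (suc (suc f) ℕ.+ r) , β₂ r
      a₂ i       = x + zigzag i , not (β₁ i)
      b₂ r with <-cmp r f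
      ... | tri< _ _ _ = x + zigzag (suc (suc f) ℕ.+ r) , not (β₂ r)
      ... | tri≈ _ _ _ = x + zigzag (suc (suc f) ℕ.+ f) , χ
      ... | tri> _ _ _ = x + zigzag (suc (suc f) ℕ.+ f) , not χ

      b₂-early : ∀ {r} → r < f → b₂ r ≡ (x + zigzag (suc (suc f) ℕ.+ r) , not (β₂ r))
      b₂-early {r} lt with <-cmp r f
      ... | tri< _ _ _ = refl
      ... | tri≈ ¬a _ _ = contradiction lt ¬a
      ... | tri> ¬a _ _ = contradiction lt ¬a

      b₂-f : b₂ f ≡ (x + zigzag (suc (suc f) ℕ.+ f) , χ)
      b₂-f with <-cmp f f
      ... | tri< _ ¬b _ = contradiction refl ¬b
      ... | tri≈ _ _ _ = refl
      ... | tri> _ ¬b _ = contradiction refl ¬b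

      b₂-end : b₂ (suc f) ≡ (x + zigzag (suc (suc f) ℕ.+ f) , not χ)
      b₂-end with <-cmp (suc f) f
      ... | tri< _ _ ¬c = contradiction (n<1+n f) ¬c
      ... | tri≈ _ _ ¬c = contradiction (n<1+n f) ¬c
      ... | tri> _ _ _ = refl

      module First  = Concatenated point (suc (suc f)) (suc f) m refl a₁ b₁
      module Second = Concatenated point (suc f) (suc (suc f)) m (+-comm (suc f) (suc (suc f))) a₂ b₂

    cycle : ℤ → Bool → ℕ → ℤ × Bool
    cycle x true  = First.walk x
    cycle x false = Second.walk x

    Joined : ℤ × Bool → ℤ × Bool → Set
    Joined u v = ∃ λ (x : Fin N) → ∃ λ s → Adjacent point m (cycle (+ toℕ x) s) u v

    Joined-sym : ∀ {u v} → Joined u v → Joined v u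
    Joined-sym (x , s , a) = x , s , swap a

    to : ∀ x {i j} → i ≡ j → ∀ {y b b′} → x + zigzag i ≈ y [ N ] → b ≡ b′ → point (x + zigzag j , b) ≡ point (y , b′)
    to x refl = point-cong

    spans : ∀ x y b → ∃ λ s → ∃ λ i → i < m × point (cycle x s i) ≡ point (y , b)
    spans x y b = go (zigzag-onto N (y - x))
      where
      Goal = ∃ λ s → ∃ λ i → i < m × point (cycle x s i) ≡ point (y , b)
      first : ∀ {v} → (∃ λ k → k < m × point (First.walk x k) ≡ point v) → point v ≡ point (y , b) → Goal
      first (k , k<m , eq) eq′ = true , k , k<m , trans eq eq′
      second : ∀ {v} → (∃ λ k → k < m × point (Second.walk x k) ≡ point v) → point v ≡ point (y , b) → Goal
      second (k , k<m , eq) eq′ = false , k , k<m , trans eq eq′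
      go : ∃ (λ i → i < N × zigzag i ≈ y - x [ N ]) → Goal
      go (i , i<N , e₀) = at (≈-rebase {x = x} {y = y} {i = i} e₀) (<-cmp i (suc f))
        where
        at : x + zigzag i ≈ y [ N ] → Tri (i < suc f) (i ≡ suc f) (suc f < i) → Goal
        at e′ (tri< lt _ _) with β₁ i Bool.≟ b
        ... | yes eq = first {a₁ x i} (First.on-a x (m<n⇒m<1+n lt)) (point-cong e′ (trans (bitA-early (≤-pred lt)) eq))
        ... | no  ne = second {a₂ x i} (Second.on-a x lt) (point-cong e′ (sym (¬-not (ne ∘ sym))))
        at e′ (tri≈ _ refl _) with χ Bool.≟ b
        ... | yes eq = first {b₁ x 0} (First.on-b x (s≤s z≤n)) (point-cong e′ eq)
        ... | no  ne = first {a₁ x (suc f)} (First.on-a x (n<1+n _))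
          (point-cong e′ (trans bitA-middle (sym (¬-not (ne ∘ sym)))))
        at e′ (tri> _ _ gt) = beyond (i ∸ suc (suc f)) (m+[n∸m]≡n gt)
          where
          beyond : ∀ r → suc (suc f) ℕ.+ r ≡ i → Goal
          beyond r eq = last (m≤n⇒m<n∨m≡n (≤-pred (+-cancelˡ-< (suc (suc f)) r (suc f)
            (≤-<-trans (≤-reflexive eq) (<-≤-trans i<N (≤-reflexive (cong suc (dbl≡+ (suc f)))))))))
            where
            last : r < f ⊎ r ≡ f → Goal
            last (inj₁ lt) with β₂ r Bool.≟ b
            ... | yes β≡ = first {b₁ x (suc r)} (First.on-b x (s≤s lt)) (to x (sym eq) e′ β≡)
            ... | no  ne = second {b₂ x r} (Second.on-b x (m<n⇒m<1+n (m<n⇒m<1+n lt)))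
              (trans (cong point (b₂-early x lt)) (to x (sym eq) e′ (sym (¬-not (ne ∘ sym)))))
            last (inj₂ refl) with χ Bool.≟ b
            ... | yes χ≡ = second {b₂ x f} (Second.on-b x (m<n⇒m<1+n (n<1+n f)))
              (trans (cong point (b₂-f x)) (to x (sym eq) e′ χ≡))
            ... | no  ne = second {b₂ x (suc f)} (Second.on-b x (n<1+n (suc f)))
              (trans (cong point (b₂-end x)) (to x (sym eq) e′ (sym (¬-not (ne ∘ sym)))))

    within : ∀ y b y′ b′ → y ≈ y′ [ N ] → b ≢ b′ → Joined (y , b) (y′ , b′)
    within y b y′ b′ y≈y′ b≢b′ = go (represent-at (zigzag (suc f)) y) (b Bool.≟ χ)
      where
      go : ∃ (λ (x : Fin N) → + toℕ x + zigzag (suc f) ≈ y [ N ]) → Dec (b ≡ χ) → Joined (y , b) (y′ , b′)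
      go (x , e₀) eq = x , true , side eq
        where
        side : Dec (b ≡ χ) → Adjacent point m (First.walk (+ toℕ x)) (y , b) (y′ , b′)
        side (yes b≡χ) = swap (Adjacent-resp (First.joint (+ toℕ x) refl (s≤s z≤n))
          (point-cong (≈-trans e₀ y≈y′) (trans bitA-middle (trans (cong not (sym b≡χ)) (sym (¬-not (b≢b′ ∘ sym))))))
            (point-cong e₀ (sym b≡χ)))
        side (no b≢χ) = Adjacent-resp (First.joint (+ toℕ x) refl (s≤s z≤n))
          (point-cong e₀ (trans bitA-middle (sym (¬-not b≢χ))))
          (point-cong (≈-trans e₀ y≈y′) (trans (sym (not-involutive χ))
            (trans (cong not (sym (¬-not b≢χ))) (sym (¬-not (b≢b′ ∘ sym))))))

    bit-step : ∀ b b′ c c′ → b xor b′ ≡ c xor c′ → (b ≡ c → b′ ≡ c′) × (b ≡ not c → b′ ≡ not c′)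
    bit-step b b′ c c′ eq = (λ { refl → cancel b b′ c′ eq }) , λ { refl → negate c b′ c′ eq }
      where
      cancel : ∀ b x y → b xor x ≡ b xor y → x ≡ y
      cancel false x y eq = eq
      cancel true  x y eq = trans (sym (not-involutive x)) (trans (cong not eq) (not-involutive y))
      negate : ∀ c x y → not c xor x ≡ c xor y → x ≡ not y
      negate false x y eq = trans (sym (not-involutive x)) (cong not eq)
      negate true  x y eq = eq

    -- Of the twin edges one keeps and one changes the bit, and on each of them the two cycles carry
    -- opposite bits; this gives all four pairs of bits.
    ordinary : ∀ y b y′ b′ o → suc o < f → RiseAt N y y′ (f ∸ suc o) → RiseAt N y y′ (suc (suc f) ℕ.+ o) →
      Joined (y , b) (y′ , b′)
    ordinary y b y′ b′ o lt r r′ = choose (b xor b′ Bool.≟ β₁ i xor β₁ (suc i))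
      where
      i = f ∸ suc o
      1+i≤f : suc i ≤ f
      1+i≤f = ≤-trans (≤-reflexive (sym (+-∸-assoc 1 (<⇒≤ lt)))) (m∸n≤m f o)
      types : β₁ i xor β₁ (suc i) ≡ not (β₂ o xor β₂ (suc o))
      types = go i refl (o ℕ.≟ e)
        where
        flat : ∀ b → b xor b ≡ false
        flat false = refl
        flat true  = refl
        step : ∀ b → b xor not b ≡ true
        step false = refl
        step true  = refl
        β₂-o : β₂ o ≡ χ
        β₂-o = β₂-early {o} λ { refl → <-irrefl refl lt }
        i+o : ∀ i′ → f ∸ suc o ≡ i′ → i′ ℕ.+ o ≡ suc e
        i+o i′ eq = trans (cong (ℕ._+ o) (sym eq)) (m∸n+n≡m (≤-pred (<⇒≤ lt)))
        go : ∀ i′ → f ∸ suc o ≡ i′ → Dec (o ≡ e) → β₁ i′ xor β₁ (suc i′) ≡ not (β₂ o xor β₂ (suc o))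
        go zero eq _ = contradiction (≤-reflexive (sym (i+o 0 eq))) (<⇒≱ (≤-pred lt))
        go (suc zero) eq _ = sym (cong not (trans (cong₂ _xor_ β₂-o
          (trans (cong (β₂ ∘ suc) (suc-injective (i+o 1 eq))) β₂-last)) (step χ)))
        go (suc (suc i′)) eq _ = trans (step (not (par i′))) (sym (cong not (trans (cong₂ _xor_ β₂-o (β₂-early λ eq′ →
          <-irrefl (trans (suc-injective eq′) (sym (suc-injective (i+o (suc (suc i′)) eq)))) (s≤s (m≤n+m o i′))))
            (flat χ))))
      early : b xor b′ ≡ β₁ i xor β₁ (suc i) → Dec (b ≡ β₁ i) → Joined (y , b) (y′ , b′)
      early d (yes eq) = let x , p , p′ = place r in x , true , Adjacent-resp (First.along-a (+ toℕ x) (s≤s (m≤n⇒m≤1+n 1+i≤f)))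
        (point-cong p (trans (bitA-early (<⇒≤ 1+i≤f)) (sym eq)))
          (point-cong p′ (trans (bitA-early 1+i≤f) (sym (proj₁ (bit-step b b′ (β₁ i) (β₁ (suc i)) d) eq))))
      early d (no ne) = let x , p , p′ = place r in x , false , Adjacent-resp (Second.along-a (+ toℕ x) (s≤s 1+i≤f))
        (point-cong p (sym (¬-not ne))) (point-cong p′ (sym (proj₂ (bit-step b b′ (β₁ i) (β₁ (suc i)) d) (¬-not ne))))
      next≡ : suc (suc (suc f) ℕ.+ o) ≡ suc (suc f) ℕ.+ suc o
      next≡ = sym (+-suc (suc (suc f)) o)
      late : b xor b′ ≡ β₂ o xor β₂ (suc o) → Dec (b ≡ β₂ o) → Joined (y , b) (y′ , b′)
      late d (yes eq) = let x , p , p′ = place r′ in x , true , Adjacent-resp (First.along-b (+ toℕ x) (s≤s lt))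
        (point-cong p (sym eq)) (to (+ toℕ x) next≡ p′ (sym (proj₁ (bit-step b b′ (β₂ o) (β₂ (suc o)) d) eq)))
      late d (no ne) = let x , p , p′ = place r′ in x , false , Adjacent-resp (Second.along-b (+ toℕ x) (m<n⇒m<1+n (m<n⇒m<1+n lt)))
        (trans (cong point (b₂-early (+ toℕ x) (<-trans (n<1+n o) lt))) (point-cong p (sym (¬-not ne))))
        (trans (cong point (b₂-early (+ toℕ x) lt))
          (to (+ toℕ x) next≡ p′ (sym (proj₂ (bit-step b b′ (β₂ o) (β₂ (suc o)) d) (¬-not ne)))))
      choose : Dec (b xor b′ ≡ β₁ i xor β₁ (suc i)) → Joined (y , b) (y′ , b′)
      choose (yes d) = early d (b Bool.≟ β₁ i)
      choose (no ¬d) = late (trans (¬-not ¬d) (trans (cong not types) (not-involutive _))) (b Bool.≟ β₂ o)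

    f≡ : suc (suc f) ℕ.+ suc e ≡ suc (dbl f)
    f≡ = cong suc (trans (sym (+-suc f (suc e))) (sym (dbl≡+ f)))

    -- The edges of difference 1.
    shortest : ∀ y b y′ b′ → RiseAt N y y′ 0 → RiseAt N y y′ (suc (suc f) ℕ.+ suc e) → Joined (y , b) (y′ , b′)
    shortest y b y′ b′ r r′ = choose (b Bool.≟ b′) (b Bool.≟ χ)
      where
      0<f : 0 < f
      0<f = s≤s z≤n
      crossing : ∀ b b′ → b ≢ b′ → Joined (y , b) (y′ , b′)
      crossing false false ne = contradiction refl ne
      crossing true  true  ne = contradiction refl ne
      crossing false true  _  = let x , p , p′ = place r in x , true , Adjacent-resp (First.along-a (+ toℕ x) (s≤s (s≤s z≤n)))
        (point-cong p (bitA-early {0} z≤n)) (point-cong p′ (bitA-early {1} 0<f))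
      crossing true  false _  = let x , p , p′ = place r in x , false , Adjacent-resp (Second.along-a (+ toℕ x) (s≤s 0<f))
        (point-cong p refl) (point-cong p′ refl)
      χ≡ : not (β₂ (suc e)) ≡ χ
      χ≡ = trans (cong not β₂-last) (not-involutive χ)
      last : b ≡ χ → b ≡ b′ → Joined (y , b) (y′ , b′)
      last b≡χ b≡b′ = let x , p , p′ = place r′ in x , false , Adjacent-resp (Second.along-b (+ toℕ x) {suc e} (s≤s (n≤1+n f)))
        (trans (cong point (b₂-early (+ toℕ x) (n<1+n (suc e)))) (point-cong p (trans χ≡ (sym b≡χ))))
        (trans (cong point (b₂-f (+ toℕ x))) (to (+ toℕ x) (sym (+-suc (suc (suc f)) (suc e))) p′ (trans (sym b≡χ) b≡b′)))
      -- By omitting the middle level the second cycle jumps from level f to level f + 2, which is a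
      -- step by 1 or by -1 according to the parity of f.
      skip : ∀ {y y′} → zigzag (suc (suc f)) - zigzag f ≈ y′ - y [ N ] → ∀ {b b′} → b ≡ not χ → b′ ≡ not χ →
        Joined (y , b) (y′ , b′)
      skip {y} {y′} d eq eq′ = let x , p , p′ = place-levels f (suc (suc f)) y y′ d in x , false , Adjacent-resp (Second.joint (+ toℕ x) refl (s≤s z≤n))
          (point-cong p (trans (cong not β₁-f) (sym eq)))
          (trans (cong point (b₂-early (+ toℕ x) 0<f))
            (to (+ toℕ x) (sym (+-identityʳ (suc (suc f)))) p′ (trans (cong not (β₂-early {0} λ ())) (sym eq′))))
      two : ∀ z c d → (d - (c - z)) - z ≡ d - c
      two = solve-∀
      skipped : b ≡ not χ → b ≡ b′ → Joined (y , b) (y′ , b′)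
      skipped eq b≡b′ = go (halve f) refl
        where
        go : ∀ {n} → Halved n → n ≡ f → Joined (y , b) (y′ , b′)
        go (odd a) n≡f = skip (≈-trans (≈-reflexive
          (trans (two (zigzag f) (δ f) (δ (suc f)))
          (trans (cong (λ n → δ (suc n) - δ n) (sym n≡f)) (cong₂ _-_ (δ-even (suc a)) (δ-odd a))))) (RiseAt.rise r)) eq
          (trans (sym b≡b′) eq)
        go (even a) n≡f = Joined-sym (skip (≈-by⁻ (≈-trans
          (≈-reflexive (trans (cong (λ n → - (δ (suc n) - δ n)) (sym n≡f))
          (cong₂ (λ s t → - (s - t)) (δ-odd a) (δ-even a)))) (RiseAt.rise r)) (swapped (zigzag f) (δ f) (δ (suc f)) y y′))
          (trans (sym b≡b′) eq) eq)
          where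
          swapped : ∀ z c d y y′ → ((d - (c - z)) - z) - (y - y′) ≡ (y′ - y) - (- (d - c))
          swapped = solve-∀
      choose : Dec (b ≡ b′) → Dec (b ≡ χ) → Joined (y , b) (y′ , b′)
      choose (no b≢b′)  _         = crossing b b′ b≢b′
      choose (yes b≡b′) (yes b≡χ) = last b≡χ b≡b′
      choose (yes b≡b′) (no b≢χ)  = skipped (¬-not b≢χ) b≡b′

    -- The edges of difference f + 1.
    longest : ∀ y b y′ b′ → RiseAt N y y′ f → RiseAt N y y′ (suc f) → Joined (y , b) (y′ , b′)
    longest y b y′ b′ r r′ = choose (b Bool.≟ χ) (b′ Bool.≟ χ)
      where
      Goal = Joined (y , b) (y′ , b′)
      end end′ : ℕ
      end  = suc (suc f) ℕ.+ suc e
      end′ = suc (suc f) ℕ.+ f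
      zz-end : zigzag end ≡ + suc f
      zz-end = trans (cong zigzag f≡) (zigzag-odd f)
      zz-end′ : zigzag end′ ≡ - + suc f
      zz-end′ = trans (cong zigzag (trans (+-suc (suc (suc f)) (suc e)) (cong suc f≡))) (zigzag-even (suc f))
      -- The cycles end at the zigzag values f + 1 and -(f + 1) and begin at 0, so the two closing
      -- edges supply the missing pairs of the longest difference.
      closeA : ∀ u c v c′ → 0ℤ - + suc f ≈ v - u [ N ] → c ≡ not χ → c′ ≡ false → Joined (u , c) (v , c′)
      closeA u c v c′ d eq eq′ = let x , p , p′ = place-levels end 0 u v (≈-trans (≈-reflexive (cong (λ z → 0ℤ - z) zz-end)) d) in
        x , true , Adjacent-resp (First.close (+ toℕ x) {f} refl (s≤s z≤n))
          (point-cong p (trans β₂-last (sym eq))) (point-cong p′ (trans (bitA-early {0} z≤n) (sym eq′)))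
      closeB : ∀ u c v c′ → + suc f ≈ v - u [ N ] → c ≡ not χ → c′ ≡ true → Joined (u , c) (v , c′)
      closeB u c v c′ d eq eq′ = let x , p , p′ = place-levels end′ 0 u v (≈-trans (≈-reflexive (trans (cong (λ z → 0ℤ - z) zz-end′) (n (+ suc f)))) d) in
        x , false , Adjacent-resp (Second.close (+ toℕ x) {suc f} refl (s≤s z≤n))
          (trans (cong point (b₂-end (+ toℕ x))) (point-cong p (sym eq))) (point-cong p′ (sym eq′))
        where n : ∀ k → 0ℤ - - k ≡ k
              n = solve-∀
      backward : ∀ {k} → k ≈ y′ - y [ N ] → 0ℤ - k ≈ y - y′ [ N ]
      backward {k} d = ≈-by⁻ d (w k y y′)
        where w : ∀ k y y′ → (0ℤ - k) - (y - y′) ≡ (y′ - y) - k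
              w = solve-∀
      choose : Dec (b ≡ χ) → Dec (b′ ≡ χ) → Goal
      choose (yes b≡χ) (no b′≢χ) = let x , p , p′ = place r in x , true , Adjacent-resp (First.along-a (+ toℕ x) (n<1+n (suc f)))
        (point-cong p (trans (bitA-early {f} ≤-refl) (trans β₁-f (sym b≡χ))))
          (point-cong p′ (trans bitA-middle (sym (¬-not b′≢χ))))
      choose (yes b≡χ) (yes b′≡χ) = let x , p , p′ = place r′ in x , true , Adjacent-resp (First.along-b (+ toℕ x) {0} (s≤s (s≤s z≤n)))
        (point-cong p (sym b≡χ)) (to (+ toℕ x) (sym (+-identityʳ (suc (suc f)))) p′ (trans (β₂-early {0} λ ()) (sym b′≡χ)))
      choose (no b≢χ) _ = go (halve f) refl
        where
        b≡ : b ≡ not χ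
        b≡ = ¬-not b≢χ
        go : ∀ {n} → Halved n → n ≡ f → Goal
        go (even a) n≡f = closing b′ refl
          where
          b≡false : b ≡ false
          b≡false = trans b≡ (trans (not-involutive (par f)) (trans (cong par (sym n≡f)) (par-dbl a)))
          up : + suc f ≈ y′ - y [ N ]
          up = ≈-trans (≈-reflexive (sym (trans (cong (λ n → zigzag (suc n) - zigzag n) (sym n≡f))
            (trans (zigzag-rise-even a) (cong (λ n → + suc n) n≡f))))) (RiseAt.rise r)
          closing : ∀ c → b′ ≡ c → Goal
          closing true  eq = closeB y b y′ b′ up b≡ eq
          closing false eq = Joined-sym (closeA y′ b′ y b (backward up) (trans eq (trans (sym b≡false) b≡)) b≡false)
        go (odd a) n≡f = closing b′ refl
          where
          b≡true : b ≡ true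
          b≡true = trans b≡ (trans (not-involutive (par f)) (trans (cong par (sym n≡f)) (cong not (par-dbl a))))
          down : 0ℤ - + suc f ≈ y′ - y [ N ]
          down = ≈-trans (≈-reflexive (sym (trans (cong (λ n → zigzag (suc n) - zigzag n) (sym n≡f))
            (trans (cong₂ _-_ (zigzag-even (suc a)) (zigzag-odd a))
            (trans (n (+ a)) (cong (λ z → 0ℤ - z) (trans (cong (λ z → 1ℤ + (1ℤ + z)) (sym (+dbl a)))
              (cong (λ n → + suc n) n≡f)))))))) (RiseAt.rise r)
            where n : ∀ a → - (1ℤ + a) - (1ℤ + a) ≡ 0ℤ - (1ℤ + (1ℤ + (a + a)))
                  n = solve-∀
          closing : ∀ c → b′ ≡ c → Goal
          closing false eq = closeA y b y′ b′ down b≡ eq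
          closing true  eq = Joined-sym (closeB y′ b′ y b (≈-trans (≈-reflexive (n (+ suc f))) (backward down))
            (trans eq (trans (sym b≡true) b≡)) b≡true)
            where n : ∀ k → k ≡ 0ℤ - (0ℤ - k)
                  n = solve-∀

    starter : Starter N m
    starter = record { cycle = cycle ; spans = spans ; covers = λ y b y′ b′ u≢v → covers y b y′ b′ u≢v (y ≈? y′) }
      where
      rising : ∀ y b y′ b′ → Twin f N y y′ → Joined (y , b) (y′ , b′)
      rising y b y′ b′ (middle r r′)     = longest y b y′ b′ r r′
      rising y b y′ b′ (outer o lt r r′) = last (m≤n⇒m<n∨m≡n lt)
        where
        last : suc o < f ⊎ suc o ≡ f → Joined (y , b) (y′ , b′)
        last (inj₁ lt)   = ordinary y b y′ b′ o lt r r′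
        last (inj₂ refl) = shortest y b y′ b′ (subst (RiseAt N y y′) (n∸n≡0 f) r) r′
      either : ∀ {y b y′ b′} → Rise (suc f) y y′ ⊎ Rise (suc f) y′ y → Joined (y , b) (y′ , b′)
      either (inj₁ r) = rising _ _ _ _ (twin r)
      either (inj₂ r) = Joined-sym (rising _ _ _ _ (twin r))
      covers : ∀ y b y′ b′ → point (y , b) ≢ point (y′ , b′) → Dec (y ≈ y′ [ N ]) → Joined (y , b) (y′ , b′)
      covers y b y′ b′ u≢v (yes e) = within y b y′ b′ e λ eq → u≢v (point-cong e eq)
      covers y b y′ b′ u≢v (no ¬e) = either (rises (suc f) y y′ ¬e)

  -- Finite checks and the starter of length five

  allBool? : ∀ {P : Bool → Set} → (∀ b → Dec (P b)) → Dec (∀ b → P b)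
  allBool? {P} P? = map′ (λ { (p , q) → both p q }) (λ p → p false , p true) (P? false ×-dec P? true)
    where
    both : P false → P true → ∀ b → P b
    both p q false = p
    both p q true  = q

  anyBool? : ∀ {P : Bool → Set} → (∀ b → Dec (P b)) → Dec (∃ P)
  anyBool? {P} P? = map′ (λ { (inj₁ p) → false , p ; (inj₂ q) → true , q }) split (P? false ⊎-dec P? true)
    where
    split : ∃ P → P false ⊎ P true
    split (false , p) = inj₁ p
    split (true  , q) = inj₂ q

  ≈-% : ∀ a → + a ≈ + (a % 5) [ 5 ]
  ≈-% a = ≈-shift (+ (a / 5)) (trans (cong (λ n → + n - + (a % 5)) (m≡m%n+[m/n]*n a 5))
    (trans (cong (λ z → z - + (a % 5)) (trans (pos-+ (a % 5) (a / 5 ℕ.* 5))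
    (cong (λ z → + (a % 5) + z) (pos-* (a / 5) 5)))) (l (+ (a % 5)) (+ (a / 5) * + 5))))
    where l : ∀ r q → r + q - r ≡ q
          l = solve-∀

  -- The two cycles were found by a computer search.
  module ShortStarter where

    open Ladder 5

    spot : Bool → ℕ → ℕ × Bool
    spot true  0 = 0 , false
    spot true  1 = 0 , true
    spot true  2 = 1 , true
    spot true  3 = 3 , false
    spot true  _ = 1 , false
    spot false 0 = 2 , false
    spot false 1 = 3 , true
    spot false 2 = 4 , false
    spot false 3 = 2 , true
    spot false _ = 4 , true

    cycle : ℤ → Bool → ℕ → ℤ × Bool
    cycle x s i = x + + proj₁ (spot s i) , proj₂ (spot s i)

    succ : Fin 5 → ℕ
    succ i = suc (toℕ i) % 5

    hits : ∀ (r : Fin 5) b → ∃ λ s → ∃ λ (i : Fin 5) → proj₁ (spot s (toℕ i)) ≡ toℕ r × proj₂ (spot s (toℕ i)) ≡ b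
    hits = toWitness {a? = all? λ r → allBool? λ b → anyBool? λ s → any? λ i →
      (proj₁ (spot s (toℕ i)) ℕ.≟ toℕ r) ×-dec (proj₂ (spot s (toℕ i)) Bool.≟ b)} tt

    Forward Backward : Fin 5 → Bool → Bool → Bool → Fin 5 → Set
    Forward  r b b′ s i = (proj₁ (spot s (toℕ i)) ℕ.+ toℕ r) % 5 ≡ proj₁ (spot s (succ i)) × proj₂ (spot s (toℕ i)) ≡ b ×
      proj₂ (spot s (succ i)) ≡ b′
    Backward r b b′ s i = (proj₁ (spot s (succ i)) ℕ.+ toℕ r) % 5 ≡ proj₁ (spot s (toℕ i)) × proj₂ (spot s (succ i)) ≡ b ×
      proj₂ (spot s (toℕ i)) ≡ b′

    links : ∀ (r : Fin 5) b b′ → (toℕ r ≡ 0 × b ≡ b′) ⊎ (∃ λ s → ∃ (Forward r b b′ s)) ⊎ (∃ λ s → ∃ (Backward r b b′ s))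
    links = toWitness {a? = all? λ r → allBool? λ b → allBool? λ b′ →
      ((toℕ r ℕ.≟ 0) ×-dec (b Bool.≟ b′)) ⊎-dec
      ((anyBool? λ s → any? λ i → ((proj₁ (spot s (toℕ i)) ℕ.+ toℕ r) % 5 ℕ.≟ proj₁ (spot s (succ i))) ×-dec
        (proj₂ (spot s (toℕ i)) Bool.≟ b) ×-dec (proj₂ (spot s (succ i)) Bool.≟ b′)) ⊎-dec
       (anyBool? λ s → any? λ i → ((proj₁ (spot s (succ i)) ℕ.+ toℕ r) % 5 ℕ.≟ proj₁ (spot s (toℕ i))) ×-dec
         (proj₂ (spot s (succ i)) Bool.≟ b) ×-dec (proj₂ (spot s (toℕ i)) Bool.≟ b′)))} tt

    consecutive : ∀ {x s u v} (i : Fin 5) → point (cycle x s (toℕ i)) ≡ point u → point (cycle x s (succ i)) ≡ point v →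
      Consecutive point 5 (cycle x s) u v
    consecutive Fin.zero p q = next 0 (s≤s (s≤s z≤n)) p q
    consecutive (Fin.suc Fin.zero) p q = next 1 (s≤s (s≤s (s≤s z≤n))) p q
    consecutive (Fin.suc (Fin.suc Fin.zero)) p q = next 2 (s≤s (s≤s (s≤s (s≤s z≤n)))) p q
    consecutive (Fin.suc (Fin.suc (Fin.suc Fin.zero))) p q = next 3 (s≤s (s≤s (s≤s (s≤s (s≤s z≤n))))) p q
    consecutive (Fin.suc (Fin.suc (Fin.suc (Fin.suc Fin.zero)))) p q = wrap 4 refl p q

    place-spots : ∀ a c (r : Fin 5) y y′ → + toℕ r ≈ y′ - y [ 5 ] → (a ℕ.+ toℕ r) % 5 ≡ c →
                  ∃ λ (x : Fin 5) → + toℕ x + + a ≈ y [ 5 ] × + toℕ x + + c ≈ y′ [ 5 ]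
    place-spots a c r y y′ e eq =
      let x , p = represent-at {5} (+ a) y
          d : + c - + a ≈ y′ - y [ 5 ]
          d = ≈-trans {y = + toℕ r} (≈-by⁻ (≈-trans (≈-% (a ℕ.+ toℕ r)) (≈-reflexive (cong +_ eq)))
            (trans (n (+ a) (+ toℕ r) (+ c)) (cong (λ z → + c - z) (sym (pos-+ a (toℕ r)))))) e
      in x , p , ≈-by₂ p d (l (+ toℕ x) (+ a) (+ c) y y′)
      where
      n : ∀ a r c → (c - a) - r ≡ c - (a + r)
      n = solve-∀
      l : ∀ x z z′ u v → x + z′ - v ≡ (x + z - u) + ((z′ - z) - (v - u))
      l = solve-∀

    starter : Starter 5 5
    starter = record { cycle = cycle ; spans = spans ; covers = λ y b y′ b′ ne → covers y b y′ b′ ne (residue 5 (y′ - y))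
      (residue-≈ 5 (y′ - y)) }
      where
      spans : ∀ x y b → ∃ λ s → ∃ λ i → i < 5 × point (cycle x s i) ≡ point (y , b)
      spans x y b =
        let s , i , p , q = hits (residue 5 (y - x)) b
        in s , toℕ i , toℕ<n i , point-cong (≈-trans (≈-reflexive (cong (λ n → x + + n) p))
          (≈-by (residue-≈ 5 (y - x)) (l x y _))) q
        where l : ∀ x y r → x + r - y ≡ r - (y - x)
              l = solve-∀
      covers : ∀ y b y′ b′ → point (y , b) ≢ point (y′ , b′) → (r : Fin 5) → + toℕ r ≈ y′ - y [ 5 ] →
               ∃ λ (x : Fin 5) → ∃ λ s → Adjacent point 5 (cycle (+ toℕ x) s) (y , b) (y′ , b′)
      covers y b y′ b′ ne r e = go (links r b b′)
        where
        go : _ → ∃ λ (x : Fin 5) → ∃ λ s → Adjacent point 5 (cycle (+ toℕ x) s) (y , b) (y′ , b′)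
        go (inj₁ (r≡0 , b≡b′)) = contradiction (point-cong y≈y′ b≡b′) ne
          where
          l : ∀ y y′ → y - y′ ≡ 0ℤ - (y′ - y)
          l = solve-∀
          y≈y′ : y ≈ y′ [ 5 ]
          y≈y′ = ≈-by (≈-trans (≈-reflexive (cong +_ (sym r≡0))) e) (l y y′)
        go (inj₂ (inj₁ (s , i , p , q , q′))) =
          let x , h , h′ = place-spots (proj₁ (spot s (toℕ i))) (proj₁ (spot s (succ i))) r y y′ e p
          in x , s , inj₁ (consecutive {+ toℕ x} {s} i (point-cong h q) (point-cong h′ q′))
        go (inj₂ (inj₂ (s , i , p , q , q′))) =
          let x , h , h′ = place-spots (proj₁ (spot s (succ i))) (proj₁ (spot s (toℕ i))) r y y′ e p
          in x , s , inj₂ (consecutive {+ toℕ x} {s} i (point-cong h′ q′) (point-cong h q))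

  -- The bits which tell the two strands through an element z with colours σ, κ apart, at the last
  -- level (end) and at the level before it (inn).
  end inn : Bool → Bool → Bool → Bool → Bool
  end true  j σ κ = if σ then false else j
  end false j σ κ = if σ then true else j xor κ
  inn true  j σ κ = if σ then true else j xor κ
  inn false j σ κ = if σ then false else not j

  -- Between ordinary elements `u = true` gives different bits, and `u = false` equal ones because κ
  -- alternates. The bit at a special element is fixed by u while j runs through the bits of the
  -- other element, so no alternation is required there.
  ends-meet : ∀ σ κ σ′ κ′ b b′ → σ ∧ σ′ ≡ false → (σ ≡ false → σ′ ≡ false → κ′ ≡ not κ) →
              ∃ λ u → ∃ λ j → b ≡ end u j σ κ × b′ ≡ not (end u j σ′ κ′)
  ends-meet = toWitness {a? = allBool? λ σ → allBool? λ κ → allBool? λ σ′ → allBool? λ κ′ → allBool? λ b → allBool? λ b′ →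
    (σ ∧ σ′ Bool.≟ false) →-dec (((σ Bool.≟ false) →-dec ((σ′ Bool.≟ false) →-dec (κ′ Bool.≟ not κ))) →-dec
    anyBool? λ u → anyBool? λ j → (b Bool.≟ end u j σ κ) ×-dec (b′ Bool.≟ not (end u j σ′ κ′)))} tt

  -- Between ordinary elements the two bits differ by κ′ on one side and by its negation on the
  -- other. A special element fixes one bit, oppositely on the two sides, and leaves the other bit
  -- free; two special elements would fix both.
  ends-link : ∀ τ σ κ σ′ κ′ b b′ → σ ∧ σ′ ≡ false →
              ∃ λ j → (b ≡ not τ xor end true j σ κ × b′ ≡ not τ xor inn true j σ′ κ′) ⊎
                (b ≡ τ xor inn false j σ κ × b′ ≡ τ xor end false j σ′ κ′)
  ends-link = toWitness {a? = allBool? λ τ → allBool? λ σ → allBool? λ κ → allBool? λ σ′ → allBool? λ κ′ → allBool? λ b →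
    allBool? λ b′ →
    (σ ∧ σ′ Bool.≟ false) →-dec anyBool? λ j →
    ((b Bool.≟ not τ xor end true j σ κ) ×-dec (b′ Bool.≟ not τ xor inn true j σ′ κ′)) ⊎-dec
    ((b Bool.≟ τ xor inn false j σ κ) ×-dec (b′ Bool.≟ τ xor end false j σ′ κ′))} tt

  -- Distances in a cyclic group of odd order

  record Distance (g : ℕ) (D : ℕ → ℤ) (z z′ : ℤ) : Set where
    constructor distance
    field
      d      : Fin g
      apart  : z′ - z ≈ D (suc (toℕ d)) [ suc (dbl g) ] ⊎ z - z′ ≈ D (suc (toℕ d)) [ suc (dbl g) ]

  by-fin : ∀ {g} (D : ℕ → ℤ) {z z′} a → 1 ≤ a → a ≤ g →
           z′ - z ≈ D a [ suc (dbl g) ] ⊎ z - z′ ≈ D a [ suc (dbl g) ] → Distance g D z z′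
  by-fin D {z} {z′} (suc a) _ le e = distance (fromℕ< le)
    (subst (λ a → z′ - z ≈ D (suc a) [ _ ] ⊎ z - z′ ≈ D (suc a) [ _ ]) (sym (toℕ-fromℕ< le)) e)

  opposite-residue : ∀ {N r z z′} → r ≤ N → + r ≈ z′ - z [ N ] → z - z′ ≈ + (N ∸ r) [ N ]
  opposite-residue {N} {r} {z} {z′} le e = ≈-trans (≈-by e (l z z′ (+ r)))
    (≈-trans (≈-shift (- 1ℤ) (l′ (+ r) (+ N))) (≈-reflexive (sym (pos-∸ le))))
    where l : ∀ z z′ r → (z - z′) - (- r) ≡ r - (z′ - z)
          l = solve-∀
          l′ : ∀ r n → (- r) - (n - r) ≡ - 1ℤ * n
          l′ = solve-∀

  single-distance : ∀ g z z′ → ¬ z ≈ z′ [ suc (dbl g) ] → Distance g +_ z z′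
  single-distance g z z′ ne = go (toℕ (residue s (z′ - z))) (toℕ<n (residue s (z′ - z))) (residue-≈ s (z′ - z))
    where
    s = suc (dbl g)
    go : ∀ r → r < s → + r ≈ z′ - z [ s ] → Distance g +_ z z′
    go zero r<s e = contradiction (≈-by e (l z z′)) ne
      where l : ∀ z z′ → z - z′ ≡ 0ℤ - (z′ - z)
            l = solve-∀
    go (suc r) r<s e with suc r ≤? g
    ... | yes le = by-fin +_ (suc r) (s≤s z≤n) le (inj₁ (≈-sym e))
    ... | no  gt = by-fin +_ (s ∸ suc r) (m<n⇒0<n∸m r<s)
      (m≤n+o⇒m∸n≤o s (suc r) (≤-trans (s≤s (≤-reflexive (dbl≡+ g))) (+-monoˡ-≤ g (≰⇒> gt))))
                     (inj₂ (opposite-residue {z = z} {z′} (<⇒≤ r<s) e))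

  -- As s is odd, a nonzero residue or its negative has an even representative below s, that is, 2a
  -- with a ≤ g.
  double-distance : ∀ g z z′ → ¬ z ≈ z′ [ suc (dbl g) ] → Distance g (λ a → + a + + a) z z′
  double-distance g z z′ ne = go (halve (toℕ (residue s (z′ - z)))) (toℕ<n (residue s (z′ - z))) (residue-≈ s (z′ - z))
    where
    s = suc (dbl g)
    D = λ a → + a + + a
    go : ∀ {r} → Halved r → r < s → + r ≈ z′ - z [ s ] → Distance g D z z′
    go (even zero) r<s e = contradiction (≈-by e (l z z′)) ne
      where l : ∀ z z′ → z - z′ ≡ 0ℤ - (z′ - z)
            l = solve-∀
    go (even (suc a)) r<s e = by-fin D (suc a) (s≤s z≤n) (≤-pred (dbl-cancel-< {suc a} {suc g} (m<n⇒m<1+n r<s)))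
      (inj₁ (≈-trans (≈-sym e) (≈-reflexive (+dbl (suc a)))))
    go (odd a) r<s e = by-fin D (g ∸ a) (m<n⇒0<n∸m a<g) (m∸n≤m g a)
      (inj₂ (≈-trans (opposite-residue {z = z} {z′} (<⇒≤ r<s) e) (≈-reflexive (trans (cong +_ even-part) (+dbl (g ∸ a))))))
      where
      a<g : a < g
      a<g = dbl-cancel-< {a} {g} (≤-pred r<s)
      even-part : dbl g ∸ dbl a ≡ dbl (g ∸ a)
      even-part = trans (cong (_∸ dbl a) (trans (cong dbl (sym (m∸n+n≡m (<⇒≤ a<g)))) (dbl-+ (g ∸ a) a)))
        (m+n∸n≡m (dbl (g ∸ a)) (dbl a))

  -- Odd cycle lengths 2f + 3 with 2s cycles per factor, s = 2g + 1.  The vertices are Z_N × Z_s × Z_2.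
  -- The starter covers the pairs with equal middle coordinate.  For every distance d the other factors
  -- move by -d in Z_s from level to level, except that the two strands of a cycle separate in the last
  -- step, one of them moving by -d and the other one by d; which one is told by the bits.
  module TwiceOddNumber (f′ g : ℕ) (S : Starter (suc (dbl (suc (suc f′)))) (suc (suc (suc f′)) ℕ.+ suc (suc f′))) where

    f N s m : ℕ
    f = suc f′
    N = suc (dbl (suc f))
    s = suc (dbl g)
    m = suc (suc f) ℕ.+ suc f

    module L = Ladder N

    Vertex : Set
    Vertex = ℤ × (ℤ × Bool)

    point : Vertex → Fin (N ℕ.* (s ℕ.* 2))
    point (y , z , b) = combine (residue N y) (combine (residue s z) (bit b))

    point-cong : ∀ {y y′ z z′ b b′} → y ≈ y′ [ N ] → z ≈ z′ [ s ] → b ≡ b′ → point (y , z , b) ≡ point (y′ , z′ , b′)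
    point-cong e e′ e″ = cong₂ combine (residue-cong e) (cong₂ combine (residue-cong e′) (cong bit e″))

    point-onto : ∀ w → ∃ λ v → point v ≡ w
    point-onto w =
      let i , j = remQuot {N} (s ℕ.* 2) w
          k , l = remQuot {s} 2 j
          b , e = bit-onto l
      in (+ toℕ i , + toℕ k , b) , trans (cong₂ combine (residue-toℕ i)
        (trans (cong₂ combine (residue-toℕ k) e) (combine-remQuot {s} 2 j))) (combine-remQuot {N} (s ℕ.* 2) w)

    lift : ∀ u v {z z′} → L.point u ≡ L.point v → z ≈ z′ [ s ] →
      point (proj₁ u , z , proj₂ u) ≡ point (proj₁ v , z′ , proj₂ v)
    lift (y , b) (y′ , b′) eq e =
      let p , q = combine-injective (residue N y) (bit b) (residue N y′) (bit b′) eq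
      in cong₂ combine p (cong₂ combine (residue-cong e) q)

    Label Factor Part : Set
    Label  = Fin g × Bool
    Factor = Fin N ⊎ (Fin N × Label)
    Part   = Bool × Fin s

    step : Fin g → ℤ
    step d = + suc (toℕ d)

    module C (d : Fin g) = Colouring (colour g (suc (toℕ d)) (s≤s z≤n) (toℕ<n d))

    position : Bool → ℕ → ℕ
    position true  o = f ∸ o
    position false o = suc (suc f) ℕ.+ o

    endAt innAt : Bool → Label → ℤ → Bool
    endAt u (d , j) z = end u j (C.special d z) (C.κ d z)
    innAt u (d , j) z = inn u j (C.special d z) (C.κ d z)

    endAt-cong : ∀ u j {z z′} → z ≈ z′ [ s ] → endAt u j z ≡ endAt u j z′
    endAt-cong u (d , j) e = cong₂ (end u j) (C.special-cong d e) (C.κ-cong d e)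

    innAt-cong : ∀ u j {z z′} → z ≈ z′ [ s ] → innAt u j z ≡ innAt u j z′
    innAt-cong u (d , j) e = cong₂ (inn u j) (C.special-cong d e) (C.κ-cong d e)

    sign : Bool → ℤ → ℤ
    sign true  x = x
    sign false x = - x

    -- The tag ε decides the direction of the last move. Every element of the end level is reached
    -- once from each direction, with opposite bits, so the separated strands still fill that level.
    swing : Bool → Label → Bool → ℤ → ℤ × Bool
    swing u (d , j) ε z = z + sign ε (step d) , ε xor endAt u (d , j) (z + sign ε (step d))

    -- As `par o` alternates, every inner step changes the bit by exactly j.
    inner : Label → ℤ → Bool → ℕ → ℤ × Bool
    inner (d , j) c b o = c - + suc o * step d , b xor (par o ∧ j)

    side : Bool → Label → ℤ → Bool → ℕ → ℤ × Bool
    side u j c b o with o <? f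
    ... | yes _ = inner j c b o
    ... | no  _ = let z , b′ = inner j c b f′ in swing u j (b′ xor innAt u j z) z

    side-inner : ∀ u j c b {o} → o < f → side u j c b o ≡ inner j c b o
    side-inner u j c b {o} lt with o <? f
    ... | yes _ = refl
    ... | no ¬p = contradiction lt ¬p

    side-end : ∀ u j c b → side u j c b f ≡ swing u j (proj₂ (inner j c b f′) xor innAt u j (proj₁ (inner j c b f′)))
      (proj₁ (inner j c b f′))
    side-end u j c b with f <? f
    ... | yes p = contradiction p (<-irrefl refl)
    ... | no _  = refl

    apex : Fin N × Label → Part → Vertex
    apex (x , _ , j) (u , c) = + toℕ x + zigzag (suc f) , + toℕ c , (if u then j else not j)

    level : Fin N × Label → Part → Bool → ℕ → Vertex
    level (x , j) (u , c) b o = + toℕ x + zigzag (position u o) , side u j (+ toℕ c) b o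

    path : Factor → Part → ℕ → Vertex
    path (inj₁ x) (b , c) i = let y , b′ = Starter.cycle S (+ toℕ x) b i in y , + toℕ c , b′
    path (inj₂ F) c         = ApexWalk.walk point f (apex F c) (level F c)

    Joined : Vertex → Vertex → Set
    Joined u v = ∃ λ F → ∃ λ c → Adjacent point m (path F c) u v

    Joined-sym : ∀ {u v} → Joined u v → Joined v u
    Joined-sym (F , c , a) = F , c , swap a

    module _ (u : Bool) (x : Fin N) (j : Label) where

      private
        F = x , j
        D = step (proj₁ j)

      inner-point : ∀ {o c b y z b′} → o < f → + toℕ x + zigzag (position u o) ≈ y [ N ] → + toℕ c - + suc o * D ≈ z [ s ] →
                    b xor (par o ∧ proj₂ j) ≡ b′ → point (level F (u , c) b o) ≡ point (y , z , b′)
      inner-point {o} {c} {b} {y} {z} {b′} lt e e′ eq = trans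
        (cong (λ p → point (+ toℕ x + zigzag (position u o) , p)) (side-inner u j (+ toℕ c) b lt)) (point-cong e e′ eq)

      -- The strand with parameter ε whose last inner place is Y.
      foot : ℤ → Fin s
      foot Y = residue s (Y + + suc f′ * D)

      foot-≈ : ∀ Y → + toℕ (foot Y) - + suc f′ * D ≈ Y [ s ]
      foot-≈ Y = ≈-by (residue-≈ s (Y + + suc f′ * D)) (l (+ toℕ (foot Y)) Y (+ suc f′ * D))
        where l : ∀ c y d → (c - d) - y ≡ c - (y + d)
              l = solve-∀

      initial : Bool → ℤ → Bool
      initial ε Y = (ε xor innAt u j Y) xor (par f′ ∧ proj₂ j)

      last-inner : ∀ ε Y {y} → + toℕ x + zigzag (position u f′) ≈ y [ N ] →
        point (level F (u , foot Y) (initial ε Y) f′) ≡ point (y , Y , ε xor innAt u j Y)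
      last-inner ε Y e = inner-point (n<1+n f′) e (foot-≈ Y) (xor-cancelʳ (ε xor innAt u j Y) (par f′ ∧ proj₂ j))

      tail-end : ∀ ε Y b → ε ≡ (b xor (par f′ ∧ proj₂ j)) xor innAt u j Y → ∀ {y z b′} →
        + toℕ x + zigzag (position u f) ≈ y [ N ] →
                 Y + sign ε D ≈ z [ s ] → ε xor endAt u j z ≡ b′ → point (level F (u , foot Y) b f) ≡ point (y , z , b′)
      tail-end ε Y b flag {y} {z} {b′} e e′ eq = trans
        (cong (λ p → point (+ toℕ x + zigzag (position u f) , p)) (side-end u j (+ toℕ (foot Y)) b))
        (trans (cong (λ ε → point (+ toℕ x + zigzag (position u f) , swing u j ε Y′)) flag′)
          (point-cong e Y′≈ (trans (cong (ε xor_) (endAt-cong u j Y′≈)) eq)))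
        where
        Y′ = + toℕ (foot Y) - + suc f′ * D
        Y′≈ : Y′ + sign ε D ≈ z [ s ]
        Y′≈ = ≈-trans (≈-by (foot-≈ Y) (l Y′ Y (sign ε D))) e′
          where l : ∀ a b d → (a + d) - (b + d) ≡ a - b
                l = solve-∀
        flag′ : (b xor (par f′ ∧ proj₂ j)) xor innAt u j Y′ ≡ ε
        flag′ = trans (cong ((b xor (par f′ ∧ proj₂ j)) xor_) (innAt-cong u j (foot-≈ Y))) (sym flag)

      initial-flag : ∀ ε Y → ε ≡ (initial ε Y xor (par f′ ∧ proj₂ j)) xor innAt u j Y
      initial-flag ε Y = sym (trans (cong (_xor innAt u j Y) (xor-cancelʳ (ε xor innAt u j Y) (par f′ ∧ proj₂ j)))
        (xor-cancelʳ ε (innAt u j Y)))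

      opposite-flag : ∀ ε Y → not ε ≡ (not (initial ε Y) xor (par f′ ∧ proj₂ j)) xor innAt u j Y
      opposite-flag ε Y = trans (cong not (initial-flag ε Y)) (l (initial ε Y) (par f′ ∧ proj₂ j) (innAt u j Y))
        where l : ∀ a b c → not ((a xor b) xor c) ≡ (not a xor b) xor c
              l false false c = refl
              l false true  c = not-involutive c
              l true  false c = not-involutive c
              l true  true  c = refl

      -- The two strands leave their common element Y in opposite directions, so the rim joins
      -- elements at distance 2D and supplies the pairs inside a column.
      rim : ∀ Y {y y′ z z′ b b′} → + toℕ x + zigzag (position u f) ≈ y [ N ] → + toℕ x + zigzag (position u f) ≈ y′ [ N ] →
            Y - D ≈ z [ s ] → Y + D ≈ z′ [ s ] → endAt u j z ≡ b → not (endAt u j z′) ≡ b′ → Joined (y , z , b)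
              (y′ , z′ , b′)
      rim Y e e′ p p′ q q′ = inj₂ F , (u , foot Y) , Adjacent-resp
        (ApexWalk.rim point f (apex F (u , foot Y)) (level F (u , foot Y)) (initial false Y))
        (tail-end false Y (initial false Y) (initial-flag false Y) e p q)
        (tail-end true Y (not (initial false Y)) (opposite-flag false Y) e′ p′ q′)

      link : ∀ ε Y {y y′ z b b′} → + toℕ x + zigzag (position u f′) ≈ y [ N ] → + toℕ x + zigzag (position u f) ≈ y′ [ N ] →
             Y + sign ε D ≈ z [ s ] → b ≡ ε xor innAt u j Y → b′ ≡ ε xor endAt u j z → Joined (y , Y , b) (y′ , z , b′)
      link ε Y {y} e e′ p q q′ = inj₂ F , (u , foot Y) , Adjacent-resp
        (ApexWalk.along point f (apex F (u , foot Y)) (level F (u , foot Y)) (initial ε Y) (n<1+n f′))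
        (trans (last-inner ε Y e) (cong (λ b → point (y , Y , b)) (sym q)))
        (tail-end ε Y (initial ε Y) (initial-flag ε Y) e′ p (sym q′))

      stretch : ∀ o {y y′ z z′ b b′} → suc o < f → + toℕ x + zigzag (position u o) ≈ y [ N ] →
        + toℕ x + zigzag (position u (suc o)) ≈ y′ [ N ] →
                z - z′ ≈ D [ s ] → b xor b′ ≡ proj₂ j → Joined (y , z , b) (y′ , z′ , b′)
      stretch o {y} {y′} {z} {z′} {b} {b′} lt e e′ d eq =
        let c = residue s (z + + suc o * D)
            i = b xor (par o ∧ proj₂ j)
            r = residue-≈ s (z + + suc o * D)
        in inj₂ F , (u , c) , Adjacent-resp (ApexWalk.along point f (apex F (u , c)) (level F (u , c)) i
          (<-trans (n<1+n o) lt))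
          (inner-point (<-trans (n<1+n o) lt) e (≈-by r (l (+ toℕ c) z (+ suc o * D))) (xor-cancelʳ b (par o ∧ proj₂ j)))
          (inner-point lt e′ (≈-by₂ r d (l′ (+ toℕ c) z z′ (+ suc o) D)) (bits b b′ (par o) (proj₂ j) eq))
        where
        l : ∀ c z d → (c - d) - z ≡ c - (z + d)
        l = solve-∀
        l′ : ∀ c z z′ o d → c - (1ℤ + o) * d - z′ ≡ (c - (z + o * d)) + ((z - z′) - d)
        l′ = solve-∀
        bits : ∀ b b′ p j → b xor b′ ≡ j → (b xor (p ∧ j)) xor (not p ∧ j) ≡ b′
        bits false false false _ refl = refl
        bits false true  false _ refl = refl
        bits true  false false _ refl = refl
        bits true  true  false _ refl = refl
        bits false false true  _ refl = refl
        bits false true  true  _ refl = refl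
        bits true  false true  _ refl = refl
        bits true  true  true  _ refl = refl

      spoke : ∀ {y y′ z z′ b b′} → + toℕ x + zigzag (suc f) ≈ y [ N ] → + toℕ x + zigzag (position u 0) ≈ y′ [ N ] →
              z - z′ ≈ D [ s ] → (if u then proj₂ j else not (proj₂ j)) ≡ b → Joined (y , z , b) (y′ , z′ , b′)
      spoke {y} {y′} {z} {z′} {b} {b′} e e′ d eq =
        let c = residue s z
            r = residue-≈ s z
        in inj₂ F , (u , c) , Adjacent-resp (ApexWalk.spoke point f (apex F (u , c)) (level F (u , c)) b′)
          (point-cong e r eq) (inner-point {0} {c} {b′} (s≤s z≤n) e′ (≈-by₂ r d (l (+ toℕ c) z z′ D)) (xor-identityʳ b′))
        where l : ∀ c z z′ d → c - 1ℤ * d - z′ ≡ (c - z) + ((z - z′) - d)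
              l = solve-∀

    spans : ∀ F v → ∃ λ c → ∃ λ k → k < m × point (path F c k) ≡ point v
    spans (inj₁ x) (y , z , b) =
      let t , i , i<m , eq = Starter.spans S (+ toℕ x) y b
      in (t , residue s z) , i , i<m , lift (Starter.cycle S (+ toℕ x) t i) (y , b) eq (residue-≈ s z)
    spans (inj₂ (x , d , j)) (y , z , b) = go (zigzag-onto N (y - + toℕ x))
      where
      F = x , d , j
      Goal = ∃ λ c → ∃ λ k → k < m × point (path (inj₂ F) c k) ≡ point (y , z , b)
      on-level : ∀ u c t o → o < suc f → point (level F (u , c) t o) ≡ point (y , z , b) → Goal
      on-level u c t o lt eq = let k , k<m , eq′ = ApexWalk.on point f (apex F (u , c)) (level F (u , c)) t lt in (u , c) , k , k<m , trans eq′ eq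
      via : ∀ u o → o ≤ f → + toℕ x + zigzag (position u o) ≈ y [ N ] → Goal
      via u o le e with m≤n⇒m<n∨m≡n le
      ... | inj₁ lt = on-level u (residue s (z + + suc o * step d)) (b xor (par o ∧ j)) o (m<n⇒m<1+n lt)
          (inner-point u x (d , j) {b = b xor (par o ∧ j)} lt e
            (≈-by (residue-≈ s (z + + suc o * step d)) (l (+ toℕ (residue s (z + + suc o * step d))) z (+ suc o * step d)))
            (xor-cancelʳ b (par o ∧ j)))
        where l : ∀ c z d → (c - d) - z ≡ c - (z + d)
              l = solve-∀
      ... | inj₂ refl with endAt u (d , j) z Bool.≟ b
      ...   | yes eq = on-level u (foot u x (d , j) Y) (initial u x (d , j) false Y) f (n<1+n f)
            (tail-end u x (d , j) false Y (initial u x (d , j) false Y) (initial-flag u x (d , j) false Y) e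
              (≈-reflexive (l z (step d))) eq)
          where Y = z + step d
                l : ∀ z d → z + d + - d ≡ z
                l = solve-∀
      ...   | no ne = on-level u (foot u x (d , j) Y) (initial u x (d , j) true Y) f (n<1+n f)
            (tail-end u x (d , j) true Y (initial u x (d , j) true Y) (initial-flag u x (d , j) true Y) e
              (≈-reflexive (l z (step d))) (sym (¬-not (ne ∘ sym))))
          where Y = z - step d
                l : ∀ z d → z - d + d ≡ z
                l = solve-∀
      at-apex : + toℕ x + zigzag (suc f) ≈ y [ N ] → Dec (b ≡ j) → Goal
      at-apex e (yes b≡j) = let k , k<m , eq = ApexWalk.on-apex point f (apex F (true , residue s z)) (level F (true , residue s z)) in
        (true , residue s z) , k , k<m , trans eq (point-cong e (residue-≈ s z) (sym b≡j))
      at-apex e (no b≢j) = let k , k<m , eq = ApexWalk.on-apex point f (apex F (false , residue s z)) (level F (false , residue s z)) in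
        (false , residue s z) , k , k<m , trans eq (point-cong e (residue-≈ s z) (sym (¬-not b≢j)))
      go : ∃ (λ i → i < N × zigzag i ≈ y - + toℕ x [ N ]) → Goal
      go (i , i<N , e) = at (≈-rebase {x = + toℕ x} {y = y} {i = i} e) (<-cmp i (suc f))
        where
        at : + toℕ x + zigzag i ≈ y [ N ] → Tri (i < suc f) (i ≡ suc f) (suc f < i) → Goal
        at e (tri< lt _ _) = via true (f ∸ i) (m∸n≤m f i)
          (≈-trans (≈-reflexive (cong (λ i → + toℕ x + zigzag i) (m∸[m∸n]≡n (≤-pred lt)))) e)
        at e (tri≈ _ eq _) = at-apex (≈-trans (≈-reflexive (cong (λ i → + toℕ x + zigzag i) (sym eq))) e) (b Bool.≟ j)
        at e (tri> _ _ gt) = via false (i ∸ suc (suc f))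
          (≤-pred (+-cancelˡ-< (suc (suc f)) _ _ (≤-<-trans (≤-reflexive (m+[n∸m]≡n gt))
            (<-≤-trans i<N (≤-reflexive (cong suc (dbl≡+ (suc f))))))))
            (≈-trans (≈-reflexive (cong (λ i → + toℕ x + zigzag i) (m+[n∸m]≡n gt))) e)

    same : ∀ y z b y′ z′ b′ → point (y , z , b) ≢ point (y′ , z′ , b′) → z ≈ z′ [ s ] → Joined (y , z , b) (y′ , z′ , b′)
    same y z b y′ z′ b′ ne e =
      let x , t , a = Starter.covers S y b y′ b′ (λ eq → ne (lift (y , b) (y′ , b′) eq e))
      in inj₁ x , (t , residue s z) , adjacent x t a
      where
      module _ (x : Fin N) (t : Bool) where
        forward : ∀ {u v z₁ z₂} → z ≈ z₁ [ s ] → z ≈ z₂ [ s ] → Consecutive L.point m (Starter.cycle S (+ toℕ x) t) u v →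
                  Consecutive point m (path (inj₁ x) (t , residue s z)) (proj₁ u , z₁ , proj₂ u) (proj₁ v , z₂ , proj₂ v)
        forward {u} {v} e₁ e₂ (next i lt p q) = next i lt (lift (K i) u p (≈-trans (residue-≈ s z) e₁))
          (lift (K (suc i)) v q (≈-trans (residue-≈ s z) e₂))
          where K = Starter.cycle S (+ toℕ x) t
        forward {u} {v} e₁ e₂ (wrap i lt p q) = wrap i lt (lift (K i) u p (≈-trans (residue-≈ s z) e₁))
          (lift (K 0) v q (≈-trans (residue-≈ s z) e₂))
          where K = Starter.cycle S (+ toℕ x) t
        adjacent : Adjacent L.point m (Starter.cycle S (+ toℕ x) t) (y , b) (y′ , b′) →
          Adjacent point m (path (inj₁ x) (t , residue s z)) (y , z , b) (y′ , z′ , b′)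
        adjacent (inj₁ c) = inj₁ (forward ≈-refl e c)
        adjacent (inj₂ c) = inj₂ (forward e ≈-refl c)

    not-both : ∀ d {z z′} → z′ - z ≈ step d [ s ] → C.special d z ∧ C.special d z′ ≡ false
    not-both d {z} {z′} e = go (C.special d z) refl
      where
      l : ∀ z z′ d → z′ - (z + d) ≡ (z′ - z) - d
      l = solve-∀
      go : ∀ c → C.special d z ≡ c → c ∧ C.special d z′ ≡ false
      go false _  = refl
      go true  eq = trans (C.special-cong d (≈-by e (l z z′ (step d)))) (C.special-d d z eq)

    ∧-swap : ∀ a b → a ∧ b ≡ false → b ∧ a ≡ false
    ∧-swap false false _ = refl
    ∧-swap false true  _ = refl
    ∧-swap true  false _ = refl

    fibre : ∀ y z b y′ z′ b′ d → y ≈ y′ [ N ] → z′ - z ≈ step d + step d [ s ] → Joined (y , z , b) (y′ , z′ , b′)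
    fibre y z b y′ z′ b′ d e e′ = go (ends-meet (C.special d z) (C.κ d z) (C.special d z′) (C.κ d z′) b b′
      (apart (C.special d z) refl) alternate)
      where
      l : ∀ z z′ d → z′ - (z + d + d) ≡ (z′ - z) - (d + d)
      l = solve-∀
      z′≈ : z′ ≈ z + step d + step d [ s ]
      z′≈ = ≈-by e′ (l z z′ (step d))
      apart : ∀ c → C.special d z ≡ c → c ∧ C.special d z′ ≡ false
      apart false _  = refl
      apart true  eq = trans (C.special-cong d z′≈) (C.special-2d d z eq)
      alternate : C.special d z ≡ false → C.special d z′ ≡ false → C.κ d z′ ≡ not (C.κ d z)
      alternate p q = trans (C.κ-cong d z′≈) (C.κ-2d d z p (trans (C.special-cong d (≈-sym z′≈)) q))
      go : ∃ (λ u → ∃ λ j → b ≡ endAt u (d , j) z × b′ ≡ not (endAt u (d , j) z′)) → Joined (y , z , b) (y′ , z′ , b′)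
      go (u , j , p , q) =
        let x , e₀ = represent-at {N} (zigzag (position u f)) y
        in rim u x (d , j) (z + step d) e₀ (≈-trans e₀ e) (≈-reflexive (l₁ z (step d))) (≈-sym z′≈) (sym p) (sym q)
        where
        l₁ : ∀ z d → z + d - d ≡ z
        l₁ = solve-∀

    Shift : Bool → Fin g → ℤ → ℤ → Set
    Shift τ d z z′ = z + sign τ (step d) ≈ z′ [ s ]

    shift-back : ∀ τ d z z′ → Shift τ d z z′ → Shift (not τ) d z′ z
    shift-back true  d z z′ e = ≈-by⁻ e (l z z′ (step d))
      where l : ∀ z z′ d → z′ + - d - z ≡ z′ - (z + d)
            l = solve-∀
    shift-back false d z z′ e = ≈-by⁻ e (l z z′ (step d))
      where l : ∀ z z′ d → z′ + d - z ≡ z′ - (z + - d)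
            l = solve-∀

    shift-apart : ∀ τ d z z′ → Shift τ d z z′ → C.special d z ∧ C.special d z′ ≡ false
    shift-apart true  d z z′ e = not-both d (≈-by⁻ e (l z z′ (step d)))
      where l : ∀ z z′ d → (z′ - z) - d ≡ z′ - (z + d)
            l = solve-∀
    shift-apart false d z z′ e = ∧-swap (C.special d z′) (C.special d z) (not-both d (≈-by e (l z z′ (step d))))
      where l : ∀ z z′ d → (z - z′) - d ≡ (z + - d) - z′
            l = solve-∀

    shift-true : ∀ d z z′ → Shift true d z z′ → z′ - z ≈ step d [ s ]
    shift-true d z z′ e = ≈-by⁻ e (l z z′ (step d))
      where l : ∀ z z′ d → (z′ - z) - d ≡ z′ - (z + d)
            l = solve-∀

    shift-false : ∀ d z z′ → Shift false d z z′ → z - z′ ≈ step d [ s ]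
    shift-false d z z′ e = ≈-by e (l z z′ (step d))
      where l : ∀ z z′ d → (z - z′) - d ≡ (z + - d) - z′
            l = solve-∀

    -- Read upwards, ordinary steps move by d on the side `true` and by -d on the side `false`, so
    -- the sign τ chooses the side. In the last step both signs occur on both sides, which share the
    -- pairs of bits by `ends-link`.
    rising : ∀ τ y z b y′ z′ b′ d → Shift τ d z z′ → Twin f N y y′ → Joined (y , z , b) (y′ , z′ , b′)
    rising true y z b y′ z′ b′ d sh (middle r r′) =
      let x , p , p′ = place r in Joined-sym (spoke true x (d , b′) p′ p (shift-true d z z′ sh) refl)
    rising false y z b y′ z′ b′ d sh (middle r r′) =
      let x , p , p′ = place r′ in spoke false x (d , not b) p
        (≈-trans (≈-reflexive (cong (λ i → + toℕ x + zigzag (suc (suc i))) (+-identityʳ f))) p′) (shift-false d z z′ sh)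
          (not-involutive b)
    rising τ y z b y′ z′ b′ d sh (outer o lt r r′) = go (m≤n⇒m<n∨m≡n lt)
      where
      up-position : ∀ (x : Fin N) → + toℕ x + zigzag (suc (f ∸ suc o)) ≈ y′ [ N ] →
        + toℕ x + zigzag (position true o) ≈ y′ [ N ]
      up-position x = ≈-trans (≈-reflexive (cong (λ i → + toℕ x + zigzag i) (+-∸-assoc 1 lt)))
      down-position : ∀ (x : Fin N) → + toℕ x + zigzag (suc (suc (suc f) ℕ.+ o)) ≈ y′ [ N ] →
        + toℕ x + zigzag (position false (suc o)) ≈ y′ [ N ]
      down-position x = ≈-trans (≈-reflexive (cong (λ i → + toℕ x + zigzag i) (+-suc (suc (suc f)) o)))
      long : ∀ τ → Shift τ d z z′ → suc o < f → Joined (y , z , b) (y′ , z′ , b′)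
      long true sh lt′ = let x , p , p′ = place r in Joined-sym (stretch true x (d , b′ xor b) o lt′ (up-position x p′) p (shift-true d z z′ sh) refl)
      long false sh lt′ = let x , p , p′ = place r′ in stretch false x (d , b xor b′) o lt′ p (down-position x p′) (shift-false d z z′ sh) refl
      last : suc o ≡ f → Joined (y , z , b) (y′ , z′ , b′)
      last refl = choose (ends-link τ (C.special d z) (C.κ d z) (C.special d z′) (C.κ d z′) b b′ (shift-apart τ d z z′ sh))
        where
        choose : ∃ (λ j → (b ≡ not τ xor endAt true (d , j) z × b′ ≡ not τ xor innAt true (d , j) z′) ⊎
          (b ≡ τ xor innAt false (d , j) z × b′ ≡ τ xor endAt false (d , j) z′)) →
                 Joined (y , z , b) (y′ , z′ , b′)
        choose (j , inj₁ (q , q′)) = let x , p , p′ = place r in Joined-sym (link true x (d , j) (not τ) z′ (up-position x p′) p (shift-back τ d z z′ sh) q′ q)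
        choose (j , inj₂ (q , q′)) = let x , p , p′ = place r′ in link false x (d , j) τ z p (down-position x p′) sh q q′
      go : suc o < f ⊎ suc o ≡ f → Joined (y , z , b) (y′ , z′ , b′)
      go (inj₁ lt′) = long τ sh lt′
      go (inj₂ eq)  = last eq

    as-shift : ∀ {z z′} → Distance g +_ z z′ → ∃ λ τ → ∃ λ d → Shift τ d z z′
    as-shift {z} {z′} (distance d (inj₁ e)) = true , d , ≈-by⁻ e (l z z′ (step d))
      where l : ∀ z z′ d → (z + d) - z′ ≡ d - (z′ - z)
            l = solve-∀
    as-shift {z} {z′} (distance d (inj₂ e)) = false , d , ≈-by e (l z z′ (step d))
      where l : ∀ z z′ d → (z + - d) - z′ ≡ (z - z′) - d
            l = solve-∀

    cover : Cover (N ℕ.* (s ℕ.* 2)) m (2 ℕ.* s) (N ℕ.+ N ℕ.* (g ℕ.* 2))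
    cover = record
      { Vertex = Vertex ; Factor = Factor ; Part = Part
      ; enc = point ; enc-onto = point-onto
      ; factors = enum-⊎ enum-Fin (enum-× enum-Fin (enum-× enum-Fin enum-Bool)) ; parts = enum-× enum-Bool enum-Fin
      ; path = path
      ; spans = spans
      ; covers = λ { (y , z , b) (y′ , z′ , b′) ne → covers y z b y′ z′ b′ ne (z ≈? z′) (y ≈? y′) }
      }
      where
      across : ∀ y z b y′ z′ b′ → (∃ λ τ → ∃ λ d → Shift τ d z z′) → Rise (suc f) y y′ ⊎ Rise (suc f) y′ y →
        Joined (y , z , b) (y′ , z′ , b′)
      across y z b y′ z′ b′ (τ , d , sh) (inj₁ r) = rising τ y z b y′ z′ b′ d sh (twin r)
      across y z b y′ z′ b′ (τ , d , sh) (inj₂ r) = Joined-sym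
        (rising (not τ) y′ z′ b′ y z b d (shift-back τ d z z′ sh) (twin r))
      inside : ∀ y z b y′ z′ b′ → y ≈ y′ [ N ] → Distance g (λ a → + a + + a) z z′ → Joined (y , z , b) (y′ , z′ , b′)
      inside y z b y′ z′ b′ e (distance d (inj₁ e′)) = fibre y z b y′ z′ b′ d e e′
      inside y z b y′ z′ b′ e (distance d (inj₂ e′)) = Joined-sym (fibre y′ z′ b′ y z b d (≈-sym e) e′)
      covers : ∀ y z b y′ z′ b′ → point (y , z , b) ≢ point (y′ , z′ , b′) → Dec (z ≈ z′ [ s ]) → Dec (y ≈ y′ [ N ]) →
        Joined (y , z , b) (y′ , z′ , b′)
      covers y z b y′ z′ b′ ne (yes e) _       = same y z b y′ z′ b′ ne e
      covers y z b y′ z′ b′ ne (no ¬e) (yes e) = inside y z b y′ z′ b′ e (double-distance g z z′ ¬e)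
      covers y z b y′ z′ b′ ne (no ¬e) (no ¬e′) = across y z b y′ z′ b′ (as-shift (single-distance g z z′ ¬e))
        (rises (suc f) y y′ ¬e′)

-- Choosing the construction by parities

open Counting
open Constructions
open import Data.Nat using (_+_; _*_)
open import Data.Nat.Divisibility using (_∣_; divides)
open import Data.Nat.Tactic.RingSolver using (solve-∀)

finish : ∀ {n m t n′ m′ t′ h} → Cover n′ m′ t′ h → n ≡ t * m → m ≡ m′ → t ≡ t′ → n′ ≡ t′ * m′ → n′ ≡ h * 2 → 2 ≤ m′ →
         ∀ I → HasCmFactorization n m I
finish C refl refl refl refl e le = cover⇒factorization C refl e le

starter : ∀ e → Starter (suc (dbl (suc (suc e)))) (suc (suc (suc e)) + suc (suc e))
-- For length five there is just one level between the middle and the last one, which would need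
-- both values of `β₂` in the general pattern.
starter zero    = ShortStarter.starter
starter (suc e) = LongStarter.starter e

odd-product : ∀ a b → suc (dbl a) * suc (dbl b) ≡ suc (dbl (b + a * suc (dbl b)))
odd-product a b = trans (cong₂ (λ x y → suc x * suc y) (dbl≡+ a) (dbl≡+ b))
  (trans (l a b) (sym (trans (cong suc (dbl≡+ (b + a * suc (dbl b))))
    (cong (λ x → suc (b + a * suc x + (b + a * suc x))) (dbl≡+ b)))))
  where l : ∀ a b → suc (a + a) * suc (b + b) ≡ suc (b + a * suc (b + b) + (b + a * suc (b + b)))
        l = solve-∀

four-divides : ∀ n t l → n ≡ t * dbl (dbl (suc l)) → ∀ I → HasCmFactorization n (dbl (dbl (suc l))) I
four-divides n zero l refl I = [] , λ ()
four-divides n (suc t) l eq = finish (FourDividesLength.cover l (suc t)) eq (dbl≡+ μ) refl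
  (trans (cong (μ *_) (dbl≡+ (suc t))) (l₁ μ (suc t)))
    (trans (cong₂ _*_ (dbl≡+ (suc l)) (dbl≡+ (suc t))) (l₂ (suc l) (suc t))) (s≤s (s≤s z≤n))
  where
  μ = dbl (suc l)
  l₁ : ∀ μ t → μ * (t + t) ≡ t * (μ + μ)
  l₁ = solve-∀
  l₂ : ∀ l t → (l + l) * (t + t) ≡ l * (t * 2) * 2
  l₂ = solve-∀

even-cycles : ∀ n t μ → Halved μ → Halved t → 3 ≤ μ → n ≡ t * dbl μ → ∀ I → HasCmFactorization n (dbl μ) I
even-cycles n t _ (even (suc l)) _ _ eq = four-divides n t l eq
even-cycles n _ _ (odd zero) _ (s≤s ()) _ I
even-cycles n _ _ (odd (suc f)) (even zero) _ refl I = [] , λ ()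
even-cycles n _ _ (odd (suc f)) (even (suc τ)) _ eq = finish (EvenlyManyCycles.cover f (suc τ)) eq (dbl≡+ μ) refl
  (trans (cong (μ *_) (dbl≡+ (dbl (suc τ)))) (l₁ μ (dbl (suc τ))))
    (trans (cong (μ *_) (trans (dbl≡+ (dbl (suc τ))) (cong (λ t → t + t) (dbl≡+ (suc τ))))) (l₂ μ (suc τ))) (s≤s (s≤s z≤n))
  where
  μ = suc (dbl (suc f))
  l₁ : ∀ μ t → μ * (t + t) ≡ t * (μ + μ)
  l₁ = solve-∀
  l₂ : ∀ μ τ → μ * ((τ + τ) + (τ + τ)) ≡ μ * (τ * 2) * 2
  l₂ = solve-∀
even-cycles n _ _ (odd (suc f)) (odd h) _ eq = finish (OddlyManyCycles.cover f h) eq (dbl≡+ μ)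
  (trans (cong suc (dbl≡+ h)) (l₁ h))
  (trans (cong (_* 2) (trans (OddlyManyCycles.N≡ f h) (cong (λ x → suc x * μ) (dbl≡+ h)))) (l₂ h μ)) refl (s≤s (s≤s z≤n))
  where
  μ = suc (dbl (suc f))
  l₁ : ∀ h → suc (h + h) ≡ h * 2 + 1
  l₁ = solve-∀
  l₂ : ∀ h μ → suc (h + h) * μ * 2 ≡ (h * 2 + 1) * (μ + μ)
  l₂ = solve-∀

odd-cycles : ∀ n a e → Halved a → n ≡ dbl a * suc (dbl (suc (suc e))) → ∀ I →
  HasCmFactorization n (suc (dbl (suc (suc e)))) I
odd-cycles n _ e (even zero) refl I = [] , λ ()
odd-cycles n _ e (even (suc L)) eq = finish (FourDividesNumber.cover e L) eq m≡ (t≡ T)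
  (trans (cong (N *_) (dbl≡+ T)) (trans (l₁ N T) (cong (2 * T *_) m≡)))
    (trans (cong (N *_) (trans (dbl≡+ T) (cong (λ t → t + t) (dbl≡+ (suc L))))) (l₂ N (suc L))) (s≤s (s≤s z≤n))
  where
  T = dbl (suc L)
  N = suc (dbl (suc (suc e)))
  m≡ : N ≡ suc (suc (suc e)) + suc (suc e)
  m≡ = cong suc (dbl≡+ (suc (suc e)))
  t≡ : ∀ T → dbl T ≡ 2 * T
  t≡ T = trans (dbl≡+ T) (cong (T +_) (sym (+-identityʳ T)))
  l₁ : ∀ N T → N * (T + T) ≡ 2 * T * N
  l₁ = solve-∀
  l₂ : ∀ N L → N * ((L + L) + (L + L)) ≡ N * (2 * L) * 2
  l₂ = solve-∀
odd-cycles n _ e (odd g) eq = finish (TwiceOddNumber.cover e g (starter e)) eq m≡ (t≡ s)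
  (trans (l₁ N s) (cong (2 * s *_) m≡)) (trans (cong (λ x → N * (suc x * 2)) (dbl≡+ g)) (l₂ N g)) (s≤s (s≤s z≤n))
  where
  s = suc (dbl g)
  N = suc (dbl (suc (suc e)))
  m≡ : N ≡ suc (suc (suc e)) + suc (suc e)
  m≡ = cong suc (dbl≡+ (suc (suc e)))
  t≡ : ∀ T → dbl T ≡ 2 * T
  t≡ T = trans (dbl≡+ T) (cong (T +_) (sym (+-identityʳ T)))
  l₁ : ∀ N s → N * (s * 2) ≡ 2 * s * N
  l₁ = solve-∀
  l₂ : ∀ N g → N * (suc (g + g) * 2) ≡ (N + N * (g * 2)) * 2
  l₂ = solve-∀

divides⇒factorization : ∀ n m t → 2 ∣ n → Halved m → Halved t → 5 ≤ m → n ≡ t * m → ∀ I → HasCmFactorization n m I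
divides⇒factorization n _ t _ (even μ) ht 5≤m eq = even-cycles n t μ (halve μ) ht (dbl-cancel-< {2} {μ} 5≤m) eq
divides⇒factorization n _ _ _ (odd (suc (suc e))) (even a) _ eq = odd-cycles n a e (halve a) eq
-- An odd number of odd cycles would have an odd number of vertices.
divides⇒factorization n _ _ (divides q n≡q2) (odd (suc (suc e))) (odd a) _ eq =
  contradiction (trans (sym (trans n≡q2 (trans (l q) (sym (dbl≡+ q))))) (trans eq (odd-product a (suc (suc e)))))
    (dbl-odd q _)
  where l : ∀ q → q * 2 ≡ q + q
        l = solve-∀
divides⇒factorization n _ _ _ (odd zero) _ (s≤s ()) _
divides⇒factorization n _ _ _ (odd (suc zero)) _ (s≤s (s≤s (s≤s ()))) _

theorem1p2 : (n m : ℕ) → 2 ∣ n → 5 ≤ m → (¬ (2 ∣ m) → n ≢ 4 * m) →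
    (I : PerfectMatching n) → (HasCmFactorization n m I ⇔ m ∣ n)
theorem1p2 n m 2∣n 5≤m _ I = mk⇔ (factorization⇒divides I)
  λ { (divides t eq) → divides⇒factorization n m t 2∣n (halve m) (halve t) 5≤m eq I }
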